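{- There is a constant $k_0$ such that, for every $\varepsilon>0$ and all integers $n$ and $k$ with $n\geq k\geq \max\{\varepsilon^{ -121},k_0\}$, all $(1/2+\varepsilon)$-subgraphs of $C_n^k$ are Hamiltonian.
   Context: $C_n^k$ is the $k$th power of the cycle $C_n$ on $n$ vertices: its vertex set is that of $C_n$ (identified with $\mathbb{Z}/n\mathbb{Z}$), and two distinct vertices are adjacent if and only if their distance in $C_n$ is at most $k$. For a real number $\beta$, a subgraph $H$ of a graph $G$ is a $\beta$-subgraph of $G$ if $d_H(v)\geq \beta\, d_G(v)$ for all $v\in V(G)$ (in particular $H$ is spanning). A graph is Hamiltonian if it contains a Hamilton cycle. -}

module Defs where

open import Data.Fin using (Fin; toℕ)
open import Data.Fin.Permutation using (Permutation′; _⟨$⟩ʳ_)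
import Data.Fin.Properties as Fin
open import Data.Integer using (+_)
open import Data.List using (length; filter; allFin)
open import Data.Nat as ℕ using (ℕ; zero; suc)
import Data.Nat.Properties as ℕ
open import Data.Product using (Σ-syntax; ∃-syntax; _×_; _,_)
open import Data.Rational as ℚ using (ℚ; 0ℚ; 1ℚ; ½; ∣_∣)
import Data.Rational.Properties as ℚ
open import Data.Rational.Solver using (module +-*-Solver)
open import Data.Sum using (_⊎_; swap)
open import Relation.Binary.PropositionalEquality
open import Relation.Nullary using (Dec; ¬_)
open import Relation.Nullary.Decidable using (map′; _×-dec_; _⊎-dec_; ¬?)

IsCauchy : (ℕ → ℚ) → Set
IsCauchy x = ∀ (e : ℚ) → 0ℚ ℚ.< e →
  ∃[ N ] (∀ m n → N ℕ.≤ m → N ℕ.≤ n → ∣ x m ℚ.- x n ∣ ℚ.< e)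

-- Reals are Cauchy sequences of rationals, not quotiented; the order below and
-- the field operations respect the usual equivalence of Cauchy sequences.
record ℝ : Set where
  constructor mkℝ
  field
    seq    : ℕ → ℚ
    cauchy : IsCauchy seq

open ℝ public

infix 4 _<_ _≤_

_<_ : ℝ → ℝ → Set
x < y = ∃[ δ ] 0ℚ ℚ.< δ × ∃[ N ] (∀ n → N ℕ.≤ n → seq x n ℚ.+ δ ℚ.≤ seq y n)

_≤_ : ℝ → ℝ → Set
x ≤ y = ¬ (y < x)

fromℚ : ℚ → ℝ
fromℚ q = mkℝ (λ _ → q) λ e 0<e →
  0 , λ _ _ _ _ → subst (ℚ._< e) (cong ∣_∣ (sym (ℚ.+-inverseʳ q))) 0<e

fromℕ : ℕ → ℝ
fromℕ n = fromℚ (+ n ℚ./ 1)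

private
  open +-*-Solver

  pos* : ∀ {p q} → 0ℚ ℚ.< p → 0ℚ ℚ.< q → 0ℚ ℚ.< p ℚ.* q
  pos* {p} {q} 0<p 0<q =
    ℚ.positive⁻¹ (p ℚ.* q) {{ℚ.pos*pos⇒pos p {{ℚ.positive 0<p}} q {{ℚ.positive 0<q}}}}

  half-pos : ∀ {e} → 0ℚ ℚ.< e → 0ℚ ℚ.< e ℚ.* ½
  half-pos 0<e = pos* 0<e (ℚ.positive⁻¹ ½)

  halves : ∀ e → e ℚ.* ½ ℚ.+ e ℚ.* ½ ≡ e
  halves e = trans (sym (ℚ.*-distribˡ-+ e ½ ½)) (ℚ.*-identityʳ e)

  *-mono-≤ : ∀ {p q r s} → 0ℚ ℚ.≤ p → 0ℚ ℚ.≤ s → p ℚ.≤ q → r ℚ.≤ s →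
             p ℚ.* r ℚ.≤ q ℚ.* s
  *-mono-≤ {p} {q} {r} {s} 0≤p 0≤s p≤q r≤s = ℚ.≤-trans
    (ℚ.*-monoˡ-≤-nonNeg p {{ℚ.nonNegative 0≤p}} r≤s)
    (ℚ.*-monoʳ-≤-nonNeg s {{ℚ.nonNegative 0≤s}} p≤q)

  telescope : ∀ p q r → p ℚ.- r ≡ (p ℚ.- q) ℚ.+ (q ℚ.- r)
  telescope = solve 3 (λ p q r → p :- r := (p :- q) :+ (q :- r)) refl

  x*yz≡y*xz : ∀ x y z → x ℚ.* (y ℚ.* z) ≡ y ℚ.* (x ℚ.* z)
  x*yz≡y*xz x y z = begin
    x ℚ.* (y ℚ.* z)  ≡⟨ ℚ.*-assoc x y z ⟨
    x ℚ.* y ℚ.* z    ≡⟨ cong (ℚ._* z) (ℚ.*-comm x y) ⟩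
    y ℚ.* x ℚ.* z    ≡⟨ ℚ.*-assoc y x z ⟩
    y ℚ.* (x ℚ.* z)  ∎
    where open ≡-Reasoning

  *-distribˡ-- : ∀ x y z → x ℚ.* y ℚ.- x ℚ.* z ≡ x ℚ.* (y ℚ.- z)
  *-distribˡ-- x y z = begin
    x ℚ.* y ℚ.- x ℚ.* z         ≡⟨ cong (x ℚ.* y ℚ.+_) (ℚ.neg-distribʳ-* x z) ⟩
    x ℚ.* y ℚ.+ x ℚ.* (ℚ.- z)   ≡⟨ ℚ.*-distribˡ-+ x y (ℚ.- z) ⟨
    x ℚ.* (y ℚ.- z)             ∎
    where open ≡-Reasoning

  scaled-< : ∀ {a A b e} (0<A : 0ℚ ℚ.< A) → 0ℚ ℚ.≤ b → a ℚ.≤ A →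
             b ℚ.< e ℚ.* (ℚ.1/ A) {{ℚ.>-nonZero 0<A}} → a ℚ.* b ℚ.< e
  scaled-< {a} {A} {b} {e} 0<A 0≤b a≤A b<e/A = begin-strict
    a ℚ.* b                  ≤⟨ ℚ.*-monoʳ-≤-nonNeg b {{ℚ.nonNegative 0≤b}} a≤A ⟩
    A ℚ.* b                  <⟨ ℚ.*-monoʳ-<-pos A {{ℚ.positive 0<A}} b<e/A ⟩
    A ℚ.* (e ℚ.* 1/A)        ≡⟨ x*yz≡y*xz A e 1/A ⟩
    e ℚ.* (A ℚ.* 1/A)        ≡⟨ cong (e ℚ.*_) (ℚ.*-inverseʳ A {{ℚ.>-nonZero 0<A}}) ⟩
    e ℚ.* 1ℚ                 ≡⟨ ℚ.*-identityʳ e ⟩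
    e                        ∎
    where
    open ℚ.≤-Reasoning
    1/A : ℚ
    1/A = (ℚ.1/ A) {{ℚ.>-nonZero 0<A}}

  1/-pos : ∀ {A} (0<A : 0ℚ ℚ.< A) → 0ℚ ℚ.< (ℚ.1/ A) {{ℚ.>-nonZero 0<A}}
  1/-pos {A} 0<A =
    ℚ.positive⁻¹ ((ℚ.1/ A) {{ℚ.>-nonZero 0<A}}) {{ℚ.1/pos⇒pos A {{ℚ.positive 0<A}}}}

  bounded : ∀ (x : ℝ) → ∃[ N ] ∃[ B ] 0ℚ ℚ.< B × (∀ n → N ℕ.≤ n → ∣ seq x n ∣ ℚ.≤ B)
  bounded x with cauchy x 1ℚ (ℚ.positive⁻¹ 1ℚ)
  ... | N , close = N , 1ℚ ℚ.+ ∣ seq x N ∣ , pos , bound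
    where
    open ℚ.≤-Reasoning
    pos : 0ℚ ℚ.< 1ℚ ℚ.+ ∣ seq x N ∣
    pos = ℚ.+-mono-<-≤ (ℚ.positive⁻¹ 1ℚ) (ℚ.0≤∣p∣ (seq x N))
    bound : ∀ n → N ℕ.≤ n → ∣ seq x n ∣ ℚ.≤ 1ℚ ℚ.+ ∣ seq x N ∣
    bound n N≤n = begin
      ∣ seq x n ∣
        ≡⟨ cong ∣_∣ (solve 2 (λ a b → a := (a :- b) :+ b) refl (seq x n) (seq x N)) ⟩
      ∣ (seq x n ℚ.- seq x N) ℚ.+ seq x N ∣
        ≤⟨ ℚ.∣p+q∣≤∣p∣+∣q∣ (seq x n ℚ.- seq x N) (seq x N) ⟩
      ∣ seq x n ℚ.- seq x N ∣ ℚ.+ ∣ seq x N ∣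
        ≤⟨ ℚ.+-monoˡ-≤ ∣ seq x N ∣ (ℚ.<⇒≤ (close n N N≤n ℕ.≤-refl)) ⟩
      1ℚ ℚ.+ ∣ seq x N ∣
        ∎

  +-cauchy : ∀ (x y : ℝ) → IsCauchy (λ n → seq x n ℚ.+ seq y n)
  +-cauchy x y e 0<e
    with cauchy x (e ℚ.* ½) (half-pos 0<e) | cauchy y (e ℚ.* ½) (half-pos 0<e)
  ... | M , f | N , g = M ℕ.⊔ N , λ m n p q → begin-strict
    ∣ (seq x m ℚ.+ seq y m) ℚ.- (seq x n ℚ.+ seq y n) ∣
      ≡⟨ cong ∣_∣ (solve 4 (λ a b c d → (a :+ b) :- (c :+ d) := (a :- c) :+ (b :- d))
                   refl (seq x m) (seq y m) (seq x n) (seq y n)) ⟩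
    ∣ (seq x m ℚ.- seq x n) ℚ.+ (seq y m ℚ.- seq y n) ∣
      ≤⟨ ℚ.∣p+q∣≤∣p∣+∣q∣ (seq x m ℚ.- seq x n) (seq y m ℚ.- seq y n) ⟩
    ∣ seq x m ℚ.- seq x n ∣ ℚ.+ ∣ seq y m ℚ.- seq y n ∣
      <⟨ ℚ.+-mono-< (f m n (ℕ.m⊔n≤o⇒m≤o M N p) (ℕ.m⊔n≤o⇒m≤o M N q))
                    (g m n (ℕ.m⊔n≤o⇒n≤o M N p) (ℕ.m⊔n≤o⇒n≤o M N q)) ⟩
    e ℚ.* ½ ℚ.+ e ℚ.* ½
      ≡⟨ halves e ⟩
    e ∎
    where open ℚ.≤-Reasoning

  product-close : ∀ a b c d {A B} e (0<A : 0ℚ ℚ.< A) (0<B : 0ℚ ℚ.< B) →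
    ∣ a ∣ ℚ.≤ A → ∣ d ∣ ℚ.≤ B →
    ∣ b ℚ.- d ∣ ℚ.< e ℚ.* ½ ℚ.* (ℚ.1/ A) {{ℚ.>-nonZero 0<A}} →
    ∣ a ℚ.- c ∣ ℚ.< e ℚ.* ½ ℚ.* (ℚ.1/ B) {{ℚ.>-nonZero 0<B}} →
    ∣ a ℚ.* b ℚ.- c ℚ.* d ∣ ℚ.< e
  product-close a b c d {A} {B} e 0<A 0<B a≤A d≤B b≈d a≈c = begin-strict
    ∣ a ℚ.* b ℚ.- c ℚ.* d ∣
      ≡⟨ cong ∣_∣ (telescope (a ℚ.* b) (a ℚ.* d) (c ℚ.* d)) ⟩
    ∣ (a ℚ.* b ℚ.- a ℚ.* d) ℚ.+ (a ℚ.* d ℚ.- c ℚ.* d) ∣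
      ≡⟨ cong₂ (λ u v → ∣ (a ℚ.* b ℚ.- a ℚ.* d) ℚ.+ (u ℚ.- v) ∣) (ℚ.*-comm a d) (ℚ.*-comm c d) ⟩
    ∣ (a ℚ.* b ℚ.- a ℚ.* d) ℚ.+ (d ℚ.* a ℚ.- d ℚ.* c) ∣
      ≡⟨ cong₂ (λ u v → ∣ u ℚ.+ v ∣) (*-distribˡ-- a b d) (*-distribˡ-- d a c) ⟩
    ∣ a ℚ.* (b ℚ.- d) ℚ.+ d ℚ.* (a ℚ.- c) ∣
      ≤⟨ ℚ.∣p+q∣≤∣p∣+∣q∣ (a ℚ.* (b ℚ.- d)) (d ℚ.* (a ℚ.- c)) ⟩
    ∣ a ℚ.* (b ℚ.- d) ∣ ℚ.+ ∣ d ℚ.* (a ℚ.- c) ∣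
      ≡⟨ cong₂ ℚ._+_ (ℚ.∣p*q∣≡∣p∣*∣q∣ a (b ℚ.- d)) (ℚ.∣p*q∣≡∣p∣*∣q∣ d (a ℚ.- c)) ⟩
    ∣ a ∣ ℚ.* ∣ b ℚ.- d ∣ ℚ.+ ∣ d ∣ ℚ.* ∣ a ℚ.- c ∣
      <⟨ ℚ.+-mono-<
           (scaled-< {∣ a ∣} {A} {∣ b ℚ.- d ∣} {e ℚ.* ½} 0<A (ℚ.0≤∣p∣ (b ℚ.- d)) a≤A b≈d)
           (scaled-< {∣ d ∣} {B} {∣ a ℚ.- c ∣} {e ℚ.* ½} 0<B (ℚ.0≤∣p∣ (a ℚ.- c)) d≤B a≈c) ⟩
    e ℚ.* ½ ℚ.+ e ℚ.* ½
      ≡⟨ halves e ⟩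
    e ∎
    where open ℚ.≤-Reasoning

  *-cauchy : ∀ (x y : ℝ) → IsCauchy (λ n → seq x n ℚ.* seq y n)
  *-cauchy x y e 0<e =
    let K , A , 0<A , x≤A = bounded x
        L , B , 0<B , y≤B = bounded y
        M , f = cauchy x (e ℚ.* ½ ℚ.* (ℚ.1/ B) {{ℚ.>-nonZero 0<B}})
                  (pos* (half-pos 0<e) (1/-pos 0<B))
        N , g = cauchy y (e ℚ.* ½ ℚ.* (ℚ.1/ A) {{ℚ.>-nonZero 0<A}})
                  (pos* (half-pos 0<e) (1/-pos 0<A))
    in K ℕ.⊔ L ℕ.⊔ (M ℕ.⊔ N) , λ m n p q →
      let KL≤m = ℕ.m⊔n≤o⇒m≤o (K ℕ.⊔ L) (M ℕ.⊔ N) p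
          MN≤m = ℕ.m⊔n≤o⇒n≤o (K ℕ.⊔ L) (M ℕ.⊔ N) p
          KL≤n = ℕ.m⊔n≤o⇒m≤o (K ℕ.⊔ L) (M ℕ.⊔ N) q
          MN≤n = ℕ.m⊔n≤o⇒n≤o (K ℕ.⊔ L) (M ℕ.⊔ N) q
      in product-close (seq x m) (seq y m) (seq x n) (seq y n) e 0<A 0<B
           (x≤A m (ℕ.m⊔n≤o⇒m≤o K L KL≤m))
           (y≤B n (ℕ.m⊔n≤o⇒n≤o K L KL≤n))
           (g m n (ℕ.m⊔n≤o⇒n≤o M N MN≤m) (ℕ.m⊔n≤o⇒n≤o M N MN≤n))
           (f m n (ℕ.m⊔n≤o⇒m≤o M N MN≤m) (ℕ.m⊔n≤o⇒m≤o M N MN≤n))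

infixl 6 _+_
infixl 7 _*_
infixr 8 _^_

_+_ : ℝ → ℝ → ℝ
x + y = mkℝ (λ n → seq x n ℚ.+ seq y n) (+-cauchy x y)

_*_ : ℝ → ℝ → ℝ
x * y = mkℝ (λ n → seq x n ℚ.* seq y n) (*-cauchy x y)

_^_ : ℝ → ℕ → ℝ
x ^ zero  = fromℕ 1
x ^ suc m = x * x ^ m

-- The reciprocal of a positive real.  The sequence is shifted by the index N
-- contained in the proof of positivity, beyond which all terms are positive.
module Reciprocal (x : ℝ) (δ : ℚ) (0<δ : 0ℚ ℚ.< δ) (N : ℕ)
  (x≥δ : ∀ n → N ℕ.≤ n → 0ℚ ℚ.+ δ ℚ.≤ seq x n) where

  term : ℕ → ℚ
  term n = seq x (N ℕ.+ n)

  term≥δ : ∀ n → δ ℚ.≤ term n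
  term≥δ n = subst (ℚ._≤ term n) (ℚ.+-identityˡ δ) (x≥δ (N ℕ.+ n) (ℕ.m≤m+n N n))

  0<term : ∀ n → 0ℚ ℚ.< term n
  0<term n = ℚ.<-≤-trans 0<δ (term≥δ n)

  1/term : ℕ → ℚ
  1/term n = (ℚ.1/ term n) {{ℚ.>-nonZero (0<term n)}}

  private
    1/δ : ℚ
    1/δ = (ℚ.1/ δ) {{ℚ.>-nonZero 0<δ}}

    0<1/term : ∀ n → 0ℚ ℚ.< 1/term n
    0<1/term n = 1/-pos (0<term n)

    term-inverse : ∀ n → term n ℚ.* 1/term n ≡ 1ℚ
    term-inverse n = ℚ.*-inverseʳ (term n) {{ℚ.>-nonZero (0<term n)}}

    1/term≤1/δ : ∀ n → 1/term n ℚ.≤ 1/δ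
    1/term≤1/δ n = begin
      1/term n                       ≡⟨ ℚ.*-identityˡ (1/term n) ⟨
      1ℚ ℚ.* 1/term n                ≡⟨ cong (ℚ._* 1/term n) (ℚ.*-inverseˡ δ {{ℚ.>-nonZero 0<δ}}) ⟨
      1/δ ℚ.* δ ℚ.* 1/term n         ≤⟨ *-mono-≤ (ℚ.<⇒≤ (pos* (1/-pos 0<δ) 0<δ)) (ℚ.<⇒≤ (0<1/term n))
                                          (ℚ.*-monoˡ-≤-nonNeg 1/δ {{ℚ.nonNegative (ℚ.<⇒≤ (1/-pos 0<δ))}} (term≥δ n))
                                          ℚ.≤-refl ⟩
      1/δ ℚ.* term n ℚ.* 1/term n    ≡⟨ ℚ.*-assoc 1/δ (term n) (1/term n) ⟩
      1/δ ℚ.* (term n ℚ.* 1/term n)  ≡⟨ cong (1/δ ℚ.*_) (term-inverse n) ⟩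
      1/δ ℚ.* 1ℚ                     ≡⟨ ℚ.*-identityʳ 1/δ ⟩
      1/δ                            ∎
      where open ℚ.≤-Reasoning

    difference : ∀ m n → 1/term m ℚ.- 1/term n ≡ (1/term m ℚ.* 1/term n) ℚ.* (term n ℚ.- term m)
    difference m n = begin
      i ℚ.- j
        ≡⟨ cong₂ ℚ._-_ (ℚ.*-identityʳ i) (ℚ.*-identityʳ j) ⟨
      i ℚ.* 1ℚ ℚ.- j ℚ.* 1ℚ
        ≡⟨ cong₂ (λ u v → i ℚ.* u ℚ.- j ℚ.* v) (term-inverse n) (term-inverse m) ⟨
      i ℚ.* (term n ℚ.* j) ℚ.- j ℚ.* (term m ℚ.* i)
        ≡⟨ cong₂ ℚ._-_ (reorder i j (term n)) (trans (reorder j i (term m))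
             (cong (ℚ._* term m) (ℚ.*-comm j i))) ⟩
      (i ℚ.* j) ℚ.* term n ℚ.- (i ℚ.* j) ℚ.* term m
        ≡⟨ *-distribˡ-- (i ℚ.* j) (term n) (term m) ⟩
      (i ℚ.* j) ℚ.* (term n ℚ.- term m)
        ∎
      where
      open ≡-Reasoning
      reorder : ∀ i j a → i ℚ.* (a ℚ.* j) ≡ (i ℚ.* j) ℚ.* a
      reorder i j a = trans (cong (i ℚ.*_) (ℚ.*-comm a j)) (sym (ℚ.*-assoc i j a))
      i j : ℚ
      i = 1/term m
      j = 1/term n

    0<1/δ² : 0ℚ ℚ.< 1/δ ℚ.* 1/δ
    0<1/δ² = pos* (1/-pos 0<δ) (1/-pos 0<δ)

  1/term-cauchy : IsCauchy 1/term
  1/term-cauchy e 0<e with cauchy x _ (pos* 0<e (1/-pos 0<1/δ²))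
  ... | M , f = M , λ m n p q → begin-strict
    ∣ 1/term m ℚ.- 1/term n ∣
      ≡⟨ cong ∣_∣ (difference m n) ⟩
    ∣ (1/term m ℚ.* 1/term n) ℚ.* (term n ℚ.- term m) ∣
      ≡⟨ ℚ.∣p*q∣≡∣p∣*∣q∣ (1/term m ℚ.* 1/term n) (term n ℚ.- term m) ⟩
    ∣ 1/term m ℚ.* 1/term n ∣ ℚ.* ∣ term n ℚ.- term m ∣
      ≡⟨ cong (ℚ._* ∣ term n ℚ.- term m ∣)
           (ℚ.0≤p⇒∣p∣≡p (ℚ.<⇒≤ (pos* (0<1/term m) (0<1/term n)))) ⟩
    (1/term m ℚ.* 1/term n) ℚ.* ∣ term n ℚ.- term m ∣
      <⟨ scaled-< 0<1/δ² (ℚ.0≤∣p∣ (term n ℚ.- term m))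
           (*-mono-≤ (ℚ.<⇒≤ (0<1/term m)) (ℚ.<⇒≤ (1/-pos 0<δ)) (1/term≤1/δ m) (1/term≤1/δ n))
           (f (N ℕ.+ n) (N ℕ.+ m) (ℕ.m≤n⇒m≤o+n N q) (ℕ.m≤n⇒m≤o+n N p)) ⟩
    e ∎
    where open ℚ.≤-Reasoning

recip : (x : ℝ) → fromℕ 0 < x → ℝ
recip x (δ , 0<δ , N , x≥δ) = mkℝ 1/term 1/term-cauchy
  where open Reciprocal x δ 0<δ N x≥δ

record Graph (n : ℕ) : Set₁ where
  field
    Adj    : Fin n → Fin n → Set
    adj?   : ∀ u v → Dec (Adj u v)
    symm   : ∀ {u v} → Adj u v → Adj v u
    irrefl : ∀ {v} → ¬ Adj v v

open Graph public

degree : ∀ {n} → Graph n → Fin n → ℕ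
degree {n} G v = length (filter (adj? G v) (allFin n))

-- Both graphs have the vertex set Fin n, so the subgraph is spanning.
IsSubgraph : ∀ {n} → Graph n → Graph n → Set
IsSubgraph H G = ∀ {u v} → Adj H u v → Adj G u v

Is_-SubgraphOf : ∀ {n} → ℝ → Graph n → Graph n → Set
Is β -SubgraphOf H G =
  IsSubgraph H G × (∀ v → β * fromℕ (degree G v) ≤ fromℕ (degree H v))

infixr 5 _∷_

data Walk {n} (G : Graph n) : ℕ → Fin n → Fin n → Set where
  []  : ∀ {u} → Walk G 0 u u
  _∷_ : ∀ {l u v w} → Adj G u v → Walk G l v w → Walk G (suc l) u w

-- The distance, i.e. the least length of a walk, is at most k.
DistAtMost : ∀ {n} → Graph n → ℕ → Fin n → Fin n → Set
DistAtMost G k u v = ∃[ l ] l ℕ.≤ k × Walk G l u v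

private
  walk? : ∀ {n} (G : Graph n) l u v → Dec (Walk G l u v)
  walk? G zero    u v = map′ (λ { refl → [] }) (λ { [] → refl }) (u Fin.≟ v)
  walk? G (suc l) u v = map′
    (λ { (w , a , p) → a ∷ p })
    (λ { (a ∷ p) → _ , a , p })
    (Fin.any? (λ w → adj? G u w ×-dec walk? G l w v))

  distAtMost? : ∀ {n} (G : Graph n) k u v → Dec (DistAtMost G k u v)
  distAtMost? G k u v = map′
    (λ { (l , ℕ.s≤s l≤k , p) → l , l≤k , p })
    (λ { (l , l≤k , p) → l , ℕ.s≤s l≤k , p })
    (ℕ.anyUpTo? (λ l → walk? G l u v) (suc k))

  snoc : ∀ {n} {G : Graph n} {l u v w} → Walk G l u v → Adj G v w → Walk G (suc l) u w
  snoc []      b = b ∷ []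
  snoc (a ∷ p) b = a ∷ snoc p b

  reverse : ∀ {n} {G : Graph n} {l u v} → Walk G l u v → Walk G l v u
  reverse         []      = []
  reverse {G = G} (a ∷ p) = snoc (reverse p) (symm G a)

power : ∀ {n} → Graph n → ℕ → Graph n
power G k = record
  { Adj    = λ u v → u ≢ v × DistAtMost G k u v
  ; adj?   = λ u v → ¬? (u Fin.≟ v) ×-dec distAtMost? G k u v
  ; symm   = λ { (u≢v , l , l≤k , p) → ≢-sym u≢v , l , l≤k , reverse p }
  ; irrefl = λ { (v≢v , _) → v≢v refl }
  }

-- j = i + 1 in ℤ/nℤ.
Next : ∀ {n} → Fin n → Fin n → Set
Next {n} i j = (toℕ j ≡ suc (toℕ i)) ⊎ (suc (toℕ i) ≡ n × toℕ j ≡ 0)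

private
  next? : ∀ {n} (i j : Fin n) → Dec (Next i j)
  next? {n} i j =
    (toℕ j ℕ.≟ suc (toℕ i)) ⊎-dec ((suc (toℕ i) ℕ.≟ n) ×-dec (toℕ j ℕ.≟ 0))

-- The cycle Cₙ.  It is a genuine cycle for n ≥ 3; the condition i ≢ j only
-- excludes the loop at n = 1.
cycle : ∀ n → Graph n
cycle n = record
  { Adj    = λ i j → i ≢ j × (Next i j ⊎ Next j i)
  ; adj?   = λ i j → ¬? (i Fin.≟ j) ×-dec (next? i j ⊎-dec next? j i)
  ; symm   = λ { (i≢j , s) → ≢-sym i≢j , swap s }
  ; irrefl = λ { (i≢i , _) → i≢i refl }
  }

-- A Hamilton cycle is a copy of Cₙ through all n vertices, where n ≥ 3.
Hamiltonian : ∀ {n} → Graph n → Set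
Hamiltonian {n} G =
  3 ℕ.≤ n × Σ[ π ∈ Permutation′ n ]
    (∀ i j → Adj (cycle n) i j → Adj G (π ⟨$⟩ʳ i) (π ⟨$⟩ʳ j))

{-# OPTIONS --safe #-}

-- Cut the circle into blocks of P consecutive vertices and give the vertices of a
-- block the labels 0, …, P - 1 up to a rotation.  Within a cell of consecutive
-- blocks the rotations are chosen one at a time so that a fourth-moment potential
-- stays small; then, of the non-neighbours of any vertex, every label gets its
-- share.  Since the degree exceeds half of the window by a definite margin, the
-- graph restricted to any two labels satisfies Hall's condition: from a violating
-- set one could walk around the circle for ever without meeting enough vertices.
--
-- Labels 0, …, L are layers, joined successively by perfect matchings; the other
-- labels form a reserve.  Few reserve vertices are used to lead, block by block,
-- a strand from layer L back to layer 0, and each of the remaining ones, a spare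
-- vertex, is inserted between two layers by the matching of its stage.  Edges
-- between spare vertices are forbidden, so every orbit of the resulting permutation
-- passes through a strand.  Consecutive strands meet in a 4-cycle, and exchanging
-- its two pairs of opposite edges merges their orbits, until one cycle is left.
--
-- As k ≥ ε⁻¹²¹, one may replace ε by 1/Q with Q²⁰ ≤ k, which leaves room for all
-- block and cell sizes, polynomials in Q of smaller degree.
module Submission where

-- A degree slightly above half of the window makes any two nearby vertices share many neighbours,
-- but four prescribed vertices may share none, while the 4-cycles used for merging need vertices
-- adjacent to several corners at once. So the corners are not prescribed: averaging finds four
-- suitable ones among seven candidates of each block. Rotating whole blocks, instead of labelling
-- vertices one by one, keeps the layers balanced: on every initial segment their sizes differ by at
-- most one, which is all that the walk behind Hall's condition tolerates. The reserve is divided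
-- among the stages so thinly that it costs each matching at most `3 m` of a margin of `43 m`. The
-- exponent 20 is 13 + 6 + 1. With `P ≤ Q ^ 3`, equidistribution asks for
-- `m ≥ 2560 * 1024 * Q ^ 5 * P ^ 2`, for which `Q ^ 13` suffices; the radius of the window is
-- rounded down to a multiple of a unit of size at most `Q ^ 6`; one more factor `Q` pays for
-- shrinking the radius to about `n / 2` when the full window does not fit into the circle.

-- Finite sums, indicators and bounded search

module Sums where

  import Algebra.Properties.CommutativeSemigroup as Semigroup
  open import Data.Bool using (Bool; true; false; _∧_; _∨_; not; if_then_else_)
  open import Data.Empty using (⊥; ⊥-elim)
  open import Data.Nat
  open import Data.Nat.DivMod
  open import Data.Nat.Properties
  open import Data.Product using (∃-syntax; _×_; _,_)
  open import Data.Sum using (_⊎_; inj₁; inj₂)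
  open import Relation.Binary.PropositionalEquality
  open import Relation.Nullary using (¬_; yes; no)

  private module CommutativeSemigroup = Semigroup +-commutativeSemigroup

  -- Linear arithmetic by certificate: `l ≤ r` is a nonnegative combination of hypotheses assembled
  -- with `_⊕_` and `_⊗_`, `s` is the remaining slack, and the equation is an identity for the ring
  -- solver.
  certify : ∀ {x y l r} s → l ≤ r → x + r + s ≡ y + l → x ≤ y
  certify {x} {y} {l} {r} s l≤r eq = +-cancelʳ-≤ r x y
    (≤-trans (m≤m+n (x + r) s) (≤-trans (≤-reflexive eq) (+-monoʳ-≤ y l≤r)))

  infixr 5 _⊕_
  infixr 6 _⊗_

  _⊕_ : ∀ {a b c d} → a ≤ b → c ≤ d → a + c ≤ b + d
  _⊕_ = +-mono-≤

  _⊗_ : ∀ c {a b} → a ≤ b → c * a ≤ c * b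
  c ⊗ a≤b = *-monoʳ-≤ c a≤b

  ∑ : ℕ → (ℕ → ℕ) → ℕ
  ∑ zero    f = 0
  ∑ (suc n) f = ∑ n f + f n

  ∑-mono : ∀ n {f g : ℕ → ℕ} → (∀ i → i < n → f i ≤ g i) → ∑ n f ≤ ∑ n g
  ∑-mono zero    le = z≤n
  ∑-mono (suc n) le = +-mono-≤ (∑-mono n λ i i<n → le i (m<n⇒m<1+n i<n)) (le n ≤-refl)

  ∑-cong : ∀ n {f g : ℕ → ℕ} → (∀ i → i < n → f i ≡ g i) → ∑ n f ≡ ∑ n g
  ∑-cong n eq = ≤-antisym (∑-mono n λ i i<n → ≤-reflexive (eq i i<n))
                          (∑-mono n λ i i<n → ≤-reflexive (sym (eq i i<n)))

  interchange : ∀ a b c d → (a + b) + (c + d) ≡ (a + c) + (b + d)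
  interchange = CommutativeSemigroup.interchange

  +-swapʳ : ∀ a b c → a + b + c ≡ a + c + b
  +-swapʳ = CommutativeSemigroup.xy∙z≈xz∙y

  ∑-+ : ∀ n (f g : ℕ → ℕ) → ∑ n (λ i → f i + g i) ≡ ∑ n f + ∑ n g
  ∑-+ zero    f g = refl
  ∑-+ (suc n) f g = trans (cong (_+ (f n + g n)) (∑-+ n f g)) (interchange (∑ n f) (∑ n g) (f n) (g n))

  ∑-* : ∀ n c (f : ℕ → ℕ) → ∑ n (λ i → c * f i) ≡ c * ∑ n f
  ∑-* zero    c f = sym (*-zeroʳ c)
  ∑-* (suc n) c f = trans (cong (_+ c * f n) (∑-* n c f)) (sym (*-distribˡ-+ c (∑ n f) (f n)))

  ∑-const : ∀ n c → ∑ n (λ _ → c) ≡ n * c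
  ∑-const zero    c = refl
  ∑-const (suc n) c = trans (cong (_+ c) (∑-const n c)) (+-comm (n * c) c)

  ∑-zero : ∀ n {f : ℕ → ℕ} → (∀ i → i < n → f i ≡ 0) → ∑ n f ≡ 0
  ∑-zero n eq = trans (∑-cong n eq) (trans (∑-const n 0) (*-zeroʳ n))

  ∑-split : ∀ a b (f : ℕ → ℕ) → ∑ (a + b) f ≡ ∑ a f + ∑ b (λ j → f (a + j))
  ∑-split a zero    f = trans (cong (λ t → ∑ t f) (+-identityʳ a)) (sym (+-identityʳ (∑ a f)))
  ∑-split a (suc b) f = begin
    ∑ (a + suc b) f                                   ≡⟨ cong (λ t → ∑ t f) (+-suc a b) ⟩
    ∑ (a + b) f + f (a + b)                           ≡⟨ cong (_+ f (a + b)) (∑-split a b f) ⟩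
    ∑ a f + ∑ b (λ j → f (a + j)) + f (a + b)         ≡⟨ +-assoc (∑ a f) _ _ ⟩
    ∑ a f + (∑ b (λ j → f (a + j)) + f (a + b))       ∎
    where open ≡-Reasoning

  ∑-mono-range : ∀ {a b} (f : ℕ → ℕ) → a ≤ b → ∑ a f ≤ ∑ b f
  ∑-mono-range {a} f a≤b with m≤n⇒∃[o]m+o≡n a≤b
  ... | o , refl = ≤-trans (m≤m+n (∑ a f) _) (≤-reflexive (sym (∑-split a o f)))

  ∑-swap : ∀ a b (f : ℕ → ℕ → ℕ) → ∑ a (λ i → ∑ b (f i)) ≡ ∑ b (λ j → ∑ a (λ i → f i j))
  ∑-swap zero    b f = sym (∑-zero b λ _ _ → refl)
  ∑-swap (suc a) b f = trans (cong (_+ ∑ b (f a)) (∑-swap a b f))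
                             (sym (∑-+ b (λ j → ∑ a (λ i → f i j)) (f a)))

  ∑-blocks : ∀ a d (f : ℕ → ℕ) → ∑ (a * d) f ≡ ∑ a (λ b → ∑ d (λ j → f (b * d + j)))
  ∑-blocks zero    d f = refl
  ∑-blocks (suc a) d f = begin
    ∑ (d + a * d) f                                         ≡⟨ cong (λ t → ∑ t f) (+-comm d (a * d)) ⟩
    ∑ (a * d + d) f                                         ≡⟨ ∑-split (a * d) d f ⟩
    ∑ (a * d) f + ∑ d (λ j → f (a * d + j))                 ≡⟨ cong (_+ ∑ d (λ j → f (a * d + j))) (∑-blocks a d f) ⟩
    ∑ a (λ b → ∑ d (λ j → f (b * d + j))) + ∑ d (λ j → f (a * d + j)) ∎
    where open ≡-Reasoning

  ∑-term : ∀ n (f : ℕ → ℕ) {i} → i < n → f i ≤ ∑ n f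
  ∑-term (suc n) f {i} i<1+n with m≤n⇒m<n∨m≡n (s≤s⁻¹ i<1+n)
  ... | inj₁ i<n  = ≤-trans (∑-term n f i<n) (m≤m+n _ _)
  ... | inj₂ refl = m≤n+m _ _

  ∑-single : ∀ n (f : ℕ → ℕ) {i} → i < n → (∀ j → j < n → j ≢ i → f j ≡ 0) → ∑ n f ≡ f i
  ∑-single (suc n) f {i} i<1+n others with m≤n⇒m<n∨m≡n (s≤s⁻¹ i<1+n)
  ... | inj₁ i<n  = trans (cong (∑ n f +_) (others n ≤-refl λ n≡i → <-irrefl (sym n≡i) i<n))
                   (trans (+-identityʳ _) (∑-single n f i<n λ j j<n → others j (m<n⇒m<1+n j<n)))
  ... | inj₂ refl = cong (_+ f n) (∑-zero n λ j j<n → others j (m<n⇒m<1+n j<n) λ j≡n → <-irrefl j≡n j<n)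

  ∑-mono-< : ∀ n {f g : ℕ → ℕ} → 0 < n → (∀ i → i < n → f i < g i) → ∑ n f < ∑ n g
  ∑-mono-< (suc n) _ lt = +-mono-≤-< (∑-mono n λ i i<n → <⇒≤ (lt i (m<n⇒m<1+n i<n))) (lt n ≤-refl)

  -- The pigeonhole principle with the division by `n` cleared. If the search `go` fails at every
  -- index, summing the failures gives `n * N < n * N`.
  ∑-average : ∀ n (f : ℕ → ℕ) N → 0 < n → N ≤ ∑ n f → ∃[ i ] i < n × N ≤ n * f i
  ∑-average n f N 0<n N≤∑ = go n ≤-refl λ i n≤i i<n → ⊥-elim (<-irrefl refl (≤-trans i<n n≤i))
    where
    go : ∀ r → r ≤ n → (∀ i → r ≤ i → i < n → n * f i < N) → ∃[ i ] i < n × N ≤ n * f i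
    go zero    r≤n small = ⊥-elim (<-irrefl refl (begin-strict
      n * N                       ≤⟨ *-monoʳ-≤ n N≤∑ ⟩
      n * ∑ n f                   ≡⟨ ∑-* n n f ⟨
      ∑ n (λ i → n * f i)         <⟨ ∑-mono-< n 0<n (λ i i<n → small i z≤n i<n) ⟩
      ∑ n (λ _ → N)               ≡⟨ ∑-const n N ⟩
      n * N                       ∎))
      where open ≤-Reasoning
    go (suc r) r<n small with N ≤? n * f r
    ... | yes N≤ = r , r<n , N≤
    ... | no  N≰ = go r (<⇒≤ r<n) λ i r≤i i<n → case (m≤n⇒m<n∨m≡n r≤i) i<n
      where
      case : ∀ {i} → r < i ⊎ r ≡ i → i < n → n * f i < N
      case (inj₁ r<i)  i<n = small _ r<i i<n
      case (inj₂ refl) _   = ≰⇒> N≰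

  ⟦_⟧ : Bool → ℕ
  ⟦ true ⟧  = 1
  ⟦ false ⟧ = 0

  ⟦⟧≤1 : ∀ b → ⟦ b ⟧ ≤ 1
  ⟦⟧≤1 true  = ≤-refl
  ⟦⟧≤1 false = z≤n

  ⟦⟧-mono : ∀ {a b} → (a ≡ true → b ≡ true) → ⟦ a ⟧ ≤ ⟦ b ⟧
  ⟦⟧-mono {false}         imp = z≤n
  ⟦⟧-mono {true}  {b}     imp rewrite imp refl = ≤-refl

  ⟦⟧-not : ∀ b → ⟦ b ⟧ + ⟦ not b ⟧ ≡ 1
  ⟦⟧-not true  = refl
  ⟦⟧-not false = refl

  ⟦⟧-∧-not : ∀ a b → ⟦ a ∧ b ⟧ + ⟦ a ∧ not b ⟧ ≡ ⟦ a ⟧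
  ⟦⟧-∧-not true  b = ⟦⟧-not b
  ⟦⟧-∧-not false b = refl

  ∧-true⁻ : ∀ {a b} → a ∧ b ≡ true → a ≡ true × b ≡ true
  ∧-true⁻ {true} eq = refl , eq

  ∧-true : ∀ {a b} → a ≡ true → b ≡ true → a ∧ b ≡ true
  ∧-true refl refl = refl

  ∨-true⁻ : ∀ {a b} → a ∨ b ≡ true → a ≡ true ⊎ b ≡ true
  ∨-true⁻ {true}  eq = inj₁ refl
  ∨-true⁻ {false} eq = inj₂ eq

  ∨-trueˡ : ∀ {a b} → a ≡ true → a ∨ b ≡ true
  ∨-trueˡ refl = refl

  ∨-trueʳ : ∀ {a b} → b ≡ true → a ∨ b ≡ true
  ∨-trueʳ {true}  refl = refl
  ∨-trueʳ {false} refl = refl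

  not-true : ∀ {b} → ¬ (b ≡ true) → not b ≡ true
  not-true {true}  ¬t = ⊥-elim (¬t refl)
  not-true {false} ¬t = refl

  not-true⁻ : ∀ {b} → not b ≡ true → ¬ (b ≡ true)
  not-true⁻ {false} _ ()

  true≢false : ∀ {b} → b ≡ true → b ≡ false → ⊥
  true≢false refl ()

  any< : ℕ → (ℕ → Bool) → Bool
  any< zero    p = false
  any< (suc n) p = p n ∨ any< n p

  any<-intro : ∀ n {p : ℕ → Bool} {i} → i < n → p i ≡ true → any< n p ≡ true
  any<-intro (suc n) {p} {i} i<1+n pi with m≤n⇒m<n∨m≡n (s≤s⁻¹ i<1+n)
  ... | inj₁ i<n  = ∨-trueʳ {p n} (any<-intro n i<n pi)
  ... | inj₂ refl = ∨-trueˡ pi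

  any<-elim : ∀ n {p : ℕ → Bool} → any< n p ≡ true → ∃[ i ] i < n × p i ≡ true
  any<-elim (suc n) {p} eq with ∨-true⁻ {p n} eq
  ... | inj₁ pn = n , ≤-refl , pn
  ... | inj₂ ps with any<-elim n ps
  ...   | i , i<n , pi = i , m<n⇒m<1+n i<n , pi

  -- A total search for the largest witness; the default 0 means nothing by itself, so the value is
  -- only used through `find<-spec`.
  find< : ℕ → (ℕ → Bool) → ℕ
  find< zero    p = 0
  find< (suc n) p = if p n then n else find< n p

  find<-spec : ∀ n {p : ℕ → Bool} → any< n p ≡ true → find< n p < n × p (find< n p) ≡ true
  find<-spec (suc n) {p} eq with p n in pn
  ... | true  = ≤-refl , pn
  ... | false with find<-spec n eq
  ...   | f<n , pf = m<n⇒m<1+n f<n , pf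

  Periodic : {A : Set} → ℕ → (ℕ → A) → Set
  Periodic n f = ∀ x → f (x + n) ≡ f x

  module _ {A : Set} {n : ℕ} {f : ℕ → A} (per : Periodic n f) where

    periodic-* : ∀ x q → f (x + q * n) ≡ f x
    periodic-* x zero    = cong f (+-identityʳ x)
    periodic-* x (suc q) = begin
      f (x + (n + q * n))  ≡⟨ cong (λ t → f (x + t)) (+-comm n (q * n)) ⟩
      f (x + (q * n + n))  ≡⟨ cong f (+-assoc x (q * n) n) ⟨
      f (x + q * n + n)    ≡⟨ per (x + q * n) ⟩
      f (x + q * n)        ≡⟨ periodic-* x q ⟩
      f x                  ∎
      where open ≡-Reasoning

    periodic-% : .{{_ : NonZero n}} → ∀ x → f (x % n) ≡ f x
    periodic-% x = trans (sym (periodic-* (x % n) (x / n))) (cong f (sym (m≡m%n+[m/n]*n x n)))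

  ∑-rotate : ∀ {n} {f : ℕ → ℕ} → Periodic n f → ∀ x → ∑ n (λ j → f (x + j)) ≡ ∑ n f
  ∑-rotate {n} {f} per zero    = refl
  ∑-rotate {n} {f} per (suc x) = trans (+-cancelʳ-≡ (f x) _ _ (begin
    ∑ n (λ j → f (suc x + j)) + f x            ≡⟨ +-comm _ (f x) ⟩
    f x + ∑ n (λ j → f (suc x + j))            ≡⟨ cong₂ _+_ (cong f (sym (+-identityʳ x)))
                                                    (∑-cong n λ j _ → cong f (sym (+-suc x j))) ⟩
    f (x + 0) + ∑ n (λ j → f (x + suc j))      ≡⟨ ∑-split 1 n (λ j → f (x + j)) ⟨
    ∑ n (λ j → f (x + j)) + f (x + n)          ≡⟨ cong (∑ n (λ j → f (x + j)) +_) (per x) ⟩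
    ∑ n (λ j → f (x + j)) + f x                ∎)) (∑-rotate per x)
    where open ≡-Reasoning

  ∑-periods : ∀ {n} {f : ℕ → ℕ} → Periodic n f → ∀ q r → ∑ (q * n + r) f ≡ q * ∑ n f + ∑ r f
  ∑-periods {n} {f} per q r = begin
    ∑ (q * n + r) f                                 ≡⟨ ∑-split (q * n) r f ⟩
    ∑ (q * n) f + ∑ r (λ j → f (q * n + j))         ≡⟨ cong₂ _+_ (full q) (∑-cong r λ j _ →
                                                         trans (cong f (+-comm (q * n) j)) (periodic-* per j q)) ⟩
    q * ∑ n f + ∑ r f                               ∎
    where
    open ≡-Reasoning
    full : ∀ q → ∑ (q * n) f ≡ q * ∑ n f
    full q = trans (∑-blocks q n f) (trans (∑-cong q λ b _ → ∑-rotate per (b * n)) (∑-const q (∑ n f)))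

-- Hall's theorem by alternating walks

module Hall where

  open import Data.Bool using (Bool; true; false; _∧_; _∨_; not)
  import Data.Bool as Bool
  open import Data.Empty using (⊥-elim)
  open import Data.Bool.Properties using (∧-zeroʳ)
  open import Data.Nat
  open import Data.Nat.Properties
  open import Data.Product using (_×_; _,_; proj₁; proj₂)
  open import Data.Sum using (_⊎_; inj₁; inj₂)
  open import Relation.Binary.PropositionalEquality
  open import Relation.Nullary using (¬_; yes; no)
  open import Relation.Nullary.Decidable using (⌊_⌋)
  open Sums

  infix 4 _==_

  _==_ : ℕ → ℕ → Bool
  x == y = ⌊ x ≟ y ⌋

  ==-refl : ∀ x → (x == x) ≡ true
  ==-refl x with x ≟ x
  ... | yes _  = refl
  ... | no  ne = ⊥-elim (ne refl)

  ==⇒≡ : ∀ {x y} → (x == y) ≡ true → x ≡ y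
  ==⇒≡ {x} {y} eq with x ≟ y
  ... | yes x≡y = x≡y

  ≢⇒==false : ∀ {x y} → x ≢ y → (x == y) ≡ false
  ≢⇒==false {x} {y} ne with x ≟ y
  ... | yes x≡y = ⊥-elim (ne x≡y)
  ... | no  _   = refl

  -- Induction on `Y`: by injectivity the smaller arguments still map into `P` after the value `g Y`
  -- has been deleted from it.
  count-≤-injection : ∀ X Y (P Q : ℕ → Bool) (g : ℕ → ℕ) →
    (∀ y → y < Y → Q y ≡ true → g y < X × P (g y) ≡ true) →
    (∀ y y′ → y < Y → y′ < Y → Q y ≡ true → Q y′ ≡ true → g y ≡ g y′ → y ≡ y′) →
    ∑ Y (λ y → ⟦ Q y ⟧) ≤ ∑ X (λ x → ⟦ P x ⟧)
  count-≤-injection X zero    P Q g maps inj = z≤n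
  count-≤-injection X (suc Y) P Q g maps inj with Q Y in QY
  ... | false = ≤-trans (≤-reflexive (+-identityʳ _)) (count-≤-injection X Y P Q g
          (λ y y<Y → maps y (m<n⇒m<1+n y<Y))
          (λ y y′ y<Y y′<Y → inj y y′ (m<n⇒m<1+n y<Y) (m<n⇒m<1+n y′<Y)))
  ... | true = begin
      ∑ Y (λ y → ⟦ Q y ⟧) + 1
        ≤⟨ +-monoˡ-≤ 1 (count-≤-injection X Y P′ Q g
             (λ y y<Y Qy → proj₁ (maps y (m<n⇒m<1+n y<Y) Qy) ,
               ∧-true (proj₂ (maps y (m<n⇒m<1+n y<Y) Qy)) (not-true λ eq →
                 <-irrefl (inj y Y (m<n⇒m<1+n y<Y) ≤-refl Qy QY (==⇒≡ eq)) y<Y))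
             (λ y y′ y<Y y′<Y → inj y y′ (m<n⇒m<1+n y<Y) (m<n⇒m<1+n y′<Y))) ⟩
      ∑ X (λ x → ⟦ P′ x ⟧) + 1
        ≡⟨ cong (∑ X (λ x → ⟦ P′ x ⟧) +_) (sym single) ⟩
      ∑ X (λ x → ⟦ P′ x ⟧) + ∑ X (λ x → ⟦ P x ∧ (x == g Y) ⟧)
        ≡⟨ ∑-+ X (λ x → ⟦ P′ x ⟧) (λ x → ⟦ P x ∧ (x == g Y) ⟧) ⟨
      ∑ X (λ x → ⟦ P′ x ⟧ + ⟦ P x ∧ (x == g Y) ⟧)
        ≡⟨ ∑-cong X (λ x _ → trans (+-comm ⟦ P′ x ⟧ _) (⟦⟧-∧-not (P x) (x == g Y))) ⟩
      ∑ X (λ x → ⟦ P x ⟧) ∎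
    where
    open ≤-Reasoning
    P′ : ℕ → Bool
    P′ x = P x ∧ not (x == g Y)
    single : ∑ X (λ x → ⟦ P x ∧ (x == g Y) ⟧) ≡ 1
    single = trans
      (∑-single X _ (proj₁ (maps Y ≤-refl QY)) λ x _ x≢ →
        cong ⟦_⟧ (trans (cong (P x ∧_) (≢⇒==false x≢)) (∧-zeroʳ (P x))))
      (cong ⟦_⟧ (∧-true (proj₂ (maps Y ≤-refl QY)) (==-refl (g Y))))

  module _ (n : ℕ) (A : ℕ → Bool) (rel : ℕ → ℕ → Bool) where

    neighbours : (ℕ → Bool) → ℕ → Bool
    neighbours S y = any< n λ x → S x ∧ rel x y

    HallCondition : Set
    HallCondition = ∀ S → (∀ x → S x ≡ true → A x ≡ true) →
      ∑ n (λ x → ⟦ S x ⟧) ≤ ∑ n (λ y → ⟦ neighbours S y ⟧)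

    record Matching (D : ℕ → Bool) : Set where
      field
        to        : ℕ → ℕ
        to<       : ∀ {x} → x < n → D x ≡ true → to x < n
        to-rel    : ∀ {x} → x < n → D x ≡ true → rel x (to x) ≡ true
        injective : ∀ {x x′} → x < n → x′ < n → D x ≡ true → D x′ ≡ true → to x ≡ to x′ → x ≡ x′

    private
      module Augment (D : ℕ → Bool) (x₀ : ℕ) (x₀<n : x₀ < n) (x₀∉D : D x₀ ≡ false) where

        D⁺ : ℕ → Bool
        D⁺ x = D x ∨ (x == x₀)

        -- R f j: the left vertices reachable from x₀ by f-alternating walks of
        -- at most j double steps.
        R : (ℕ → ℕ) → ℕ → ℕ → Bool
        R f zero    x = x == x₀
        R f (suc j) x = R f j x ∨ (D x ∧ neighbours (R f j) (f x))

        set : (ℕ → ℕ) → ℕ → ℕ → ℕ → ℕ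
        set f x y z with z ≟ x
        ... | yes _ = y
        ... | no  _ = f z

        set-other : ∀ f x y {z} → z ≢ x → set f x y z ≡ f z
        set-other f x y {z} z≢x with z ≟ x
        ... | yes eq = ⊥-elim (z≢x eq)
        ... | no  _  = refl

        Unmatched : (ℕ → ℕ) → ℕ → Set
        Unmatched f y = ∀ x → x < n → D x ≡ true → f x ≢ y

        -- Serves two purposes: with `E = D` it redirects a vertex that is already matched, with
        -- `E = D⁺` it gives `x₀` its first partner.
        reassign : ∀ {E : ℕ → Bool} (M : Matching D) {x y} → y < n → rel x y ≡ true →
          Unmatched (Matching.to M) y → (∀ {z} → E z ≡ true → z ≢ x → D z ≡ true) → Matching E
        reassign {E} M {x} {y} y<n xy free E⊆D = record
          { to = set to x y
          ; to< = λ z<n Ez → to′< z<n Ez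
          ; to-rel = λ z<n Ez → to′-rel z<n Ez
          ; injective = inj′ }
          where
          open Matching M
          to′< : ∀ {z} → z < n → E z ≡ true → set to x y z < n
          to′< {z} z<n Ez with z ≟ x
          ... | yes refl = y<n
          ... | no  z≢x  = to< z<n (E⊆D Ez z≢x)
          to′-rel : ∀ {z} → z < n → E z ≡ true → rel z (set to x y z) ≡ true
          to′-rel {z} z<n Ez with z ≟ x
          ... | yes refl = xy
          ... | no  z≢x  = to-rel z<n (E⊆D Ez z≢x)
          inj′ : ∀ {z z′} → z < n → z′ < n → E z ≡ true → E z′ ≡ true → set to x y z ≡ set to x y z′ → z ≡ z′
          inj′ {z} {z′} z<n z′<n Ez Ez′ eq with z ≟ x | z′ ≟ x
          ... | yes refl | yes refl = refl
          ... | yes refl | no  z′≢x = ⊥-elim (free z′ z′<n (E⊆D Ez′ z′≢x) (sym eq))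
          ... | no  z≢x  | yes refl = ⊥-elim (free z z<n (E⊆D Ez z≢x) eq)
          ... | no  z≢x  | no  z′≢x = injective z<n z′<n (E⊆D Ez z≢x) (E⊆D Ez′ z′≢x) eq

        -- Vertices reached within `j` double steps differ from `x`, so the walks leading to them
        -- never use the value at `x` and survive its change.
        R-monotone : ∀ (f g : ℕ → ℕ) {x} j → (∀ z → z ≢ x → g z ≡ f z) → ∀ i → i ≤ j → R f j x ≡ false →
          ∀ z → R f i z ≡ true → R g i z ≡ true
        R-monotone f g {x} j agree zero    _   x∉ z Rz = Rz
        R-monotone f g {x} j agree (suc i) i<j x∉ z Rz with ∨-true⁻ {R f i z} Rz
        ... | inj₁ Rz′ = ∨-trueˡ (R-monotone f g j agree i (<⇒≤ i<j) x∉ z Rz′)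
        ... | inj₂ step with ∧-true⁻ {D z} step
        ...   | Dz , nb with any<-elim n nb
        ...     | x′ , x′<n , r with ∧-true⁻ {R f i x′} r
        ...       | Rx′ , rl = ∨-trueʳ {R g i z} (∧-true Dz (any<-intro n x′<n
                      (∧-true (R-monotone f g j agree i (<⇒≤ i<j) x∉ x′ Rx′)
                              (trans (cong (rel x′) (agree z z≢x)) rl))))
          where
          mono : ∀ {i j z} → i ≤′ j → R f i z ≡ true → R f j z ≡ true
          mono ≤′-refl       Rz = Rz
          mono (≤′-step i≤j) Rz = ∨-trueˡ (mono i≤j Rz)
          z≢x : z ≢ x
          z≢x refl with trans (sym x∉) (mono (≤⇒≤′ i<j) Rz)
          ... | ()

        -- No walk is stored; the recursion flips its last edge. When `x` takes the free vertex `y`,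
        -- its old partner becomes free, and that one is a neighbour of some `x′` reached one double
        -- step earlier. By `R-monotone`, `x′` is still reached under the new matching.
        augment : ∀ j (M : Matching D) {x y} → R (Matching.to M) j x ≡ true → x < n → y < n →
          rel x y ≡ true → Unmatched (Matching.to M) y → Matching D⁺
        augment zero M {x} {y} Rx x<n y<n xy free with ==⇒≡ {x} {x₀} Rx
        ... | refl = reassign M y<n xy free λ {z} D⁺z z≢x₀ → case z≢x₀ (∨-true⁻ {D z} D⁺z)
          where
          case : ∀ {z} → z ≢ x₀ → D z ≡ true ⊎ (z == x₀) ≡ true → D z ≡ true
          case _    (inj₁ Dz) = Dz
          case z≢x₀ (inj₂ eq) = ⊥-elim (z≢x₀ (==⇒≡ eq))
        augment (suc j) M {x} {y} Rx x<n y<n xy free with R (Matching.to M) j x in x∈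
        ... | true  = augment j M x∈ x<n y<n xy free
        ... | false with ∧-true⁻ {D x} Rx
        ...   | Dx , nb with any<-elim n nb
        ...     | x′ , x′<n , r with ∧-true⁻ {R (Matching.to M) j x′} r
        ...       | Rx′ , rl = augment j M′ Rx″ x′<n (to< x<n Dx) rl free′
          where
          open Matching M
          M′ : Matching D
          M′ = reassign M y<n xy free λ Dz _ → Dz
          Rx″ : R (set to x y) j x′ ≡ true
          Rx″ = R-monotone to (set to x y) j (λ z → set-other to x y) j ≤-refl x∈ x′ Rx′
          free′ : Unmatched (set to x y) (to x)
          free′ z z<n Dz eq with z ≟ x
          ... | yes refl = free x z<n Dx (sym eq)
          ... | no  z≢x  = z≢x (injective z<n x<n Dz Dx eq)

        R⊆D⁺ : ∀ f j x → R f j x ≡ true → D⁺ x ≡ true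
        R⊆D⁺ f zero    x Rx = ∨-trueʳ {D x} Rx
        R⊆D⁺ f (suc j) x Rx with ∨-true⁻ {R f j x} Rx
        ... | inj₁ Rx′ = R⊆D⁺ f j x Rx′
        ... | inj₂ D∧  = ∨-trueˡ (proj₁ (∧-true⁻ {D x} D∧))

        x₀∈R : ∀ f j → R f j x₀ ≡ true
        x₀∈R f zero    = ==-refl x₀
        x₀∈R f (suc j) = ∨-trueˡ (x₀∈R f j)

        module _ (hall : HallCondition) (D⁺⊆A : ∀ x → D⁺ x ≡ true → A x ≡ true) (M : Matching D) where

          open Matching M

          size : ℕ → ℕ
          size j = ∑ n λ x → ⟦ R to j x ⟧

          matched : ℕ → Bool
          matched y = any< n λ x → D x ∧ (to x == y)

          escape : ℕ → ℕ → Bool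
          escape j y = neighbours (R to j) y ∧ not (matched y)

          -- If every neighbour of the reached set is matched, `back` sends the neighbourhood
          -- injectively to its partners in `D`. These all belong to the next reached set, which
          -- contains in addition `x₀`, a vertex outside `D`.
          growth : ∀ j → any< n (escape j) ≡ false → size j < size (suc j)
          growth j none = begin-strict
            size j                                               ≤⟨ hall (R to j) (λ x Rx → D⁺⊆A x (R⊆D⁺ to j x Rx)) ⟩
            ∑ n (λ y → ⟦ neighbours (R to j) y ⟧)                ≤⟨ count-≤-injection n n new (neighbours (R to j)) back back-maps back-inj ⟩
            ∑ n (λ x → ⟦ new x ⟧)                                <⟨ n<1+n _ ⟩
            suc (∑ n (λ x → ⟦ new x ⟧))                          ≡⟨ +-comm 1 _ ⟩
            ∑ n (λ x → ⟦ new x ⟧) + 1                            ≡⟨ cong (∑ n (λ x → ⟦ new x ⟧) +_) one ⟨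
            ∑ n (λ x → ⟦ new x ⟧) + ∑ n (λ x → ⟦ x == x₀ ⟧)      ≡⟨ ∑-+ n (λ x → ⟦ new x ⟧) (λ x → ⟦ x == x₀ ⟧) ⟨
            ∑ n (λ x → ⟦ new x ⟧ + ⟦ x == x₀ ⟧)                  ≤⟨ ∑-mono n pointwise ⟩
            size (suc j)                                         ∎
            where
            open ≤-Reasoning
            new : ℕ → Bool
            new x = D x ∧ neighbours (R to j) (to x)
            one : ∑ n (λ x → ⟦ x == x₀ ⟧) ≡ 1
            one = trans (∑-single n _ x₀<n λ x _ x≢ → cong ⟦_⟧ (≢⇒==false x≢)) (cong ⟦_⟧ (==-refl x₀))
            pointwise : ∀ x → x < n → ⟦ new x ⟧ + ⟦ x == x₀ ⟧ ≤ ⟦ R to (suc j) x ⟧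
            pointwise x _ with x ≟ x₀
            ... | yes refl = ≤-reflexive (trans (cong (λ b → ⟦ b ∧ neighbours (R to j) (to x₀) ⟧ + 1) x₀∉D)
                                                  (sym (cong ⟦_⟧ (x₀∈R to (suc j)))))
            ... | no  _    = ≤-trans (≤-reflexive (+-identityʳ _)) (⟦⟧-mono {new x} (∨-trueʳ {R to j x}))
            back : ℕ → ℕ
            back y = find< n λ x → D x ∧ (to x == y)
            back-spec : ∀ y → y < n → neighbours (R to j) y ≡ true →
              back y < n × D (back y) ≡ true × to (back y) ≡ y
            back-spec y y<n Ny with matched y in my
            ... | true with find<-spec n my
            ...   | b<n , eq with ∧-true⁻ {D (back y)} eq
            ...     | Db , tb = b<n , Db , ==⇒≡ tb
            back-spec y y<n Ny | false with trans (sym none) (any<-intro n y<n (∧-true Ny (cong not my)))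
            ...   | ()
            back-maps : ∀ y → y < n → neighbours (R to j) y ≡ true → back y < n × new (back y) ≡ true
            back-maps y y<n Ny with back-spec y y<n Ny
            ... | b<n , Db , tb = b<n , ∧-true Db (trans (cong (neighbours (R to j)) tb) Ny)
            back-inj : ∀ y y′ → y < n → y′ < n → neighbours (R to j) y ≡ true → neighbours (R to j) y′ ≡ true →
              back y ≡ back y′ → y ≡ y′
            back-inj y y′ y<n y′<n Ny Ny′ eq = trans (sym (proj₂ (proj₂ (back-spec y y<n Ny))))
              (trans (cong to eq) (proj₂ (proj₂ (back-spec y′ y′<n Ny′))))

          grow : ∀ j → Matching D⁺ ⊎ j ≤ size j
          grow zero    = inj₂ z≤n
          grow (suc j) with grow j | any< n (escape j) in esc
          ... | inj₁ M⁺ | _     = inj₁ M⁺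
          ... | inj₂ le | false = inj₂ (≤-<-trans le (growth j esc))
          ... | inj₂ le | true  with any<-elim n esc
          ...   | y , y<n , e with ∧-true⁻ {neighbours (R to j) y} e
          ...     | Ny , free with any<-elim n Ny
          ...       | x , x<n , r with ∧-true⁻ {R to j x} r
          ...         | Rx , rl = inj₁ (augment j M Rx x<n y<n rl λ z z<n Dz tz →
                          not-true⁻ free (any<-intro n z<n (∧-true Dz (trans (cong (_== y) tz) (==-refl y)))))

          extended : Matching D⁺
          -- After `n + 1` rounds without an augmentation more than `n` of the vertices below `n`
          -- would be reached.
          extended with grow (suc n)
          ... | inj₁ M⁺ = M⁺
          ... | inj₂ le = ⊥-elim (<-irrefl refl (≤-trans le (≤-trans (∑-mono n λ x _ → ⟦⟧≤1 (R to (suc n) x))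
                            (≤-reflexive (trans (∑-const n 1) (*-identityʳ n))))))

      restrict : ∀ {D E : ℕ → Bool} → (∀ {x} → x < n → E x ≡ true → D x ≡ true) → Matching D → Matching E
      restrict E⊆D M = record
        { to = to
        ; to< = λ x<n Ex → to< x<n (E⊆D x<n Ex)
        ; to-rel = λ x<n Ex → to-rel x<n (E⊆D x<n Ex)
        ; injective = λ x<n x′<n Ex Ex′ → injective x<n x′<n (E⊆D x<n Ex) (E⊆D x′<n Ex′) }
        where open Matching M

      <ᵇ-true : ∀ {x r} → x < r → (x <ᵇ r) ≡ true
      <ᵇ-true {x} {r} x<r with x <ᵇ r | <⇒<ᵇ x<r
      ... | true | _ = refl

      <ᵇ-true⁻ : ∀ {x r} → (x <ᵇ r) ≡ true → x < r
      <ᵇ-true⁻ {x} {r} eq = <ᵇ⇒< x r (subst Bool.T (sym eq) _)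

      upTo : HallCondition → ∀ r → r ≤ n → Matching (λ x → A x ∧ (x <ᵇ r))
      upTo hall zero r≤n = record
        { to = λ x → x
        ; to< = λ _ e → ⊥-elim (absurd e)
        ; to-rel = λ _ e → ⊥-elim (absurd e)
        ; injective = λ _ _ e → ⊥-elim (absurd e) }
        where
        absurd : ∀ {x} → ¬ (A x ∧ (x <ᵇ 0) ≡ true)
        absurd {x} e with ∧-true⁻ {A x} e
        ... | _ , ()
      upTo hall (suc r) r<n with upTo hall r (<⇒≤ r<n) | A r in Ar
      ... | M | false = restrict E⊆D M
        where
        E⊆D : ∀ {x} → x < n → A x ∧ (x <ᵇ suc r) ≡ true → A x ∧ (x <ᵇ r) ≡ true
        E⊆D {x} x<n e with ∧-true⁻ {A x} e
        ... | Ax , lt with m≤n⇒m<n∨m≡n (s≤s⁻¹ (<ᵇ-true⁻ {x} lt))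
        ...   | inj₁ x<r  = ∧-true Ax (<ᵇ-true x<r)
        ...   | inj₂ refl with trans (sym Ax) Ar
        ...     | ()
      ... | M | true = restrict E⊆D (extended hall D⁺⊆A M)
        where
        D : ℕ → Bool
        D x = A x ∧ (x <ᵇ r)
        r∉D : D r ≡ false
        r∉D with D r in Dr
        ... | false = refl
        ... | true  = ⊥-elim (<-irrefl refl (<ᵇ-true⁻ {r} (proj₂ (∧-true⁻ {A r} Dr))))
        open Augment D r r<n r∉D
        D⁺⊆A : ∀ x → D⁺ x ≡ true → A x ≡ true
        D⁺⊆A x e with ∨-true⁻ {D x} e
        ... | inj₁ Dx = proj₁ (∧-true⁻ {A x} Dx)
        ... | inj₂ eq = trans (cong A (==⇒≡ eq)) Ar
        E⊆D : ∀ {x} → x < n → A x ∧ (x <ᵇ suc r) ≡ true → D⁺ x ≡ true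
        E⊆D {x} x<n e with ∧-true⁻ {A x} e
        ... | Ax , lt with m≤n⇒m<n∨m≡n (s≤s⁻¹ (<ᵇ-true⁻ {x} lt))
        ...   | inj₁ x<r  = ∨-trueˡ (∧-true Ax (<ᵇ-true x<r))
        ...   | inj₂ refl = ∨-trueʳ {D r} (==-refl r)

    hall-marriage : HallCondition → Matching A
    hall-marriage hall = restrict (λ {x} x<n Ax → ∧-true Ax (<ᵇ-true x<n)) (upTo hall n ≤-refl)

-- Hall's condition on the circle

module CircleHall where

  open import Data.Bool using (Bool; true; false; _∧_; not)
  open import Data.Empty using (⊥; ⊥-elim)
  open import Data.List using (_∷_; [])
  open import Data.Nat
  open import Data.Nat.DivMod
  open import Data.Nat.Properties
  open import Data.Nat.Tactic.RingSolver using (solve)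
  open import Data.Product using (∃-syntax; _×_; _,_; proj₁; proj₂)
  open import Data.Sum using (_⊎_; inj₁; inj₂)
  open import Relation.Binary.PropositionalEquality
  open import Relation.Nullary using (¬_; yes; no)
  open Sums
  open Hall

  count : (ℕ → Bool) → ℕ → ℕ
  count p x = ∑ x λ i → ⟦ p i ⟧

  count-partition : ∀ (p q r : ℕ → Bool) → (∀ i → ⟦ q i ⟧ + ⟦ r i ⟧ ≡ ⟦ p i ⟧) → ∀ x →
    count q x + count r x ≡ count p x
  count-partition p q r split x = trans (sym (∑-+ x (λ i → ⟦ q i ⟧) (λ i → ⟦ r i ⟧))) (∑-cong x λ i _ → split i)

  count≤ : ∀ p x → count p x ≤ x
  count≤ p x = ≤-trans (∑-mono x λ i _ → ⟦⟧≤1 (p i)) (≤-reflexive (trans (∑-const x 1) (*-identityʳ x)))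

  periodic-⟦⟧ : ∀ {n} {p : ℕ → Bool} → Periodic n p → Periodic n (λ x → ⟦ p x ⟧)
  periodic-⟦⟧ per x = cong ⟦_⟧ (per x)

  unbounded : ∀ {P : ℕ → Set} → P 0 → (∀ x → P x → ∃[ x′ ] x < x′ × P x′) → ∀ N → ∃[ x ] N ≤ x × P x
  unbounded P0 next zero    = 0 , z≤n , P0
  unbounded P0 next (suc N) with unbounded P0 next N
  ... | x , N≤x , Px with next x Px
  ...   | x′ , x<x′ , Px′ = x′ , ≤-<-trans N≤x x<x′ , Px′

  -- Every full period increases the difference of the two prefix sums by at least one, so that more
  -- than `∑ n g + c` periods outweigh both `c` and the incomplete last period.
  drift : ∀ {n} .{{_ : NonZero n}} {f g : ℕ → ℕ} → Periodic n f → Periodic n g → ∑ n g < ∑ n f →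
    ∀ c y → (∑ n g + c + 1) * n ≤ y → ¬ (∑ y f ≤ ∑ y g + c)
  drift {n} {f} {g} perf perg g<f c y large le = <-irrefl refl (≤-trans q≥ q≤)
    where
    q r a b : ℕ
    q = y / n
    r = y % n
    a = ∑ n g
    b = ∑ n f
    y≡ : y ≡ q * n + r
    y≡ = trans (m≡m%n+[m/n]*n y n) (+-comm r (q * n))
    arith : ∀ q a b c g′ f′ → 1 + a ≤ b → g′ ≤ a → q * b + f′ ≤ (q * a + g′) + c → q ≤ a + c
    arith q a b c g′ f′ a<b g′≤a h = certify f′ (h ⊕ q ⊗ a<b ⊕ g′≤a) (solve (q ∷ a ∷ b ∷ c ∷ g′ ∷ f′ ∷ []))
    q≤ : q ≤ a + c
    q≤ = arith q a b c (∑ r g) (∑ r f) g<f (∑-mono-range g (<⇒≤ (m%n<n y n)))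
      (subst₂ _≤_ (trans (cong (λ t → ∑ t f) y≡) (∑-periods perf q r))
                  (cong (_+ c) (trans (cong (λ t → ∑ t g) y≡) (∑-periods perg q r))) le)
    q≥ : a + c < q
    q≥ = ≤-trans (≤-reflexive (trans (+-comm 1 (a + c)) (sym (m*n/n≡m (a + c + 1) n)))) (/-monoˡ-≤ n large)

  module _ (n k : ℕ) .{{_ : NonZero n}} (A B : ℕ → Bool) (rel : ℕ → ℕ → Bool)
    (perA : Periodic n A) (perB : Periodic n B)
    (perˡ : ∀ y → Periodic n (λ x → rel x y)) (perʳ : ∀ x → Periodic n (rel x)) where

    private
      relB : ℕ → ℕ → Bool
      relB x y = B y ∧ rel x y

      module Deficient (S : ℕ → Bool) (S⊆A : ∀ x → S x ≡ true → A x ≡ true) where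

        N₀ Ŝ N T C : ℕ → Bool
        N₀ y = neighbours n A relB S y
        Ŝ x = S (x % n)
        N y = N₀ (y % n)
        T y = B y ∧ not (N y)
        C x = A x ∧ not (Ŝ x)

        perŜ : Periodic n Ŝ
        perŜ x = cong S ([m+n]%n≡m%n x n)
        perN : Periodic n N
        perN y = cong N₀ ([m+n]%n≡m%n y n)
        perT : Periodic n T
        perT y = cong₂ (λ a b → a ∧ not b) (perB y) (perN y)
        perC : Periodic n C
        perC x = cong₂ (λ a b → a ∧ not b) (perA x) (perŜ x)

        Ŝ⊆A : ∀ x → Ŝ x ≡ true → A x ≡ true
        Ŝ⊆A x Sx = trans (sym (periodic-% perA x)) (S⊆A (x % n) Sx)

        edge : ∀ s t → Ŝ s ≡ true → B t ≡ true → rel s t ≡ true → N t ≡ true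
        edge s t Ss Bt st = any<-intro n (m%n<n s n) (∧-true Ss
          (∧-true (trans (periodic-% perB t) Bt)
            (trans (periodic-% (perʳ (s % n)) t) (trans (periodic-% (perˡ t) s) st))))

        N⊆B : ∀ y → N y ≡ true → B y ≡ true
        N⊆B y Ny with any<-elim n Ny
        ... | x , _ , e with ∧-true⁻ {S x} e
        ...   | _ , e′ = trans (sym (periodic-% perB y)) (proj₁ (∧-true⁻ {B (y % n)} e′))

        non-edge : ∀ s t → Ŝ s ≡ true → T t ≡ true → (B t ∧ not (rel s t)) ≡ true
        non-edge s t Ss Tt with ∧-true⁻ {B t} Tt
        ... | Bt , ¬Nt = ∧-true Bt (not-true λ st → not-true⁻ ¬Nt (edge s t Ss Bt st))

        ⟦⟧-split : ∀ a b → (b ≡ true → a ≡ true) → ⟦ b ⟧ + ⟦ a ∧ not b ⟧ ≡ ⟦ a ⟧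
        ⟦⟧-split true  b     _   = ⟦⟧-not b
        ⟦⟧-split false false _   = refl
        ⟦⟧-split false true  imp with imp refl
        ... | ()

        S+C : ∀ x → count Ŝ x + count C x ≡ count A x
        S+C = count-partition A Ŝ C λ x → ⟦⟧-split (A x) (Ŝ x) (Ŝ⊆A x)

        N+T : ∀ y → count N y + count T y ≡ count B y
        N+T = count-partition B N T λ y → ⟦⟧-split (B y) (N y) (N⊆B y)

        same : ∀ (p : ℕ → Bool) → count (λ x → p (x % n)) n ≡ count p n
        same p = ∑-cong n λ i i<n → cong (λ t → ⟦ p t ⟧) (m<n⇒m%n≡m i<n)

        start : ∀ p q → count p (0 + k) ≤ count q 0 + k
        start p q = count≤ p k

        step : ∀ (p q : ℕ → Bool) y → p (y + k) ≡ false → count p (y + k) ≤ count q y + k →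
          count p (suc y + k) ≤ count q (suc y) + k
        step p q y absent le = ≤-trans (≤-reflexive (trans (cong (λ b → count p (y + k) + ⟦ b ⟧) absent) (+-identityʳ _)))
          (≤-trans le (+-monoˡ-≤ k (m≤m+n (count q y) ⟦ q y ⟧)))

        exhausted : ∀ (p q : ℕ → Bool) → Periodic n p → Periodic n q → count q n < count p n → ∀ y →
          (n + k + 1) * n ≤ y → count p (y + k) ≤ count q y + k → ⊥
        exhausted p q perp perq q<p y large le = drift (periodic-⟦⟧ perp) (periodic-⟦⟧ perq) q<p k y
          (≤-trans (*-monoˡ-≤ n (+-monoˡ-≤ 1 (+-monoˡ-≤ k (count≤ q n)))) large)
          (≤-trans (∑-mono-range (λ i → ⟦ p i ⟧) (m≤m+n y k)) le)

    -- A set S violating Hall's condition, with N its neighbourhood and T = B ∖ N,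
    -- makes |S ∩ [0, y + k)| ≤ |N ∩ [0, y)| + k fail for large y.  But one can walk
    -- from y = 0 to infinity keeping this or the symmetric inequality for T and
    -- A ∖ S: at y + k ∉ S move one step; at y + k ∈ S the vertices of T in the
    -- window around y + k are non-neighbours, so switch to the other inequality
    -- at y + k + 1.
    dense-matching : ∀ κ →
      (∀ x → count A x ≤ count B x + 1) → (∀ x → count B x ≤ count A x + 1) → count A n ≡ count B n →
      (∀ x → κ + 2 ≤ count (λ j → A (x + j)) k) → (∀ x → κ + 2 ≤ count (λ j → B (x + j)) k) →
      (∀ y → A (y + k) ≡ true → count (λ j → B (y + j) ∧ not (rel (y + k) (y + j))) (k + suc k) ≤ κ) →
      (∀ y → B (y + k) ≡ true → count (λ j → A (y + j) ∧ not (rel (y + j) (y + k))) (k + suc k) ≤ κ) →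
      Matching n A relB A
    dense-matching κ A≤B B≤A A≡B halfA halfB nonA nonB = hall-marriage n A relB condition
      where
      condition : HallCondition n A relB
      condition S S⊆A with ∑ n (λ x → ⟦ S x ⟧) ≤? ∑ n (λ y → ⟦ neighbours n A relB S y ⟧)
      ... | yes le = le
      ... | no  ¬le = ⊥-elim (contra (unbounded {Inv} (inj₁ (start Ŝ N)) next ((n + k + 1) * n)))
        where
        open Deficient S S⊆A
        Inv : ℕ → Set
        Inv y = count Ŝ (y + k) ≤ count N y + k ⊎ count T (y + k) ≤ count C y + k
        arith : ∀ t t′ n b s s′ c a a′ → t′ ≤ t + κ → n + t ≤ b → s ≤ n + k → a′ ≤ s′ + c → s′ ≤ s + 1 →
          a + (κ + 2) ≤ a′ → b ≤ a + 1 → t′ ≤ c + k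
        arith t t′ n b s s′ c a a′ h₁ h₂ h₃ h₄ h₅ h₆ h₇ = certify 0 (h₁ ⊕ h₂ ⊕ h₃ ⊕ h₄ ⊕ h₅ ⊕ h₆ ⊕ h₇)
          (solve (κ ∷ k ∷ t ∷ t′ ∷ n ∷ b ∷ s ∷ s′ ∷ c ∷ a ∷ a′ ∷ []))
        shift : ∀ y → y + k + suc k ≡ suc (y + k) + k
        shift y = +-suc (y + k) k
        -- Formulated for arbitrary sets because it is applied a second time with the two sides
        -- interchanged. Of the `κ + 2` vertices of `A` in half a window, `κ` pay for the
        -- non-neighbours, one for the difference between the prefixes of `A` and `B`, and one for
        -- the vertex `y + k` itself.
        jump : ∀ (A B S N T C : ℕ → Bool) y → (∀ x → count B x ≤ count A x + 1) →
          (∀ x → κ + 2 ≤ count (λ j → A (x + j)) k) →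
          (∀ x → count S x + count C x ≡ count A x) → (∀ x → count N x + count T x ≡ count B x) →
          count (λ j → T (y + j)) (k + suc k) ≤ κ →
          count S (y + k) ≤ count N y + k → count T (suc (y + k) + k) ≤ count C (suc (y + k)) + k
        jump A B S N T C y B≤A half S+C N+T few le = arith (count T y) _ (count N y) (count B y) (count S (y + k))
          (count S (suc (y + k))) _ (count A y) (count A (suc (y + k)))
          (≤-trans (≤-reflexive (trans (cong (count T) (trans (sym (shift y)) (+-assoc y k (suc k))))
             (∑-split y (k + suc k) λ i → ⟦ T i ⟧))) (+-monoʳ-≤ (count T y) few))
          (≤-reflexive (N+T y)) le (≤-reflexive (sym (S+C (suc (y + k))))) (+-monoʳ-≤ (count S (y + k)) (⟦⟧≤1 (S (y + k))))
          (≤-trans (+-monoʳ-≤ (count A y) (half y)) (≤-trans (≤-reflexive (sym (∑-split y k λ i → ⟦ A i ⟧)))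
             (m≤m+n (count A (y + k)) ⟦ A (y + k) ⟧)))
          (B≤A y)
        next : ∀ y → Inv y → ∃[ y′ ] y < y′ × Inv y′
        next y (inj₁ inv) with Ŝ (y + k) in Sy
        ... | false = suc y , ≤-refl , inj₁ (step Ŝ N y Sy inv)
        ... | true  = suc (y + k) , s≤s (m≤m+n y k) , inj₂ (jump A B Ŝ N T C y B≤A halfA S+C N+T
                (≤-trans (∑-mono (k + suc k) λ j _ → ⟦⟧-mono (non-edge (y + k) (y + j) Sy)) (nonA y (Ŝ⊆A (y + k) Sy))) inv)
        next y (inj₂ inv) with T (y + k) in Ty
        ... | false = suc y , ≤-refl , inj₂ (step T C y Ty inv)
        ... | true  = suc (y + k) , s≤s (m≤m+n y k) , inj₁ (jump B A T C Ŝ N y A≤B halfB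
                (λ x → trans (+-comm (count T x) (count N x)) (N+T x)) (λ x → trans (+-comm (count C x) (count Ŝ x)) (S+C x))
                (≤-trans (∑-mono (k + suc k) λ j _ → ⟦⟧-mono λ Sj → ∧-true (Ŝ⊆A (y + j) Sj)
                   (proj₂ (∧-true⁻ {B (y + k)} (non-edge (y + j) (y + k) Sj Ty))))
                   (nonB y (proj₁ (∧-true⁻ {B (y + k)} Ty)))) inv)
        N<S : count N n < count Ŝ n
        N<S = subst₂ _<_ (sym (same N₀)) (sym (same S)) (≰⇒> ¬le)
        -- Both sides have the same size, so a deficient neighbourhood on one side is an excess of
        -- the complement on the other.
        C<T : count C n < count T n
        C<T = flip (count N n) (count Ŝ n) (count C n) (count T n)
          (trans (S+C n) (trans A≡B (sym (N+T n)))) N<S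
          where
          flip : ∀ a b c d → b + c ≡ a + d → a < b → c < d
          flip a b c d eq a<b = +-cancelˡ-< a c d (≤-trans (+-monoˡ-< c a<b) (≤-reflexive eq))
        contra : ∃[ y ] (n + k + 1) * n ≤ y × Inv y → ⊥
        contra (y , large , inj₁ inv) = exhausted Ŝ N perŜ perN N<S y large inv
        contra (y , large , inj₂ inv) = exhausted T C perT perC C<T y large inv

    -- One inequality is enough here. At a vertex `y + k` of `S` both prefixes advance by a whole
    -- window, in which `S` gains at most `d` and its neighbourhood at least `d`.
    sparse-matching : ∀ d →
      (∀ x → count (λ j → A (x + j)) (k + suc k) ≤ d) →
      (∀ y → A (y + k) ≡ true → d ≤ count (λ j → B (y + j) ∧ rel (y + k) (y + j)) (k + suc k)) →
      Matching n A relB A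
    sparse-matching d sparse rich = hall-marriage n A relB condition
      where
      condition : HallCondition n A relB
      condition S S⊆A with ∑ n (λ x → ⟦ S x ⟧) ≤? ∑ n (λ y → ⟦ neighbours n A relB S y ⟧)
      ... | yes le = le
      ... | no  ¬le = ⊥-elim (contra (unbounded {Inv} (start Ŝ N) next ((n + k + 1) * n)))
        where
        open Deficient S S⊆A
        Inv : ℕ → Set
        Inv y = count Ŝ (y + k) ≤ count N y + k
        window : ∀ (p : ℕ → Bool) x → count p (x + (k + suc k)) ≡ count p x + count (λ j → p (x + j)) (k + suc k)
        window p x = ∑-split x (k + suc k) λ i → ⟦ p i ⟧
        arith : ∀ s s′ n n′ → s′ ≤ s + d → s ≤ n + k → n + d ≤ n′ → s′ ≤ n′ + k
        arith s s′ n n′ h₁ h₂ h₃ = certify 0 (h₁ ⊕ h₂ ⊕ h₃) (solve (d ∷ k ∷ s ∷ s′ ∷ n ∷ n′ ∷ []))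
        next : ∀ y → Inv y → ∃[ y′ ] y < y′ × Inv y′
        next y inv with Ŝ (y + k) in Sy
        ... | false = suc y , ≤-refl , step Ŝ N y Sy inv
        ... | true  = y + (k + suc k) , m<m+n y (m≤n⇒m≤o+n k (s≤s z≤n)) , arith (count Ŝ (y + k)) _ (count N y) _
                (≤-trans (≤-reflexive (trans (cong (count Ŝ) (+-swapʳ y (k + suc k) k)) (window Ŝ (y + k))))
                   (+-monoʳ-≤ (count Ŝ (y + k)) (≤-trans (∑-mono (k + suc k) λ j _ → ⟦⟧-mono (Ŝ⊆A (y + k + j))) (sparse (y + k)))))
                inv
                (≤-trans (+-monoʳ-≤ (count N y) (≤-trans (rich y (Ŝ⊆A (y + k) Sy)) (∑-mono (k + suc k) λ j _ → ⟦⟧-mono λ e →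
                   edge (y + k) (y + j) Sy (proj₁ (∧-true⁻ {B (y + j)} e)) (proj₂ (∧-true⁻ {B (y + j)} e)))))
                   (≤-reflexive (sym (window N y))))
        contra : ∃[ y ] (n + k + 1) * n ≤ y × Inv y → ⊥
        contra (y , large , inv) = exhausted Ŝ N perŜ perN
          (subst₂ _<_ (sym (same N₀)) (sym (same S)) (≰⇒> ¬le)) y large inv

-- Orbits of permutations and how to merge them

module Merge where

  open import Data.Bool using (Bool; true; false)
  open import Data.Empty using (⊥-elim)
  open import Data.Nat
  open import Data.Nat.DivMod
  open import Data.Nat.Properties
  open import Data.Product using (∃-syntax; _×_; _,_; proj₁; proj₂)
  open import Data.Sum using (_⊎_; inj₁; inj₂)
  open import Relation.Binary.PropositionalEquality
  open import Relation.Nullary using (¬_; yes; no)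
  open import Relation.Binary.Definitions using (tri<; tri≈; tri>)
  open Sums
  open Hall

  iter : (ℕ → ℕ) → ℕ → ℕ → ℕ
  iter σ zero    x = x
  iter σ (suc i) x = iter σ i (σ x)

  iter-+ : ∀ σ i j x → iter σ (i + j) x ≡ iter σ j (iter σ i x)
  iter-+ σ zero    j x = refl
  iter-+ σ (suc i) j x = iter-+ σ i j (σ x)

  iter-suc : ∀ σ i x → iter σ (suc i) x ≡ σ (iter σ i x)
  iter-suc σ zero    x = refl
  iter-suc σ (suc i) x = iter-suc σ i (σ x)

  iter-* : ∀ σ d x → iter σ d x ≡ x → ∀ i → iter σ (i * d) x ≡ x
  iter-* σ d x eq zero    = refl
  iter-* σ d x eq (suc i) = trans (iter-+ σ d (i * d) x) (trans (cong (iter σ (i * d)) eq) (iter-* σ d x eq i))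

  Reach : (ℕ → ℕ) → ℕ → ℕ → Set
  Reach σ x y = ∃[ i ] iter σ i x ≡ y

  reach-refl : ∀ {σ x} → Reach σ x x
  reach-refl = 0 , refl

  reach-trans : ∀ {σ x y z} → Reach σ x y → Reach σ y z → Reach σ x z
  reach-trans {σ} {x} (i , refl) (j , refl) = i + j , iter-+ σ i j x

  reach-step : ∀ {σ x} → Reach σ x (σ x)
  reach-step = 1 , refl

  reach-lift : ∀ {σ τ : ℕ → ℕ} {n} → (∀ {x} → x < n → σ x < n) → (∀ {x} → x < n → Reach τ x (σ x)) →
    ∀ {x y} → x < n → Reach σ x y → Reach τ x y
  reach-lift {σ} {τ} {n} σ< sim x<n (i , refl) = go i x<n
    where
    go : ∀ i {x} → x < n → Reach τ x (iter σ i x)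
    go zero    x<n = reach-refl
    go (suc i) x<n = reach-trans (sim x<n) (go i (σ< x<n))

  too-many : ∀ {n m} (g : ℕ → ℕ) → m < n → (∀ x → x < n → g x < m) →
    ¬ (∀ x y → x < n → y < n → g x ≡ g y → x ≡ y)
  too-many {n} {m} g m<n g< inj = <-irrefl refl (begin-strict
    m                      <⟨ m<n ⟩
    n                      ≡⟨ trans (∑-const n 1) (*-identityʳ n) ⟨
    ∑ n (λ _ → 1)          ≤⟨ count-≤-injection m n (λ _ → true) (λ _ → true) g
                                (λ x x<n _ → g< x x<n , refl) (λ x y x<n y<n _ _ → inj x y x<n y<n) ⟩
    ∑ m (λ _ → 1)          ≡⟨ trans (∑-const m 1) (*-identityʳ m) ⟩
    m                      ∎)
    where open ≤-Reasoning

  module Permutes (n : ℕ) where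

    record Perm (σ : ℕ → ℕ) : Set where
      field
        closed    : ∀ {x} → x < n → σ x < n
        injective : ∀ {x y} → x < n → y < n → σ x ≡ σ y → x ≡ y

    module _ {σ : ℕ → ℕ} (perm : Perm σ) where

      open Perm perm

      iter< : ∀ i {x} → x < n → iter σ i x < n
      iter< zero    x<n = x<n
      iter< (suc i) x<n = iter< i (closed x<n)

      iter-injective : ∀ i {x y} → x < n → y < n → iter σ i x ≡ iter σ i y → x ≡ y
      iter-injective zero    x<n y<n eq = eq
      iter-injective (suc i) x<n y<n eq = injective x<n y<n (iter-injective i (closed x<n) (closed y<n) eq)

      return : ∀ {x i j} → x < n → i < j → iter σ i x ≡ iter σ j x → iter σ (j ∸ i) x ≡ x
      return {x} {i} {j} x<n i<j eq = sym (iter-injective i x<n (iter< (j ∸ i) x<n) (begin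
        iter σ i x                 ≡⟨ eq ⟩
        iter σ j x                 ≡⟨ cong (λ t → iter σ t x) (sym (m∸n+n≡m (<⇒≤ i<j))) ⟩
        iter σ (j ∸ i + i) x       ≡⟨ iter-+ σ (j ∸ i) i x ⟩
        iter σ i (iter σ (j ∸ i) x) ∎))
        where open ≡-Reasoning

      period : ∀ {x} → x < n → ∃[ d ] 0 < d × d ≤ n × iter σ d x ≡ x
      period {x} x<n with any< (suc n) (λ j → any< j λ i → iter σ i x == iter σ j x) in found
      ... | true with any<-elim (suc n) found
      ...   | j , j<1+n , e with any<-elim j e
      ...     | i , i<j , eq = j ∸ i , m<n⇒0<n∸m i<j , ≤-trans (m∸n≤m j i) (s≤s⁻¹ j<1+n) , return x<n i<j (==⇒≡ eq)
      period {x} x<n | false = ⊥-elim (too-many (λ i → iter σ i x) ≤-refl (λ i _ → iter< i x<n) inj)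
        where
        distinct : ∀ i j → j < suc n → i < j → iter σ i x ≢ iter σ j x
        distinct i j j<1+n i<j eq with trans (sym found) (any<-intro (suc n) j<1+n (any<-intro j i<j
          (trans (cong (_== iter σ j x) eq) (==-refl (iter σ j x)))))
        ... | ()
        inj : ∀ i j → i < suc n → j < suc n → iter σ i x ≡ iter σ j x → i ≡ j
        inj i j i< j< eq with <-cmp i j
        ... | tri< i<j _ _ = ⊥-elim (distinct i j j< i<j eq)
        ... | tri≈ _ i≡j _ = i≡j
        ... | tri> _ _ j<i = ⊥-elim (distinct j i i< j<i (sym eq))

      -- If `d + 1` is a period of `x`, then `i * d` further steps undo `i` steps, because
      -- `i + i * d` is a multiple of the period.
      reach-sym : ∀ {x y} → x < n → Reach σ x y → Reach σ y x
      reach-sym {x} x<n (i , refl) with period x<n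
      ... | suc d , _ , _ , eq = i * d , (begin
        iter σ (i * d) (iter σ i x)   ≡⟨ iter-+ σ i (i * d) x ⟨
        iter σ (i + i * d) x          ≡⟨ cong (λ t → iter σ t x) (*-suc i d) ⟨
        iter σ (i * suc d) x          ≡⟨ iter-* σ (suc d) x eq i ⟩
        x                             ∎)
        where open ≡-Reasoning

      reduce : ∀ {x y d} → 0 < d → iter σ d x ≡ x → Reach σ x y → ∃[ i ] i < d × iter σ i x ≡ y
      reduce {x} {d = suc d} _ eq (i , refl) = i % suc d , m%n<n i (suc d) , (begin
        iter σ (i % suc d) x                                      ≡⟨ cong (iter σ (i % suc d)) (iter-* σ (suc d) x eq (i / suc d)) ⟨
        iter σ (i % suc d) (iter σ (i / suc d * suc d) x)         ≡⟨ iter-+ σ (i / suc d * suc d) (i % suc d) x ⟨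
        iter σ (i / suc d * suc d + i % suc d) x                  ≡⟨ cong (λ t → iter σ t x) (trans (+-comm _ (i % suc d)) (sym (m≡m%n+[m/n]*n i (suc d)))) ⟩
        iter σ i x                                                ∎)
        where open ≡-Reasoning

      reach? : ∀ {x} y → x < n → Reach σ x y ⊎ ¬ Reach σ x y
      reach? {x} y x<n with any< n (λ i → iter σ i x == y) in found
      ... | true with any<-elim n found
      ...   | i , _ , eq = inj₁ (i , ==⇒≡ eq)
      reach? {x} y x<n | false = inj₂ absurd
        where
        absurd : ¬ Reach σ x y
        absurd r with period x<n
        ... | d , 0<d , d≤n , eq with reduce 0<d eq r
        ...   | i , i<d , e with trans (sym found) (any<-intro n (≤-trans i<d d≤n) (trans (cong (_== y) e) (==-refl y)))
        ...     | ()

    module Switch {σ : ℕ → ℕ} (perm : Perm σ) (p q : ℕ) (p<n : p < n) (q<n : q < n) where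

      open Perm perm

      switched : ℕ → ℕ
      switched x with x ≟ p | x ≟ q
      ... | yes _ | _     = σ q
      ... | no  _ | yes _ = σ p
      ... | no  _ | no  _ = σ x

      data View (x : ℕ) : Set where
        at-p  : x ≡ p → switched x ≡ σ q → View x
        at-q  : x ≡ q → switched x ≡ σ p → View x
        other : x ≢ p → x ≢ q → switched x ≡ σ x → View x

      view : ∀ x → View x
      view x with x ≟ p | x ≟ q
      ... | yes x≡p | _       = at-p x≡p lemma
        where
        lemma : switched x ≡ σ q
        lemma with x ≟ p
        ... | yes _ = refl
        ... | no ne = ⊥-elim (ne x≡p)
      ... | no x≢p | yes x≡q = at-q x≡q lemma
        where
        lemma : switched x ≡ σ p
        lemma with x ≟ p | x ≟ q
        ... | yes e | _     = ⊥-elim (x≢p e)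
        ... | no _  | yes _ = refl
        ... | no _  | no ne = ⊥-elim (ne x≡q)
      ... | no x≢p | no x≢q = other x≢p x≢q lemma
        where
        lemma : switched x ≡ σ x
        lemma with x ≟ p | x ≟ q
        ... | yes e | _     = ⊥-elim (x≢p e)
        ... | no _  | yes e = ⊥-elim (x≢q e)
        ... | no _  | no _  = refl

      switched-other : ∀ {x} → x ≢ p → x ≢ q → switched x ≡ σ x
      switched-other {x} x≢p x≢q with view x
      ... | at-p e _      = ⊥-elim (x≢p e)
      ... | at-q e _      = ⊥-elim (x≢q e)
      ... | other _ _ eq  = eq

      switched-perm : p ≢ q → Perm switched
      switched-perm p≢q = record { closed = cl ; injective = inj }
        where
        cl : ∀ {x} → x < n → switched x < n
        cl {x} x<n with view x
        ... | at-p _ eq    = subst (_< n) (sym eq) (closed q<n)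
        ... | at-q _ eq    = subst (_< n) (sym eq) (closed p<n)
        ... | other _ _ eq = subst (_< n) (sym eq) (closed x<n)
        inj : ∀ {x y} → x < n → y < n → switched x ≡ switched y → x ≡ y
        inj {x} {y} x<n y<n eq with view x | view y
        ... | at-p refl e | at-p refl e′ = refl
        ... | at-q refl e | at-q refl e′ = refl
        ... | at-p refl e | at-q refl e′ = ⊥-elim (p≢q (sym (injective q<n p<n (trans (sym e) (trans eq e′)))))
        ... | at-q refl e | at-p refl e′ = ⊥-elim (p≢q (injective p<n q<n (trans (sym e) (trans eq e′))))
        ... | at-p refl e | other y≢p y≢q e′ = ⊥-elim (y≢q (sym (injective q<n y<n (trans (sym e) (trans eq e′)))))
        ... | at-q refl e | other y≢p y≢q e′ = ⊥-elim (y≢p (sym (injective p<n y<n (trans (sym e) (trans eq e′)))))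
        ... | other x≢p x≢q e | at-p refl e′ = ⊥-elim (x≢q (injective x<n q<n (trans (sym e) (trans eq e′))))
        ... | other x≢p x≢q e | at-q refl e′ = ⊥-elim (x≢p (injective x<n p<n (trans (sym e) (trans eq e′))))
        ... | other _ _ e | other _ _ e′ = injective x<n y<n (trans (sym e) (trans eq e′))

      module Joined (apart : ¬ Reach σ p q) where

        apart′ : ¬ Reach σ q p
        apart′ r = apart (reach-sym perm q<n r)

        p≢q : p ≢ q
        p≢q refl = apart reach-refl

        -- An orbit that leads to `q` avoids `p`, so the switched map agrees with `σ` along it until
        -- `q` is met. After the switch, `p` is therefore followed by the whole old orbit of `q`.
        follow-q : ∀ i x → iter σ i x ≡ q → Reach switched x q
        follow-q zero    x eq = 0 , eq
        follow-q (suc i) x eq with view x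
        ... | at-p refl _   = ⊥-elim (apart (suc i , eq))
        ... | at-q x≡q _    = 0 , x≡q
        ... | other _ _ eq′ = reach-trans (1 , eq′) (follow-q i (σ x) eq)

        follow-p : ∀ i x → iter σ i x ≡ p → Reach switched x p
        follow-p zero    x eq = 0 , eq
        follow-p (suc i) x eq with view x
        ... | at-p x≡p _    = 0 , x≡p
        ... | at-q refl _   = ⊥-elim (apart′ (suc i , eq))
        ... | other _ _ eq′ = reach-trans (1 , eq′) (follow-p i (σ x) eq)

        switched-p : switched p ≡ σ q
        switched-p with view p
        ... | at-p _ eq     = eq
        ... | at-q e _      = ⊥-elim (p≢q e)
        ... | other ne _ _  = ⊥-elim (ne refl)

        switched-q : switched q ≡ σ p
        switched-q with view q
        ... | at-p e _      = ⊥-elim (p≢q (sym e))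
        ... | at-q _ eq     = eq
        ... | other _ ne _  = ⊥-elim (ne refl)

        p→q : Reach switched p q
        p→q with reach-sym perm q<n reach-step
        ... | i , eq = reach-trans (1 , switched-p) (follow-q i (σ q) eq)

        q→p : Reach switched q p
        q→p with reach-sym perm p<n reach-step
        ... | i , eq = reach-trans (1 , switched-q) (follow-p i (σ p) eq)

        -- Ensures that switching only coarsens the partition into orbits: each step of `σ` can be
        -- replaced by a walk of the switched map.
        simulate : ∀ {x} → Reach switched x (σ x)
        simulate {x} with view x
        ... | at-p refl _   = reach-trans p→q (1 , switched-q)
        ... | at-q refl _   = reach-trans q→p (1 , switched-p)
        ... | other _ _ eq  = 1 , eq

    -- Switches with pairwise distinct sources can be made one after another, and
    -- each is made only when it joins two different orbits.
    merge : ∀ (adj : ℕ → ℕ → Bool) {σ} → Perm σ → (∀ {x} → x < n → adj x (σ x) ≡ true) →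
      ∀ J (p q : ℕ → ℕ) → (∀ j → j < J → p j < n × q j < n) →
      (∀ i j → i < J → j < J → i ≢ j → p i ≢ p j × q i ≢ q j) → (∀ i j → i < J → j < J → p i ≢ q j) →
      (∀ j → j < J → adj (p j) (σ (q j)) ≡ true × adj (q j) (σ (p j)) ≡ true) →
      ∃[ τ ] Perm τ × (∀ x → x < n → adj x (τ x) ≡ true) × (∀ x → x < n → Reach τ x (σ x)) ×
             (∀ j → j < J → Reach τ (p j) (q j))
    merge adj {σ} perm adjσ J p q pq<n distinct p≢q switchable = finish (go J ≤-refl)
      where
      record State (r : ℕ) : Set where
        field
          τ        : ℕ → ℕ
          perm-τ   : Perm τ
          adj-τ    : ∀ {x} → x < n → adj x (τ x) ≡ true
          coarser  : ∀ {x} → x < n → Reach τ x (σ x)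
          -- A switch not yet considered still finds the original images at its two sources, so its
          -- adjacency hypothesis, which speaks of `σ`, applies.
          intact   : ∀ j → j < J → r ≤ j → τ (p j) ≡ σ (p j) × τ (q j) ≡ σ (q j)
          joined   : ∀ j → j < r → Reach τ (p j) (q j)
      go : ∀ r → r ≤ J → State r
      go zero    r≤J = record
        { τ = σ ; perm-τ = perm ; adj-τ = adjσ ; coarser = λ _ → reach-step
        ; intact = λ _ _ _ → refl , refl ; joined = λ _ () }
      go (suc r) r<J with go r (<⇒≤ r<J)
      ... | s with reach? (State.perm-τ s) (q r) (proj₁ (pq<n r r<J))
      ...   | inj₁ yes-reach = record
        { τ = τ ; perm-τ = perm-τ ; adj-τ = adj-τ ; coarser = coarser
        ; intact = λ j j<J r<j → intact j j<J (<⇒≤ r<j)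
        ; joined = λ j j<1+r → extend j (m≤n⇒m<n∨m≡n (s≤s⁻¹ j<1+r)) }
        where
        open State s
        extend : ∀ j → j < r ⊎ j ≡ r → Reach τ (p j) (q j)
        extend j (inj₁ j<r)  = joined j j<r
        extend j (inj₂ refl) = yes-reach
      ...   | inj₂ no-reach = record
        { τ = switched
        ; perm-τ = switched-perm p≢q′
        ; adj-τ = adj′
        ; coarser = λ x<n → lift x<n (coarser x<n)
        ; intact = λ j j<J r<j →
            trans (switched-other (proj₁ (distinct j r j<J r<J λ e → <-irrefl (sym e) r<j)) (p≢q j r j<J r<J))
                  (proj₁ (intact j j<J (<⇒≤ r<j))) ,
            trans (switched-other (λ e → p≢q r j r<J j<J (sym e)) (proj₂ (distinct j r j<J r<J λ e → <-irrefl (sym e) r<j)))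
                  (proj₂ (intact j j<J (<⇒≤ r<j)))
        ; joined = λ j j<1+r → extend j (m≤n⇒m<n∨m≡n (s≤s⁻¹ j<1+r)) }
        where
        open State s
        pr<n = proj₁ (pq<n r r<J)
        qr<n = proj₂ (pq<n r r<J)
        open Switch perm-τ (p r) (q r) pr<n qr<n
        open Joined no-reach renaming (p≢q to p≢q′)
        lift : ∀ {x y} → x < n → Reach τ x y → Reach switched x y
        lift = reach-lift (Perm.closed perm-τ) λ _ → simulate
        adj′ : ∀ {x} → x < n → adj x (switched x) ≡ true
        adj′ {x} x<n with view x
        ... | at-p refl eq = trans (cong (adj x) (trans eq (proj₂ (intact r r<J ≤-refl)))) (proj₁ (switchable r r<J))
        ... | at-q refl eq = trans (cong (adj x) (trans eq (proj₁ (intact r r<J ≤-refl)))) (proj₂ (switchable r r<J))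
        ... | other _ _ eq = trans (cong (adj x) eq) (adj-τ x<n)
        extend : ∀ j → j < r ⊎ j ≡ r → Reach switched (p j) (q j)
        extend j (inj₁ j<r)  = lift (proj₁ (pq<n j (<-trans j<r r<J))) (joined j j<r)
        extend j (inj₂ refl) = p→q
      finish : State J → _
      finish s = τ , perm-τ , (λ _ → adj-τ) , (λ _ → coarser) , joined
        where open State s

    module SingleOrbit {σ : ℕ → ℕ} (perm : Perm σ) (v : ℕ) (v<n : v < n) (all : ∀ {x} → x < n → Reach σ v x) where

      -- A period `d < n` would leave only `d` places for the orbit of `v`, which consists of all
      -- `n` points.
      no-short-period : ∀ {d} → 0 < d → d < n → iter σ d v ≢ v
      no-short-period {d} 0<d d<n eq = too-many index d<n (λ x x<n → proj₁ (spec x x<n)) λ x y x<n y<n e →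
        trans (sym (proj₂ (spec x x<n))) (trans (cong (λ i → iter σ i v) e) (proj₂ (spec y y<n)))
        where
        index : ℕ → ℕ
        index x = find< d λ i → iter σ i v == x
        spec : ∀ x → x < n → index x < d × iter σ (index x) v ≡ x
        spec x x<n with reduce perm 0<d eq (all x<n)
        ... | i , i<d , e with find<-spec d (any<-intro d i<d (trans (cong (_== x) e) (==-refl x)))
        ...   | f<d , fe = f<d , ==⇒≡ fe

      order : iter σ n v ≡ v
      order with period perm v<n
      ... | d , 0<d , d≤n , eq with m≤n⇒m<n∨m≡n d≤n
      ...   | inj₁ d<n  = ⊥-elim (no-short-period 0<d d<n eq)
      ...   | inj₂ refl = eq

      position : ℕ → ℕ
      position x = find< n λ i → iter σ i v == x

      position-spec : ∀ {x} → x < n → position x < n × iter σ (position x) v ≡ x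
      position-spec {x} x<n with reduce perm (≤-<-trans z≤n v<n) order (all x<n)
      ... | i , i<n , e with find<-spec n (any<-intro n i<n (trans (cong (_== x) e) (==-refl x)))
      ...   | f<n , fe = f<n , ==⇒≡ fe

      iterates-distinct : ∀ {i j} → i < n → j < n → iter σ i v ≡ iter σ j v → i ≡ j
      iterates-distinct {i} {j} i<n j<n eq with <-cmp i j
      ... | tri≈ _ i≡j _ = i≡j
      ... | tri< i<j _ _ = ⊥-elim (no-short-period (m<n⇒0<n∸m i<j) (≤-<-trans (m∸n≤m j i) j<n) (return perm v<n i<j eq))
      ... | tri> _ _ j<i = ⊥-elim (no-short-period (m<n⇒0<n∸m j<i) (≤-<-trans (m∸n≤m i j) i<n) (return perm v<n j<i (sym eq)))

-- Choosing rotations by a fourth-moment potential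

module Moment where

  open import Data.Bool using (Bool)
  open import Data.Empty using (⊥-elim)
  open import Data.Integer hiding (suc; NonZero)
  open import Data.Integer.Properties
  open import Data.Integer.Tactic.RingSolver using (solve)
  open import Data.List using (_∷_; [])
  open import Data.Nat as ℕ using (ℕ; zero; suc; z≤n; s≤s; NonZero)
  import Data.Nat.DivMod as ℕ
  import Data.Nat.Properties as ℕ
  open import Data.Product using (∃-syntax; _×_; _,_; proj₁; proj₂)
  open import Data.Sum using (inj₁; inj₂)
  open import Relation.Binary.PropositionalEquality
  open import Relation.Nullary using (yes; no)
  open Sums using (∑; ⟦_⟧; ⟦⟧≤1; ∑-rotate; ∑-cong; ∑-split; ∑-mono; ∑-const)

  0≤+ : ∀ {i j} → 0ℤ ≤ i → 0ℤ ≤ j → 0ℤ ≤ i + j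
  0≤+ = +-mono-≤

  0≤* : ∀ {i j} → 0ℤ ≤ i → 0ℤ ≤ j → 0ℤ ≤ i * j
  0≤* {+ m} {+ n} _ _ = subst (0ℤ ≤_) (pos-* m n) (+≤+ z≤n)

  0≤square : ∀ i → 0ℤ ≤ i * i
  0≤square (+ n)    = subst (0ℤ ≤_) (pos-* n n) (+≤+ z≤n)
  0≤square -[1+ n ] = +≤+ z≤n

  ≤-by : ∀ {i j} s → 0ℤ ≤ s → j ≡ i + s → i ≤ j
  ≤-by {i} s 0≤s refl = ≤-trans (≤-reflexive (sym (+-identityʳ i))) (+-monoʳ-≤ i 0≤s)

  ∑ℤ : ℕ → (ℕ → ℤ) → ℤ
  ∑ℤ zero    f = 0ℤ
  ∑ℤ (suc n) f = ∑ℤ n f + f n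

  ∑ℤ-mono : ∀ n {f g : ℕ → ℤ} → (∀ i → i ℕ.< n → f i ≤ g i) → ∑ℤ n f ≤ ∑ℤ n g
  ∑ℤ-mono zero    le = ≤-refl
  ∑ℤ-mono (suc n) le = +-mono-≤ (∑ℤ-mono n λ i i<n → le i (ℕ.m<n⇒m<1+n i<n)) (le n ℕ.≤-refl)

  ∑ℤ-cong : ∀ n {f g : ℕ → ℤ} → (∀ i → i ℕ.< n → f i ≡ g i) → ∑ℤ n f ≡ ∑ℤ n g
  ∑ℤ-cong zero    eq = refl
  ∑ℤ-cong (suc n) eq = cong₂ _+_ (∑ℤ-cong n λ i i<n → eq i (ℕ.m<n⇒m<1+n i<n)) (eq n ℕ.≤-refl)

  ∑ℤ-+ : ∀ n (f g : ℕ → ℤ) → ∑ℤ n (λ i → f i + g i) ≡ ∑ℤ n f + ∑ℤ n g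
  ∑ℤ-+ zero    f g = refl
  ∑ℤ-+ (suc n) f g = trans (cong (_+ (f n + g n)) (∑ℤ-+ n f g)) (shuffle (∑ℤ n f) (∑ℤ n g) (f n) (g n))
    where
    shuffle : ∀ a b c d → (a + b) + (c + d) ≡ (a + c) + (b + d)
    shuffle a b c d = solve (a ∷ b ∷ c ∷ d ∷ [])

  ∑ℤ-*ʳ : ∀ n (f : ℕ → ℤ) c → ∑ℤ n (λ i → f i * c) ≡ ∑ℤ n f * c
  ∑ℤ-*ʳ zero    f c = sym (*-zeroˡ c)
  ∑ℤ-*ʳ (suc n) f c = trans (cong (_+ f n * c) (∑ℤ-*ʳ n f c)) (sym (*-distribʳ-+ c (∑ℤ n f) (f n)))

  ∑ℤ-const : ∀ n c → ∑ℤ n (λ _ → c) ≡ + n * c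
  ∑ℤ-const zero    c = sym (*-zeroˡ c)
  ∑ℤ-const (suc n) c = trans (cong (_+ c) (∑ℤ-const n c)) (trans (+-comm (+ n * c) c) (sym (suc-* (+ n) c)))

  ∑ℤ-swap : ∀ a b (f : ℕ → ℕ → ℤ) → ∑ℤ a (λ i → ∑ℤ b (f i)) ≡ ∑ℤ b (λ j → ∑ℤ a (λ i → f i j))
  ∑ℤ-swap zero    b f = sym (trans (∑ℤ-const b 0ℤ) (*-zeroʳ (+ b)))
  ∑ℤ-swap (suc a) b f = trans (cong (_+ ∑ℤ b (f a)) (∑ℤ-swap a b f)) (sym (∑ℤ-+ b (λ j → ∑ℤ a (λ i → f i j)) (f a)))

  0≤∑ℤ : ∀ n {f : ℕ → ℤ} → (∀ i → i ℕ.< n → 0ℤ ≤ f i) → 0ℤ ≤ ∑ℤ n f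
  0≤∑ℤ n {f} nonneg = ≤-trans (≤-reflexive (sym (trans (∑ℤ-const n 0ℤ) (*-zeroʳ (+ n))))) (∑ℤ-mono n nonneg)

  ∑ℤ-term : ∀ n {f : ℕ → ℤ} → (∀ i → i ℕ.< n → 0ℤ ≤ f i) → ∀ {i} → i ℕ.< n → f i ≤ ∑ℤ n f
  ∑ℤ-term (suc n) {f} nonneg {i} i<1+n with ℕ.m≤n⇒m<n∨m≡n (ℕ.s≤s⁻¹ i<1+n)
  ... | inj₁ i<n  = ≤-trans (∑ℤ-term n (λ j j<n → nonneg j (ℕ.m<n⇒m<1+n j<n)) i<n)
                      (≤-by (f n) (nonneg n ℕ.≤-refl) refl)
  ... | inj₂ refl = ≤-by (∑ℤ n f) (0≤∑ℤ n λ j j<n → nonneg j (ℕ.m<n⇒m<1+n j<n)) (+-comm (∑ℤ n f) (f n))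

  ∑ℤ-average : ∀ n (f : ℕ → ℤ) c → 0 ℕ.< n → ∑ℤ n f ≤ + n * c → ∃[ i ] i ℕ.< n × f i ≤ c
  ∑ℤ-average (suc n) f c _ le with f n ≤? c
  ... | yes fn≤c = n , ℕ.≤-refl , fn≤c
  ... | no  fn≰c with n
  ...   | zero   = ⊥-elim (fn≰c (subst₂ _≤_ (+-identityˡ (f 0)) (*-identityˡ c) le))
  ...   | suc n′ with ∑ℤ-average (suc n′) f c (s≤s z≤n) rest
    where
    rest : ∑ℤ (suc n′) f ≤ + suc n′ * c
    rest = ≤-by (f (suc n′) - c + (+ suc (suc n′) * c - (∑ℤ (suc n′) f + f (suc n′))))
      (0≤+ (i≤j⇒0≤j-i (<⇒≤ (≰⇒> fn≰c))) (i≤j⇒0≤j-i le))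
      (trans (rearrange (+ suc n′ * c) c (∑ℤ (suc n′) f) (f (suc n′)))
        (cong (λ t → ∑ℤ (suc n′) f + (f (suc n′) - c + (t - (∑ℤ (suc n′) f + f (suc n′))))) (sym (suc-* (+ suc n′) c))))
      where
      rearrange : ∀ a c s x → a ≡ s + (x - c + (c + a - (s + x)))
      rearrange a c s x = solve (a ∷ c ∷ s ∷ x ∷ [])
  ...     | i , i<n , fi≤c = i , ℕ.m<n⇒m<1+n i<n , fi≤c

  ∑ℤ-pos : ∀ n (f : ℕ → ℕ) → ∑ℤ n (λ i → + f i) ≡ + ∑ n f
  ∑ℤ-pos zero    f = refl
  ∑ℤ-pos (suc n) f = trans (cong (_+ + f n) (∑ℤ-pos n f)) (sym (pos-+ (∑ n f) (f n)))

  -- A fourth-moment supermartingale for sums of r increments bounded by p with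
  -- mean zero.
  potential : ℤ → ℤ → ℤ → ℤ
  potential p r D = D * D * (D * D) + + 8 * r * (p * p) * (D * D) + + 4 * (r * r) * (p * p * (p * p))

  -- The cubic term is traded by `4a³D = 2a²D² + 2a⁴ - 2a²(D - a)²`, which together with the `6a²D²`
  -- of the binomial expansion accounts for the coefficient 8. What remains is bounded by `a² ≤ p²`,
  -- except for the terms linear in `a`, which are kept since they vanish on average.
  potential-step : ∀ p r D a → 0ℤ ≤ r → 0ℤ ≤ p - a → 0ℤ ≤ p + a →
    potential p r (D + a) ≤ potential p (+ 1 + r) D + a * (+ 4 * (D * D * D) + + 16 * r * (p * p) * D)
  potential-step p r D a 0≤r 0≤p-a 0≤p+a = ≤-by
    (+ 8 * (D * D) * ((p - a) * (p + a)) + + 3 * (p * p + a * a) * ((p - a) * (p + a)) + + 2 * (a * a) * ((D - a) * (D - a))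
       + p * p * (p * p) + + 8 * r * (p * p) * ((p - a) * (p + a)))
    (slack≥0 (D * D) ((p - a) * (p + a)) (p * p) (a * a) ((D - a) * (D - a)) r
      (0≤square D) (0≤* 0≤p-a 0≤p+a) (0≤square p) (0≤square a) (0≤square (D - a)) 0≤r)
    (identity p r D a)
    where
    slack≥0 : ∀ d e p² a² s r → 0ℤ ≤ d → 0ℤ ≤ e → 0ℤ ≤ p² → 0ℤ ≤ a² → 0ℤ ≤ s → 0ℤ ≤ r →
      0ℤ ≤ + 8 * d * e + + 3 * (p² + a²) * e + + 2 * a² * s + p² * p² + + 8 * r * p² * e
    slack≥0 (+ d) (+ e) (+ p²) (+ a²) (+ s) (+ r) _ _ _ _ _ _ = 0≤+
      (0≤+ (0≤+ (0≤+ (0≤* {+ 8 * + d} {+ e} (0≤* {+ 8} {+ d} 0≤n 0≤n) 0≤n)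
                     (0≤* {+ 3 * (+ p² + + a²)} {+ e} (0≤* {+ 3} {+ p² + + a²} 0≤n 0≤n) 0≤n))
                (0≤* {+ 2 * + a²} {+ s} (0≤* {+ 2} {+ a²} 0≤n 0≤n) 0≤n))
           (0≤* {+ p²} {+ p²} 0≤n 0≤n))
      (0≤* {+ 8 * + r * + p²} {+ e} (0≤* {+ 8 * + r} {+ p²} (0≤* {+ 8} {+ r} 0≤n 0≤n) 0≤n) 0≤n)
      where
      0≤n : ∀ {n} → 0ℤ ≤ + n
      0≤n = +≤+ z≤n
    identity : ∀ p r D a →
      (D * D * (D * D) + + 8 * (+ 1 + r) * (p * p) * (D * D) + + 4 * ((+ 1 + r) * (+ 1 + r)) * (p * p * (p * p)))
        + a * (+ 4 * (D * D * D) + + 16 * r * (p * p) * D)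
      ≡ ((D + a) * (D + a) * ((D + a) * (D + a)) + + 8 * r * (p * p) * ((D + a) * (D + a)) + + 4 * (r * r) * (p * p * (p * p)))
        + (+ 8 * (D * D) * ((p - a) * (p + a)) + + 3 * (p * p + a * a) * ((p - a) * (p + a)) + + 2 * (a * a) * ((D - a) * (D - a))
           + p * p * (p * p) + + 8 * r * (p * p) * ((p - a) * (p + a)))
    identity p r D a = solve (p ∷ r ∷ D ∷ a ∷ [])

  module Rotations (P I : ℕ) .{{_ : NonZero P}} where

    hit : (ℕ → ℕ → ℕ → Bool) → (ℕ → ℕ) → ℕ → ℕ → ℕ → ℕ
    hit G rot i t b = ⟦ G i b ((t ℕ.+ rot b) ℕ.% P) ⟧

    total : (ℕ → ℕ → ℕ → Bool) → ℕ → ℕ → ℕ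
    total G i b = ∑ P λ j → ⟦ G i b j ⟧

    deviation : (ℕ → ℕ → ℕ → Bool) → (ℕ → ℕ) → ℕ → ℕ → ℕ → ℤ
    deviation G rot m i t = + P * + ∑ m (hit G rot i t) - + ∑ m (total G i)

    energy : ℕ → (ℕ → ℕ → ℤ) → ℤ
    energy r D = ∑ℤ I λ i → ∑ℤ P λ t → potential (+ P) (+ r) (D i t)

    energy-cong : ∀ r {D D′ : ℕ → ℕ → ℤ} → (∀ i t → D i t ≡ D′ i t) → energy r D ≡ energy r D′
    energy-cong r eq = ∑ℤ-cong I λ i _ → ∑ℤ-cong P λ t _ → cong (potential (+ P) (+ r)) (eq i t)

    increment : (ℕ → ℕ → Bool) → ℕ → ℕ → ℕ → ℤ
    increment g r i t = + P * + ⟦ g i ((t ℕ.+ r) ℕ.% P) ⟧ - + ∑ P λ j → ⟦ g i j ⟧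

    -- Over all rotations of a block, the label `t` visits each of its positions exactly once.
    increments-cancel : ∀ g i t → ∑ℤ P (λ r → increment g r i t) ≡ 0ℤ
    increments-cancel g i t = begin
      ∑ℤ P (λ r → + P * + x r - + s)                       ≡⟨ ∑ℤ-+ P (λ r → + P * + x r) (λ _ → - + s) ⟩
      ∑ℤ P (λ r → + P * + x r) + ∑ℤ P (λ _ → - + s)         ≡⟨ cong₂ _+_ (trans (∑ℤ-cong P λ r _ → *-comm (+ P) (+ x r)) (∑ℤ-*ʳ P (λ r → + x r) (+ P))) (∑ℤ-const P (- + s)) ⟩
      ∑ℤ P (λ r → + x r) * + P + + P * (- + s)             ≡⟨ cong (λ y → y * + P + + P * (- + s)) (trans (∑ℤ-pos P x) (cong +_ rotated)) ⟩
      + s * + P + + P * (- + s)                            ≡⟨ vanish (+ s) (+ P) ⟩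
      0ℤ                                                   ∎
      where
      open ≡-Reasoning
      x : ℕ → ℕ
      x r = ⟦ g i ((t ℕ.+ r) ℕ.% P) ⟧
      s : ℕ
      s = ∑ P λ j → ⟦ g i j ⟧
      rotated : ∑ P x ≡ s
      rotated = trans (∑-rotate {P} {λ y → ⟦ g i (y ℕ.% P) ⟧} (λ y → cong (λ z → ⟦ g i z ⟧) (ℕ.[m+n]%n≡m%n y P)) t)
        (∑-cong P λ j j<P → cong (λ z → ⟦ g i z ⟧) (ℕ.m<n⇒m%n≡m j<P))
      vanish : ∀ s p → s * p + p * (- s) ≡ 0ℤ
      vanish s p = solve (s ∷ p ∷ [])

    increment-bounds : ∀ g r i t → 0ℤ ≤ + P - increment g r i t × 0ℤ ≤ + P + increment g r i t
    increment-bounds g r i t = bounds (⟦⟧≤1 (g i ((t ℕ.+ r) ℕ.% P)))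
      (ℕ.≤-trans (∑-mono P λ j _ → ⟦⟧≤1 (g i j)) (ℕ.≤-reflexive (trans (∑-const P 1) (ℕ.*-identityʳ P))))
      where
      bounds : ∀ {x s} → x ℕ.≤ 1 → s ℕ.≤ P → 0ℤ ≤ + P - (+ P * + x - + s) × 0ℤ ≤ + P + (+ P * + x - + s)
      bounds {zero} {s} _ s≤P =
        subst (0ℤ ≤_) (eq₁ (+ P) (+ s)) (+≤+ z≤n) ,
        subst (0ℤ ≤_) (eq₂ (+ P) (+ s)) (i≤j⇒0≤j-i (+≤+ s≤P))
        where
        eq₁ : ∀ p s → p + s ≡ p - (p * 0ℤ - s)
        eq₁ p s = solve (p ∷ s ∷ [])
        eq₂ : ∀ p s → p - s ≡ p + (p * 0ℤ - s)
        eq₂ p s = solve (p ∷ s ∷ [])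
      bounds {suc zero} {s} _ s≤P =
        subst (0ℤ ≤_) (eq₁ (+ P) (+ s)) (+≤+ z≤n) ,
        subst (0ℤ ≤_) (eq₂ (+ P) (+ s)) (0≤+ {+ P} {+ P - + s} (+≤+ z≤n) (i≤j⇒0≤j-i (+≤+ s≤P)))
        where
        eq₁ : ∀ p s → s ≡ p - (p * 1ℤ - s)
        eq₁ p s = solve (p ∷ s ∷ [])
        eq₂ : ∀ p s → p + (p - s) ≡ p + (p * 1ℤ - s)
        eq₂ p s = solve (p ∷ s ∷ [])
      bounds {suc (suc _)} (s≤s ())

    -- Averaging `potential-step` over all rotations removes the linear terms, so some rotation does
    -- no worse than the average, and it does so for the total over all `i` and `t` at once.
    good-rotation : ∀ r g D → ∃[ ρ ] ρ ℕ.< P × energy r (λ i t → D i t + increment g ρ i t) ≤ energy (suc r) D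
    good-rotation r g D = ∑ℤ-average P _ _ (ℕ.>-nonZero⁻¹ P) (begin
      ∑ℤ P (λ ρ → energy r (λ i t → D i t + increment g ρ i t))
        ≤⟨ ∑ℤ-mono P (λ ρ _ → ∑ℤ-mono I λ i _ → ∑ℤ-mono P λ t _ →
             potential-step (+ P) (+ r) (D i t) (increment g ρ i t) (+≤+ z≤n)
               (proj₁ (increment-bounds g ρ i t)) (proj₂ (increment-bounds g ρ i t))) ⟩
      ∑ℤ P (λ ρ → ∑ℤ I λ i → ∑ℤ P λ t → pot i t + increment g ρ i t * slope i t)
        ≡⟨ ∑ℤ-swap P I _ ⟩
      ∑ℤ I (λ i → ∑ℤ P λ ρ → ∑ℤ P λ t → pot i t + increment g ρ i t * slope i t)
        ≡⟨ ∑ℤ-cong I (λ i _ → ∑ℤ-swap P P _) ⟩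
      ∑ℤ I (λ i → ∑ℤ P λ t → ∑ℤ P λ ρ → pot i t + increment g ρ i t * slope i t)
        ≡⟨ ∑ℤ-cong I (λ i _ → ∑ℤ-cong P λ t _ → mean i t) ⟩
      ∑ℤ I (λ i → ∑ℤ P λ t → pot i t * + P)
        ≡⟨ ∑ℤ-cong I (λ i _ → ∑ℤ-*ʳ P (pot i) (+ P)) ⟩
      ∑ℤ I (λ i → ∑ℤ P (pot i) * + P)
        ≡⟨ ∑ℤ-*ʳ I (λ i → ∑ℤ P (pot i)) (+ P) ⟩
      energy (suc r) D * + P
        ≡⟨ *-comm (energy (suc r) D) (+ P) ⟩
      + P * energy (suc r) D ∎)
      where
      open ≤-Reasoning
      pot slope : ℕ → ℕ → ℤ
      pot i t = potential (+ P) (+ 1 + + r) (D i t)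
      slope i t = + 4 * (D i t * D i t * D i t) + + 16 * + r * (+ P * + P) * D i t
      mean : ∀ i t → ∑ℤ P (λ ρ → pot i t + increment g ρ i t * slope i t) ≡ pot i t * + P
      mean i t = trans (∑ℤ-+ P (λ _ → pot i t) (λ ρ → increment g ρ i t * slope i t))
        (trans (cong₂ _+_ (trans (∑ℤ-const P (pot i t)) (*-comm (+ P) (pot i t)))
          (trans (∑ℤ-*ʳ P (λ ρ → increment g ρ i t) (slope i t)) (trans (cong (_* slope i t) (increments-cancel g i t)) (*-zeroˡ (slope i t)))))
          (+-identityʳ (pot i t * + P)))

    cons : ℕ → (ℕ → ℕ) → ℕ → ℕ
    cons ρ rot zero    = ρ
    cons ρ rot (suc b) = rot b

    -- The method of conditional expectations: the parameter of the energy counts the blocks still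
    -- to be rotated, and `D` collects the deviations of those already fixed.
    rotations : ∀ m G D → ∃[ rot ] (∀ b → rot b ℕ.< P) ×
      energy 0 (λ i t → D i t + deviation G rot m i t) ≤ energy m D
    rotations zero G D = (λ _ → 0) , (λ _ → ℕ.>-nonZero⁻¹ P) , ≤-reflexive (energy-cong 0 unchanged)
      where
      unchanged : ∀ i t → D i t + deviation G (λ _ → 0) 0 i t ≡ D i t
      unchanged i t = trans (cong (λ z → D i t + (z - 0ℤ)) (*-zeroʳ (+ P))) (+-identityʳ (D i t))
    rotations (suc m) G D = extend (good-rotation m (λ i j → G i 0 j) D)
      where
      G′ : ℕ → ℕ → ℕ → Bool
      G′ i b j = G i (suc b) j
      first : ℕ → ℕ → ℕ → ℤ
      first = increment (λ i j → G i 0 j)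
      regroup : ∀ d p x xs s ss → d + (p * (x + xs) - (s + ss)) ≡ d + (p * x - s) + (p * xs - ss)
      regroup d p x xs s ss = solve (d ∷ p ∷ x ∷ xs ∷ s ∷ ss ∷ [])
      split : ∀ ρ rot i t → D i t + deviation G (cons ρ rot) (suc m) i t ≡ D i t + first ρ i t + deviation G′ rot m i t
      split ρ rot i t = trans
        (cong₂ (λ x s → D i t + (+ P * x - s))
          (trans (cong +_ (∑-split 1 m (hit G (cons ρ rot) i t))) (pos-+ ⟦ G i 0 ((t ℕ.+ ρ) ℕ.% P) ⟧ _))
          (trans (cong +_ (∑-split 1 m (total G i))) (pos-+ (total G i 0) _)))
        (regroup (D i t) (+ P) _ _ (+ total G i 0) _)
      cons< : ∀ {ρ rot} → ρ ℕ.< P → (∀ b → rot b ℕ.< P) → ∀ b → cons ρ rot b ℕ.< P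
      cons< ρ<P rot< zero    = ρ<P
      cons< ρ<P rot< (suc b) = rot< b
      extend : ∃[ ρ ] ρ ℕ.< P × energy m (λ i t → D i t + first ρ i t) ≤ energy (suc m) D → _
      extend (ρ , ρ<P , le) with rotations m G′ (λ i t → D i t + first ρ i t)
      ... | rot , rot< , le′ = cons ρ rot , cons< ρ<P rot< ,
              ≤-trans (≤-reflexive (energy-cong 0 (split ρ rot))) (≤-trans le′ le)

-- Equidistribution of the labels

module Sampling where

  open import Data.Bool using (Bool)
  open import Data.Integer using (ℤ; 0ℤ; +_)
  import Data.Integer as ℤ
  import Data.Integer.Properties as ℤ
  import Data.Integer.Tactic.RingSolver as ℤ
  open import Data.List using (_∷_; [])
  open import Data.Nat
  open import Data.Nat.DivMod
  open import Data.Nat.Properties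
  open import Data.Nat.Tactic.RingSolver using (solve)
  open import Data.Product using (∃-syntax; _×_; _,_)
  open import Relation.Binary.PropositionalEquality
  open import Relation.Nullary using (¬_)
  open Sums
  open Moment

  module _ (P I q m : ℕ) .{{_ : NonZero P}} (spread : 64 * (q * q * (q * q)) * (I * P) ≤ m * m)
    (G : ℕ → ℕ → ℕ → Bool) where

    open Rotations P I

    private
      B : ℕ
      B = 4 * (m * m) * (P * P * (P * P))

      initial : potential (+ P) (+ m) 0ℤ ≡ + B
      initial = trans (drop (+ P) (+ m) _) (begin
        + 4 ℤ.* (+ m ℤ.* + m) ℤ.* (+ P ℤ.* + P ℤ.* (+ P ℤ.* + P))
          ≡⟨ cong₂ (λ a b → + 4 ℤ.* a ℤ.* (b ℤ.* b)) (sym (ℤ.pos-* m m)) (sym (ℤ.pos-* P P)) ⟩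
        + 4 ℤ.* + (m * m) ℤ.* (+ (P * P) ℤ.* + (P * P))
          ≡⟨ cong₂ ℤ._*_ (sym (ℤ.pos-* 4 (m * m))) (sym (ℤ.pos-* (P * P) (P * P))) ⟩
        + (4 * (m * m)) ℤ.* + (P * P * (P * P))
          ≡⟨ ℤ.pos-* (4 * (m * m)) (P * P * (P * P)) ⟨
        + B ∎)
        where
        open ≡-Reasoning
        drop : ∀ p r x → 0ℤ ℤ.* 0ℤ ℤ.* (0ℤ ℤ.* 0ℤ) ℤ.+ + 8 ℤ.* r ℤ.* (p ℤ.* p) ℤ.* (0ℤ ℤ.* 0ℤ) ℤ.+ x ≡ x
        drop p r x = ℤ.solve (p ∷ r ∷ x ∷ [])

      energy-initial : energy m (λ _ _ → 0ℤ) ≡ + (I * (P * B))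
      energy-initial = begin
        ∑ℤ I (λ _ → ∑ℤ P λ _ → potential (+ P) (+ m) 0ℤ)  ≡⟨ ∑ℤ-cong I (λ i _ → trans (∑ℤ-cong P λ t _ → initial) (∑ℤ-const P (+ B))) ⟩
        ∑ℤ I (λ _ → + P ℤ.* + B)                           ≡⟨ ∑ℤ-const I (+ P ℤ.* + B) ⟩
        + I ℤ.* (+ P ℤ.* + B)                              ≡⟨ cong (+ I ℤ.*_) (ℤ.pos-* P B) ⟨
        + I ℤ.* + (P * B)                                  ≡⟨ ℤ.pos-* I (P * B) ⟨
        + (I * (P * B))                                    ∎
        where open ≡-Reasoning

      final : ∀ D → potential (+ P) 0ℤ D ≡ D ℤ.* D ℤ.* (D ℤ.* D)
      final D = simplify (+ P) D
        where
        simplify : ∀ p D → D ℤ.* D ℤ.* (D ℤ.* D) ℤ.+ + 8 ℤ.* 0ℤ ℤ.* (p ℤ.* p) ℤ.* (D ℤ.* D) ℤ.+ + 4 ℤ.* (0ℤ ℤ.* 0ℤ) ℤ.* (p ℤ.* p ℤ.* (p ℤ.* p))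
                   ≡ D ℤ.* D ℤ.* (D ℤ.* D)
        simplify p D = ℤ.solve (p ∷ D ∷ [])

      final≥0 : ∀ D → 0ℤ ℤ.≤ potential (+ P) 0ℤ D
      final≥0 D = subst (0ℤ ℤ.≤_) (sym (final D)) (0≤square (D ℤ.* D))

      -- A single excess above `m P / (2 q)` would have a fourth power larger than the whole initial
      -- energy `4 I m² P⁵`; this is exactly what `spread` excludes.
      too-large : ∀ h s → 2 * q * s + m * P < 2 * q * (P * h) →
        ¬ (let D = 0ℤ ℤ.+ (+ P ℤ.* + h ℤ.- + s) in D ℤ.* D ℤ.* (D ℤ.* D) ℤ.≤ + (I * (P * B)))
      too-large h s gap le = <-irrefl refl (begin-strict
        m * P * (m * P) * (m * P * (m * P))
          <⟨ *-mono-< (*-mono-< mP< mP<) (*-mono-< mP< mP<) ⟩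
        2 * q * δ * (2 * q * δ) * (2 * q * δ * (2 * q * δ))
          ≡⟨ gather q δ ⟩
        16 * (q * q * (q * q)) * (δ * δ * (δ * δ))
          ≤⟨ *-monoʳ-≤ (16 * (q * q * (q * q))) (ℤ.drop‿+≤+ (subst (ℤ._≤ + (I * (P * B))) power le)) ⟩
        16 * (q * q * (q * q)) * (I * (P * B))
          ≡⟨ regroup q I P m ⟩
        64 * (q * q * (q * q)) * (I * P) * (m * m * (P * P * (P * P)))
          ≤⟨ *-monoˡ-≤ (m * m * (P * P * (P * P))) spread ⟩
        m * m * (m * m * (P * P * (P * P)))
          ≡⟨ reorder m P ⟩
        m * P * (m * P) * (m * P * (m * P)) ∎)
        where
        open ≤-Reasoning
        δ : ℕ
        δ = P * h ∸ s
        s≤Ph : s ≤ P * h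
        s≤Ph = <⇒≤ (*-cancelˡ-< (2 * q) s (P * h) (≤-<-trans (m≤m+n (2 * q * s) (m * P)) gap))
        mP< : m * P < 2 * q * δ
        mP< = +-cancelˡ-< (2 * q * s) (m * P) (2 * q * δ) (≤-trans gap (≤-reflexive
          (trans (cong (2 * q *_) (sym (m+[n∸m]≡n s≤Ph))) (*-distribˡ-+ (2 * q) s δ))))
        D≡δ : 0ℤ ℤ.+ (+ P ℤ.* + h ℤ.- + s) ≡ + δ
        D≡δ = trans (ℤ.+-identityˡ _) (trans (cong (ℤ._- + s) (sym (ℤ.pos-* P h)))
          (trans (ℤ.m-n≡m⊖n (P * h) s) (ℤ.⊖-≥ s≤Ph)))
        power : (let D = 0ℤ ℤ.+ (+ P ℤ.* + h ℤ.- + s) in D ℤ.* D ℤ.* (D ℤ.* D)) ≡ + (δ * δ * (δ * δ))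
        power = trans (cong (λ D → D ℤ.* D ℤ.* (D ℤ.* D)) D≡δ)
          (trans (cong₂ ℤ._*_ (sym (ℤ.pos-* δ δ)) (sym (ℤ.pos-* δ δ))) (sym (ℤ.pos-* (δ * δ) (δ * δ))))
        gather : ∀ q δ → 2 * q * δ * (2 * q * δ) * (2 * q * δ * (2 * q * δ)) ≡ 16 * (q * q * (q * q)) * (δ * δ * (δ * δ))
        gather q δ = solve (q ∷ δ ∷ [])
        regroup : ∀ q I P m → 16 * (q * q * (q * q)) * (I * (P * (4 * (m * m) * (P * P * (P * P))))) ≡
                  64 * (q * q * (q * q)) * (I * P) * (m * m * (P * P * (P * P)))
        regroup q I P m = solve (q ∷ I ∷ P ∷ m ∷ [])
        reorder : ∀ m P → m * m * (m * m * (P * P * (P * P))) ≡ m * P * (m * P) * (m * P * (m * P))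
        reorder m P = solve (m ∷ P ∷ [])

    -- With denominators cleared: each label meets each of the `I` sets at most `m / (2 q)` times
    -- more often than an average label does.
    equidistributed : ∃[ rot ] (∀ b → rot b < P) × (∀ i t → i < I → t < P →
      2 * q * (P * ∑ m λ b → ⟦ G i b ((t + rot b) % P) ⟧) ≤ 2 * q * ∑ m (λ b → ∑ P λ j → ⟦ G i b j ⟧) + m * P)
    equidistributed = conclude (rotations m G (λ _ _ → 0ℤ))
      where
      conclude : ∃[ rot ] (∀ b → rot b < P) × energy 0 (λ i t → 0ℤ ℤ.+ deviation G rot m i t) ℤ.≤ energy m (λ _ _ → 0ℤ) → _
      conclude (rot , rot< , le) = rot , rot< , bound
        where
        bound : ∀ i t → i < I → t < P →
          2 * q * (P * ∑ m (hit G rot i t)) ≤ 2 * q * ∑ m (total G i) + m * P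
        bound i t i<I t<P = ≮⇒≥ λ gap → too-large (∑ m (hit G rot i t)) (∑ m (total G i)) gap
          (begin
            D i t ℤ.* D i t ℤ.* (D i t ℤ.* D i t)                ≡⟨ final (D i t) ⟨
            potential (+ P) 0ℤ (D i t)                           ≤⟨ ∑ℤ-term P {λ t → potential (+ P) 0ℤ (D i t)} (λ t _ → final≥0 (D i t)) t<P ⟩
            ∑ℤ P (λ t → potential (+ P) 0ℤ (D i t))              ≤⟨ ∑ℤ-term I {λ i → ∑ℤ P λ t → potential (+ P) 0ℤ (D i t)}
                                                                      (λ i _ → 0≤∑ℤ P λ t _ → final≥0 (D i t)) i<I ⟩
            energy 0 D                                           ≤⟨ le ⟩
            energy m (λ _ _ → 0ℤ)                                ≡⟨ energy-initial ⟩
            + (I * (P * B))                                      ∎)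
          where
          open ℤ.≤-Reasoning
          D : ℕ → ℕ → ℤ
          D i t = 0ℤ ℤ.+ deviation G rot m i t

-- Comparing sums over a window cell by cell

module Cells where

  open import Data.Empty using (⊥-elim)
  open import Data.List using (_∷_; [])
  open import Data.Nat
  open import Data.Nat.DivMod
  open import Data.Nat.Properties
  open import Data.Nat.Tactic.RingSolver using (solve)
  open import Relation.Binary.PropositionalEquality
  open import Data.Product using (_,_)
  open import Data.Sum using (inj₁; inj₂)
  open import Relation.Nullary using (yes; no)
  open Sums

  -- The circle ℤ/nℤ is cut into c cells of length s followed by a tail of length
  -- n - c s < n; the points Q n + a s are the cell boundaries of the lift to ℕ.
  module _ (n s c : ℕ) .{{_ : NonZero n}} .{{_ : NonZero s}} (cs≤n : c * s ≤ n) (0<c : 0 < c) where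

    module _ (f g : ℕ → ℕ) (lo hi bound : ℕ)
      (cell : ∀ Q a → a < c → lo ≤ Q * n + a * s → Q * n + a * s + s ≤ hi →
        ∑ s (λ j → g (Q * n + a * s + j)) ≤ ∑ s (λ j → f (Q * n + a * s + j)))
      (full : ∀ Q a → a < c → ∑ s (λ j → g (Q * n + a * s + j)) ≤ bound)
      (tail : ∀ Q j → c * s ≤ j → j < n → g (Q * n + j) ≡ 0) where

      private
        zero-run : ∀ Q y → y ≤ n → ∀ x → c * s ≤ x → x ≤ y → ∑ (Q * n + y) g ≤ ∑ (Q * n + x) g
        zero-run Q y y≤n x cs≤x x≤y with m≤n⇒∃[o]m+o≡n x≤y
        ... | o , refl = ≤-reflexive (begin
          ∑ (Q * n + (x + o)) g                                       ≡⟨ cong (λ t → ∑ t g) (+-assoc (Q * n) x o) ⟨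
          ∑ (Q * n + x + o) g                                         ≡⟨ ∑-split (Q * n + x) o g ⟩
          ∑ (Q * n + x) g + ∑ o (λ j → g (Q * n + x + j))             ≡⟨ cong (∑ (Q * n + x) g +_) (∑-zero o λ j j<o →
                trans (cong g (+-assoc (Q * n) x j)) (tail Q (x + j) (≤-trans cs≤x (m≤m+n x j)) (<-≤-trans (+-monoʳ-< x j<o) y≤n))) ⟩
          ∑ (Q * n + x) g + 0                                         ≡⟨ +-identityʳ _ ⟩
          ∑ (Q * n + x) g                                             ∎)
          where
          open ≡-Reasoning

        -- On the interval from `x` to `hi`, the sum of `g` exceeds that of `f` by at most `b`;
        -- prefix sums on both sides avoid subtraction.
        Claim : ℕ → ℕ → Set
        Claim x b = ∑ hi g + ∑ x f ≤ ∑ hi f + ∑ x g + b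

        stop : ∀ x b → x ≤ hi → ∑ hi g ≤ ∑ x g + b → Claim x b
        stop x b x≤hi le = arith (∑ hi g) (∑ x f) (∑ hi f) (∑ x g) le (∑-mono-range f x≤hi)
          where
          arith : ∀ G F F′ G′ → G ≤ G′ + b → F ≤ F′ → G + F ≤ F′ + G′ + b
          arith G F F′ G′ h₁ h₂ = certify 0 (h₁ ⊕ h₂) (solve (G ∷ F ∷ F′ ∷ G′ ∷ b ∷ []))

        continue : ∀ x x′ b b′ → ∑ x′ g + ∑ x f ≤ ∑ x′ f + ∑ x g + b → Claim x′ b′ → Claim x (b + b′)
        continue x x′ b b′ h₁ h₂ = arith (∑ hi g) (∑ x f) (∑ hi f) (∑ x g) (∑ x′ g) (∑ x′ f) h₁ h₂
          where
          arith : ∀ G F G′ F′ g₁ f₁ → g₁ + F ≤ f₁ + F′ + b → G + f₁ ≤ G′ + g₁ + b′ → G + F ≤ G′ + F′ + (b + b′)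
          arith G F G′ F′ g₁ f₁ h₁ h₂ = certify 0 (h₁ ⊕ h₂) (solve (G ∷ F ∷ F′ ∷ G′ ∷ g₁ ∷ f₁ ∷ b ∷ b′ ∷ []))

        next-boundary : ∀ Q a → Q * n + a * s + s ≡ Q * n + suc a * s
        next-boundary Q a = trans (+-assoc (Q * n) (a * s) s) (cong (Q * n +_) (+-comm (a * s) s))

        next-period : ∀ Q → Q * n + n ≡ suc Q * n + 0 * s
        next-period Q = trans (+-comm (Q * n) n) (sym (+-identityʳ (n + Q * n)))

        add-cell : ∀ x → ∑ s (λ j → g (x + j)) ≤ bound → ∑ (x + s) g ≤ ∑ x g + bound
        add-cell x le = ≤-trans (≤-reflexive (∑-split x s g)) (+-monoʳ-≤ (∑ x g) le)

        -- Here `d` is fuel: it bounds the distance left to `hi`, and every complete cell consumes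
        -- some of it.
        from-cell : ∀ d Q a → a < c → lo ≤ Q * n + a * s → Q * n + a * s ≤ hi → hi ≤ Q * n + a * s + d →
          Claim (Q * n + a * s) bound
        from-tail : ∀ d Q → lo ≤ Q * n + c * s → Q * n + c * s ≤ hi → hi ≤ Q * n + c * s + d → Claim (Q * n + c * s) bound
        after : ∀ d Q a → a < c → lo ≤ Q * n + suc a * s → Q * n + suc a * s ≤ hi → hi ≤ Q * n + suc a * s + d →
          Claim (Q * n + suc a * s) bound

        from-cell d Q a a<c lo≤x x≤hi hi≤ with Q * n + a * s + s ≤? hi
        ... | no  x+s≰hi = stop (Q * n + a * s) bound x≤hi
                (≤-trans (∑-mono-range g (<⇒≤ (≰⇒> x+s≰hi))) (add-cell (Q * n + a * s) (full Q a a<c)))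
        from-cell zero Q a a<c lo≤x x≤hi hi≤ | yes x+s≤hi = ⊥-elim (<-irrefl refl (≤-trans
          (m<m+n (Q * n + a * s) (>-nonZero⁻¹ s)) (≤-trans x+s≤hi (≤-trans hi≤ (≤-reflexive (+-identityʳ _))))))
        from-cell (suc d) Q a a<c lo≤x x≤hi hi≤ | yes x+s≤hi = continue (Q * n + a * s) (Q * n + suc a * s) 0 bound
          (subst (λ x′ → ∑ x′ g + ∑ (Q * n + a * s) f ≤ ∑ x′ f + ∑ (Q * n + a * s) g + 0) (next-boundary Q a) step)
          (after d Q a a<c (≤-trans lo≤x (≤-trans (m≤m+n _ s) (≤-reflexive (next-boundary Q a))))
            (subst (_≤ hi) (next-boundary Q a) x+s≤hi)
            (≤-trans hi≤ (≤-trans (≤-reflexive (+-suc _ d)) (+-monoˡ-≤ d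
              (≤-trans (m<m+n (Q * n + a * s) (>-nonZero⁻¹ s)) (≤-reflexive (next-boundary Q a)))))))
          where
          arith : ∀ G F x y → x ≤ y → G + x + F ≤ F + y + G + 0
          arith G F x y h = certify 0 h (solve (G ∷ F ∷ x ∷ y ∷ []))
          step : ∑ (Q * n + a * s + s) g + ∑ (Q * n + a * s) f ≤ ∑ (Q * n + a * s + s) f + ∑ (Q * n + a * s) g + 0
          step = subst₂ (λ u v → u + ∑ (Q * n + a * s) f ≤ v + ∑ (Q * n + a * s) g + 0)
            (sym (∑-split (Q * n + a * s) s g)) (sym (∑-split (Q * n + a * s) s f))
            (arith (∑ (Q * n + a * s) g) (∑ (Q * n + a * s) f) _ _ (cell Q a a<c lo≤x x+s≤hi))

        from-tail d Q lo≤x x≤hi hi≤ with Q * n + n ≤? hi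
        ... | no  y≰hi = stop (Q * n + c * s) bound x≤hi (≤-trans (≤-trans (∑-mono-range g (<⇒≤ (≰⇒> y≰hi)))
                (zero-run Q n ≤-refl (c * s) ≤-refl cs≤n)) (m≤m+n _ bound))
        ... | yes y≤hi = continue (Q * n + c * s) (suc Q * n + 0 * s) 0 bound
                (subst (λ x′ → ∑ x′ g + ∑ (Q * n + c * s) f ≤ ∑ x′ f + ∑ (Q * n + c * s) g + 0) (next-period Q)
                  (arith _ _ _ _ (zero-run Q n ≤-refl (c * s) ≤-refl cs≤n) (∑-mono-range f (+-monoʳ-≤ (Q * n) cs≤n))))
                (from-cell d (suc Q) 0 0<c
                  (≤-trans lo≤x (≤-trans (+-monoʳ-≤ (Q * n) cs≤n) (≤-reflexive (next-period Q))))
                  (subst (_≤ hi) (next-period Q) y≤hi)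
                  (≤-trans hi≤ (+-monoˡ-≤ d (≤-trans (+-monoʳ-≤ (Q * n) cs≤n) (≤-reflexive (next-period Q))))))
          where
          arith : ∀ G F G′ F′ → G ≤ G′ → F ≤ F′ → G + F ≤ F′ + G′ + 0
          arith G F G′ F′ h₁ h₂ = certify 0 (h₁ ⊕ h₂) (solve (G ∷ F ∷ F′ ∷ G′ ∷ []))

        after d Q a a<c lo≤x x≤hi hi≤ with m≤n⇒m<n∨m≡n a<c
        ... | inj₁ 1+a<c = from-cell d Q (suc a) 1+a<c lo≤x x≤hi hi≤
        ... | inj₂ refl  = from-tail d Q lo≤x x≤hi hi≤

      -- Complete cells favour `f` and the tails contribute nothing to `g`. Only the incomplete
      -- cells at the two ends of the interval can cost anything, at most `bound` each.
      cells-bound : lo ≤ hi → ∑ hi g + ∑ lo f ≤ ∑ hi f + ∑ lo g + (bound + bound)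
      cells-bound lo≤hi with c * s ≤? lo % n
      ... | yes cs≤r = proof
        where
        Q r : ℕ
        Q = lo / n
        r = lo % n
        lo≡ : Q * n + r ≡ lo
        lo≡ = trans (+-comm (Q * n) r) (sym (m≡m%n+[m/n]*n lo n))
        lo≤end : lo ≤ Q * n + n
        lo≤end = ≤-trans (≤-reflexive (sym lo≡)) (+-monoʳ-≤ (Q * n) (<⇒≤ (m%n<n lo n)))
        run : ∑ (Q * n + n) g ≤ ∑ lo g
        run = subst (λ x → ∑ (Q * n + n) g ≤ ∑ x g) lo≡ (zero-run Q n ≤-refl r cs≤r (<⇒≤ (m%n<n lo n)))
        arith : ∀ G F G′ F′ b → G ≤ G′ → F ≤ F′ → G + F ≤ F′ + G′ + b
        arith G F G′ F′ b h₁ h₂ = certify b (h₁ ⊕ h₂) (solve (G ∷ F ∷ F′ ∷ G′ ∷ b ∷ []))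
        proof : Claim lo (bound + bound)
        proof with Q * n + n ≤? hi
        ... | no  y≰hi = stop lo (bound + bound) lo≤hi
                (≤-trans (≤-trans (∑-mono-range g (<⇒≤ (≰⇒> y≰hi))) run) (m≤m+n _ _))
        ... | yes y≤hi = continue lo (suc Q * n + 0 * s) bound bound
                (subst (λ x′ → ∑ x′ g + ∑ lo f ≤ ∑ x′ f + ∑ lo g + bound) (next-period Q)
                  (arith _ _ _ _ bound run (∑-mono-range f lo≤end)))
                (from-cell hi (suc Q) 0 0<c (≤-trans lo≤end (≤-reflexive (next-period Q)))
                  (subst (_≤ hi) (next-period Q) y≤hi) (m≤n+m hi _))
      ... | no cs≰r = proof
        where
        Q r a x : ℕ
        Q = lo / n
        r = lo % n
        a = r / s
        x = Q * n + a * s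
        a<c : a < c
        a<c = m<n*o⇒m/o<n (≰⇒> cs≰r)
        lo≡ : Q * n + r ≡ lo
        lo≡ = trans (+-comm (Q * n) r) (sym (m≡m%n+[m/n]*n lo n))
        x≤lo : x ≤ lo
        x≤lo = ≤-trans (+-monoʳ-≤ (Q * n) (m/n*n≤m r s)) (≤-reflexive lo≡)
        lo≤x+s : lo ≤ x + s
        lo≤x+s = ≤-trans (≤-reflexive (sym lo≡)) (≤-trans (+-monoʳ-≤ (Q * n) r≤) (≤-reflexive (sym (+-assoc (Q * n) (a * s) s))))
          where
          r≤ : r ≤ a * s + s
          r≤ = ≤-trans (≤-reflexive (m≡m%n+[m/n]*n r s)) (≤-trans (+-monoˡ-≤ (a * s) (<⇒≤ (m%n<n r s))) (≤-reflexive (+-comm s (a * s))))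
        grow : ∑ (x + s) g ≤ ∑ lo g + bound
        grow = ≤-trans (add-cell x (full Q a a<c)) (+-monoˡ-≤ bound (∑-mono-range g x≤lo))
        arith : ∀ G F G′ F′ b → G ≤ G′ + b → F ≤ F′ → G + F ≤ F′ + G′ + b
        arith G F G′ F′ b h₁ h₂ = certify 0 (h₁ ⊕ h₂) (solve (G ∷ F ∷ F′ ∷ G′ ∷ b ∷ []))
        proof : Claim lo (bound + bound)
        proof with x + s ≤? hi
        ... | no  y≰hi = stop lo (bound + bound) lo≤hi (≤-trans (≤-trans (∑-mono-range g (<⇒≤ (≰⇒> y≰hi))) grow)
                (+-monoʳ-≤ (∑ lo g) (m≤m+n bound bound)))
        ... | yes y≤hi = continue lo (Q * n + suc a * s) bound bound
                (subst (λ x′ → ∑ x′ g + ∑ lo f ≤ ∑ x′ f + ∑ lo g + bound) (next-boundary Q a)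
                  (arith _ _ _ _ bound grow (∑-mono-range f lo≤x+s)))
                (after hi Q a a<c (≤-trans lo≤x+s (≤-reflexive (next-boundary Q a)))
                  (subst (_≤ hi) (next-boundary Q a) y≤hi) (m≤n+m hi _))

    window-bound : ∀ (f g : ℕ → ℕ) lo w bound →
      (∀ Q a → a < c → lo ≤ Q * n + a * s → Q * n + a * s + s ≤ lo + w →
        ∑ s (λ j → g (Q * n + a * s + j)) ≤ ∑ s (λ j → f (Q * n + a * s + j))) →
      (∀ Q a → a < c → ∑ s (λ j → g (Q * n + a * s + j)) ≤ bound) →
      (∀ Q j → c * s ≤ j → j < n → g (Q * n + j) ≡ 0) →
      ∑ w (λ j → g (lo + j)) ≤ ∑ w (λ j → f (lo + j)) + (bound + bound)
    window-bound f g lo w bound cell full tail = arith (∑ lo g) _ (∑ lo f) _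
      (subst₂ (λ u v → u + ∑ lo f ≤ v + ∑ lo g + (bound + bound)) (∑-split lo w g) (∑-split lo w f)
        (cells-bound f g lo (lo + w) bound cell full tail (m≤m+n lo w)))
      where
      arith : ∀ G wg F wf → (G + wg) + F ≤ (F + wf) + G + (bound + bound) → wg ≤ wf + (bound + bound)
      arith G wg F wf h = certify 0 h (solve (G ∷ wg ∷ F ∷ wf ∷ bound ∷ []))

-- Blocks, labels and layers

module Layout where

  open import Data.Bool using (Bool; true; false; _∧_)
  open import Data.Empty using (⊥-elim)
  open import Data.List using (_∷_; [])
  open import Data.Bool.Properties using (∧-zeroʳ; ∧-identityʳ)
  open import Data.Nat
  open import Data.Nat.DivMod
  open import Data.Nat.Properties
  open import Data.Nat.Tactic.RingSolver using (solve)
  open import Data.Product using (∃-syntax; _×_; _,_; proj₁; proj₂)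
  open import Data.Sum using (inj₁; inj₂)
  open import Relation.Binary.PropositionalEquality
  open import Relation.Nullary using (yes; no)
  open import Relation.Nullary.Decidable using (⌊_⌋)
  open Sums
  open Hall using (_==_; ==-refl; ==⇒≡; ≢⇒==false)
  open CircleHall using (count)

  infix 4 _<?ᵇ_

  _<?ᵇ_ : ℕ → ℕ → Bool
  x <?ᵇ y = ⌊ x <? y ⌋

  <?ᵇ-true : ∀ {x y} → x < y → (x <?ᵇ y) ≡ true
  <?ᵇ-true {x} {y} x<y with x <? y
  ... | yes _   = refl
  ... | no  x≮y = ⊥-elim (x≮y x<y)

  <?ᵇ-true⁻ : ∀ {x y} → (x <?ᵇ y) ≡ true → x < y
  <?ᵇ-true⁻ {x} {y} eq with x <? y
  ... | yes x<y = x<y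

  <?ᵇ-false : ∀ {x y} → y ≤ x → (x <?ᵇ y) ≡ false
  <?ᵇ-false {x} {y} y≤x with x <? y
  ... | yes x<y = ⊥-elim (<-irrefl refl (<-≤-trans x<y y≤x))
  ... | no  _   = refl

  block-% : ∀ {P} .{{_ : NonZero P}} b {j} → j < P → (b * P + j) % P ≡ j
  block-% {P} b {j} j<P = trans (cong (_% P) (+-comm (b * P) j)) (trans ([m+kn]%n≡m%n j b P) (m<n⇒m%n≡m j<P))

  block-/ : ∀ {P} .{{_ : NonZero P}} b {j} → j < P → (b * P + j) / P ≡ b
  block-/ {P} b {j} j<P = *-cancelʳ-≡ _ _ P (+-cancelˡ-≡ j _ _ (begin
    j + (b * P + j) / P * P                        ≡⟨ cong (_+ (b * P + j) / P * P) (block-% b j<P) ⟨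
    (b * P + j) % P + (b * P + j) / P * P          ≡⟨ m≡m%n+[m/n]*n (b * P + j) P ⟨
    b * P + j                                      ≡⟨ +-comm (b * P) j ⟩
    j + b * P                                      ∎))
    where open ≡-Reasoning

  lift-% : ∀ {n} .{{_ : NonZero n}} Q {x} → x < n → (Q * n + x) % n ≡ x
  lift-% = block-%

  block< : ∀ {P b B j} → b < B → j < P → b * P + j < B * P
  block< {P} {b} {B} {j} b<B j<P = ≤-trans (+-monoʳ-< (b * P) j<P)
    (≤-trans (≤-reflexive (+-comm (b * P) P)) (*-monoˡ-≤ P b<B))

  [m%d+n]%d : ∀ m n d .{{_ : NonZero d}} → (m % d + n) % d ≡ (m + n) % d
  [m%d+n]%d m n d = begin
    (m % d + n) % d              ≡⟨ %-distribˡ-+ (m % d) n d ⟩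
    (m % d % d + n % d) % d      ≡⟨ cong (λ t → (t + n % d) % d) (m%n%n≡m%n m d) ⟩
    (m % d + n % d) % d          ≡⟨ %-distribˡ-+ m n d ⟨
    (m + n) % d                  ∎
    where open ≡-Reasoning

  rotate-back : ∀ {P} .{{_ : NonZero P}} {j r t} → j < P → r ≤ P → (j + (P ∸ r)) % P ≡ t → (t + r) % P ≡ j
  rotate-back {P} {j} {r} j<P r≤P refl = begin
    ((j + (P ∸ r)) % P + r) % P  ≡⟨ [m%d+n]%d (j + (P ∸ r)) r P ⟩
    (j + (P ∸ r) + r) % P        ≡⟨ cong (_% P) (trans (+-assoc j (P ∸ r) r) (cong (j +_) (m∸n+n≡m r≤P))) ⟩
    (j + P) % P                  ≡⟨ [m+n]%n≡m%n j P ⟩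
    j % P                        ≡⟨ m<n⇒m%n≡m j<P ⟩
    j                            ∎
    where open ≡-Reasoning

  rotate-label : ∀ {P} .{{_ : NonZero P}} {r t} → t < P → r ≤ P → ((t + r) % P + (P ∸ r)) % P ≡ t
  rotate-label {P} {r} {t} t<P r≤P = begin
    ((t + r) % P + (P ∸ r)) % P  ≡⟨ [m%d+n]%d (t + r) (P ∸ r) P ⟩
    (t + r + (P ∸ r)) % P        ≡⟨ cong (_% P) (trans (+-assoc t r (P ∸ r)) (cong (t +_) (m+[n∸m]≡n r≤P))) ⟩
    (t + P) % P                  ≡⟨ [m+n]%n≡m%n t P ⟩
    t % P                        ≡⟨ m<n⇒m%n≡m t<P ⟩
    t                            ∎
    where open ≡-Reasoning

  residue-count : ∀ D a {t} .{{_ : NonZero D}} → t < D → ∑ (a * D) (λ x → ⟦ x % D == t ⟧) ≡ a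
  residue-count D a {t} t<D = trans (∑-blocks a D (λ x → ⟦ x % D == t ⟧)) (trans (∑-cong a λ b _ → one b) (trans (∑-const a 1) (*-identityʳ a)))
    where
    one : ∀ b → ∑ D (λ j → ⟦ (b * D + j) % D == t ⟧) ≡ 1
    one b = trans (∑-single D _ t<D λ j j<D j≢t → cong ⟦_⟧ (≢⇒==false λ e → j≢t (trans (sym (block-% b j<D)) e)))
      (cong ⟦_⟧ (trans (cong (_== t) (block-% b t<D)) (==-refl t)))

  ∑-lipschitz : ∀ (f : ℕ → ℕ) → (∀ x → f x ≤ 1) → ∀ a b → ∑ a f ≤ ∑ b f + (a ∸ b)
  ∑-lipschitz f f≤1 a b with ≤-total a b
  ... | inj₁ a≤b = ≤-trans (∑-mono-range f a≤b) (m≤m+n _ _)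
  ... | inj₂ b≤a = begin
    ∑ a f                                       ≡⟨ cong (λ t → ∑ t f) (m+[n∸m]≡n b≤a) ⟨
    ∑ (b + (a ∸ b)) f                           ≡⟨ ∑-split b (a ∸ b) f ⟩
    ∑ b f + ∑ (a ∸ b) (λ j → f (b + j))         ≤⟨ +-monoʳ-≤ (∑ b f) (∑-mono (a ∸ b) λ j _ → f≤1 (b + j)) ⟩
    ∑ b f + ∑ (a ∸ b) (λ _ → 1)                 ≡⟨ cong (∑ b f +_) (trans (∑-const (a ∸ b) 1) (*-identityʳ (a ∸ b))) ⟩
    ∑ b f + (a ∸ b)                             ∎
    where open ≤-Reasoning

  -- Of the points of one window, only those beyond one end of the other can be lost, and there are
  -- at most `d` of them.
  window-shift : ∀ (f : ℕ → ℕ) → (∀ x → f x ≤ 1) → ∀ w d x y → x ≤ y + d → y ≤ x + d →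
    ∑ w (λ j → f (x + j)) ≤ ∑ w (λ j → f (y + j)) + d
  window-shift f f≤1 w d x y x≤ y≤ = arith (∑ x f) (∑ y f) _ _ (x ∸ y) (y ∸ x)
    (≤-trans (≤-reflexive (sym (∑-split x w f))) (≤-trans (∑-lipschitz f f≤1 (x + w) (y + w))
      (≤-reflexive (cong₂ _+_ (∑-split y w f) (trans (cong₂ _∸_ (+-comm x w) (+-comm y w)) ([m+n]∸[m+o]≡n∸o w x y))))))
    (∑-lipschitz f f≤1 y x) gap
    where
    arith : ∀ X Y wx wy u v → X + wx ≤ Y + wy + u → Y ≤ X + v → u + v ≤ d → wx ≤ wy + d
    arith X Y wx wy u v h₁ h₂ h₃ = certify 0 (h₁ ⊕ h₂ ⊕ h₃) (solve (X ∷ Y ∷ wx ∷ wy ∷ u ∷ v ∷ d ∷ []))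
    gap : (x ∸ y) + (y ∸ x) ≤ d
    gap with ≤-total x y
    ... | inj₁ x≤y = ≤-trans (≤-reflexive (cong (_+ (y ∸ x)) (m≤n⇒m∸n≡0 x≤y))) (m≤n+o⇒m∸n≤o y x y≤)
    ... | inj₂ y≤x = ≤-trans (≤-reflexive (trans (cong ((x ∸ y) +_) (m≤n⇒m∸n≡0 y≤x)) (+-identityʳ _))) (m≤n+o⇒m∸n≤o x y x≤)

  -- The first B P vertices form B blocks of length P, and the rotation of a block
  -- assigns the labels 0, …, P - 1 to its vertices.
  module Labels (n P B : ℕ) .{{_ : NonZero n}} .{{_ : NonZero P}} (BP≤n : B * P ≤ n)
    (rot : ℕ → ℕ) (rot< : ∀ b → rot b < P) where

    block offset label : ℕ → ℕ
    block v = (v % n) / P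
    offset v = (v % n) % P
    label v = (offset v + (P ∸ rot (block v))) % P

    blocked : ℕ → Bool
    blocked v = v % n <?ᵇ B * P

    layer : ℕ → ℕ → Bool
    layer t v = blocked v ∧ (label v == t)

    -- The inverse of the pair of `label` and `block` on blocked vertices: the place in block `b` to
    -- which its rotation moves the label `t`.
    pos : ℕ → ℕ → ℕ
    pos t b = b * P + (t + rot b) % P

    %n-periodic : ∀ {A : Set} (f : ℕ → A) → Periodic n (λ v → f (v % n))
    %n-periodic f v = cong f ([m+n]%n≡m%n v n)

    blocked-periodic : Periodic n blocked
    blocked-periodic = %n-periodic (_<?ᵇ B * P)

    layer-periodic : ∀ t → Periodic n (layer t)
    layer-periodic t = %n-periodic λ x → (x <?ᵇ B * P) ∧ ((x % P + (P ∸ rot (x / P))) % P == t)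

    label< : ∀ v → label v < P
    label< v = m%n<n (offset v + (P ∸ rot (block v))) P

    module _ (Q : ℕ) {b j : ℕ} (b<B : b < B) (j<P : j < P) where

      private
        in-range : b * P + j < n
        in-range = <-≤-trans (block< b<B j<P) BP≤n

      lift-block : block (Q * n + (b * P + j)) ≡ b
      lift-block = trans (cong (_/ P) (lift-% Q in-range)) (block-/ b j<P)

      lift-offset : offset (Q * n + (b * P + j)) ≡ j
      lift-offset = trans (cong (_% P) (lift-% Q in-range)) (block-% b j<P)

      lift-blocked : blocked (Q * n + (b * P + j)) ≡ true
      lift-blocked = trans (cong (_<?ᵇ B * P) (lift-% Q in-range)) (<?ᵇ-true (block< b<B j<P))

      lift-label : label (Q * n + (b * P + j)) ≡ (j + (P ∸ rot b)) % P
      lift-label = cong₂ (λ x y → (x + (P ∸ rot y)) % P) lift-offset lift-block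

    module _ (Q t : ℕ) {b : ℕ} (b<B : b < B) where

      private
        o<P : (t + rot b) % P < P
        o<P = m%n<n (t + rot b) P

      pos-blocked : blocked (Q * n + pos t b) ≡ true
      pos-blocked = lift-blocked Q b<B o<P

      pos-block : block (Q * n + pos t b) ≡ b
      pos-block = lift-block Q b<B o<P

      pos-label : t < P → label (Q * n + pos t b) ≡ t
      pos-label t<P = trans (lift-label Q b<B o<P) (rotate-label t<P (<⇒≤ (rot< b)))

      pos< : pos t b < n
      pos< = <-≤-trans (block< b<B o<P) BP≤n

    layer⇒pos : ∀ v → v < n → blocked v ≡ true → block v < B × v ≡ pos (label v) (block v)
    layer⇒pos v v<n bl = b<B , (begin
        v                                           ≡⟨ v%n ⟨
        v % n                                       ≡⟨ m≡m%n+[m/n]*n (v % n) P ⟩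
        offset v + block v * P                      ≡⟨ +-comm (offset v) _ ⟩
        block v * P + offset v                      ≡⟨ cong (block v * P +_) (rotate-back (m%n<n (v % n) P) (<⇒≤ (rot< (block v))) refl) ⟨
        pos (label v) (block v)                     ∎)
      where
      open ≡-Reasoning
      v%n : v % n ≡ v
      v%n = m<n⇒m%n≡m v<n
      b<B : block v < B
      b<B = m<n*o⇒m/o<n (<?ᵇ-true⁻ bl)

    layer-block-sum : ∀ Q t (X : ℕ → Bool) {b} → b < B → t < P →
      ∑ P (λ j → ⟦ X (Q * n + (b * P + j)) ∧ layer t (Q * n + (b * P + j)) ⟧) ≡ ⟦ X (Q * n + pos t b) ⟧
    layer-block-sum Q t X {b} b<B t<P = trans (∑-single P _ (m%n<n (t + rot b) P) others) here
      where
      others : ∀ j → j < P → j ≢ (t + rot b) % P → ⟦ X (Q * n + (b * P + j)) ∧ layer t (Q * n + (b * P + j)) ⟧ ≡ 0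
      others j j<P j≢ with layer t (Q * n + (b * P + j)) in lay
      ... | false = cong ⟦_⟧ (∧-zeroʳ (X (Q * n + (b * P + j))))
      ... | true  = ⊥-elim (j≢ (sym (rotate-back j<P (<⇒≤ (rot< b))
              (trans (sym (lift-label Q b<B j<P)) (==⇒≡ (proj₂ (∧-true⁻ {blocked (Q * n + (b * P + j))} lay)))))))
      here : ⟦ X (Q * n + pos t b) ∧ layer t (Q * n + pos t b) ⟧ ≡ ⟦ X (Q * n + pos t b) ⟧
      here = trans (cong (λ y → ⟦ X (Q * n + pos t b) ∧ y ⟧)
        (∧-true (pos-blocked Q t b<B) (trans (cong (_== t) (pos-label Q t b<B t<P)) (==-refl t)))) (cong ⟦_⟧ (∧-identityʳ (X (Q * n + pos t b))))

    layer-blocks : ∀ t → t < P → ∀ b → b ≤ B → ∑ (b * P) (λ v → ⟦ layer t v ⟧) ≡ b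
    layer-blocks t t<P b b≤B = trans (∑-blocks b P (λ v → ⟦ layer t v ⟧))
      (trans (∑-cong b λ b′ b′<b → layer-block-sum 0 t (λ _ → true) (<-≤-trans b′<b b≤B) t<P)
        (trans (∑-const b 1) (*-identityʳ b)))

    tail-unlabelled : ∀ Q x → B * P ≤ x → x < n → blocked (Q * n + x) ≡ false
    tail-unlabelled Q x BP≤x x<n = trans (cong (_<?ᵇ B * P) (lift-% Q x<n)) (<?ᵇ-false BP≤x)

    tail-sum : ∀ t x → B * P ≤ x → x ≤ n → ∑ x (λ v → ⟦ layer t v ⟧) ≡ ∑ (B * P) (λ v → ⟦ layer t v ⟧)
    tail-sum t x BP≤x x≤n with m≤n⇒∃[o]m+o≡n BP≤x
    ... | o , refl = trans (∑-split (B * P) o (λ v → ⟦ layer t v ⟧)) (trans (cong (∑ (B * P) (λ v → ⟦ layer t v ⟧) +_)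
          (∑-zero o λ j j<o → cong (λ y → ⟦ y ∧ (label (B * P + j) == t) ⟧)
            (tail-unlabelled 0 (B * P + j) (m≤m+n _ j) (<-≤-trans (+-monoʳ-< (B * P) j<o) x≤n))))
          (+-identityʳ _))

    layer-total : ∀ t → t < P → count (layer t) n ≡ B
    layer-total t t<P = trans (tail-sum t n BP≤n ≤-refl) (layer-blocks t t<P B ≤-refl)

    -- Every block contains each label exactly once, so the prefix counts of two layers can only
    -- differ through the single block that is cut at `x`.
    layer-prefix : ∀ x → ∃[ N ] (∀ t → t < P → N ≤ count (layer t) x × count (layer t) x ≤ N + 1)
    layer-prefix x = base , λ t t<P → bounds t t<P
      where
      Q r : ℕ
      Q = x / n
      r = x % n
      x≡ : x ≡ Q * n + r
      x≡ = trans (m≡m%n+[m/n]*n x n) (+-comm r (Q * n))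
      partial : ∃[ N ] (∀ t → t < P → N ≤ count (layer t) r × count (layer t) r ≤ N + 1)
      partial with B * P ≤? r
      ... | yes BP≤r = B , λ t t<P → let eq = trans (tail-sum t r BP≤r (<⇒≤ (m%n<n x n))) (layer-blocks t t<P B ≤-refl) in
              ≤-reflexive (sym eq) , ≤-trans (≤-reflexive eq) (m≤m+n B 1)
      ... | no  BP≰r = b , λ t t<P →
              ≤-trans (≤-reflexive (sym (layer-blocks t t<P b (<⇒≤ b<B)))) (∑-mono-range _ (m/n*n≤m r P)) ,
              ≤-trans (∑-mono-range _ r≤) (≤-trans (≤-reflexive (layer-blocks t t<P (suc b) b<B)) (≤-reflexive (+-comm 1 b)))
        where
        b : ℕ
        b = r / P
        b<B : b < B
        b<B = m<n*o⇒m/o<n (≰⇒> BP≰r)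
        r≤ : r ≤ suc b * P
        r≤ = ≤-trans (≤-reflexive (m≡m%n+[m/n]*n r P)) (+-monoˡ-≤ (b * P) (<⇒≤ (m%n<n r P)))
      base : ℕ
      base = Q * B + proj₁ partial
      bounds : ∀ t → t < P → base ≤ count (layer t) x × count (layer t) x ≤ base + 1
      bounds t t<P = subst (λ z → base ≤ z × z ≤ base + 1) (sym eq)
        (+-monoʳ-≤ (Q * B) (proj₁ (proj₂ partial t t<P)) ,
         ≤-trans (+-monoʳ-≤ (Q * B) (proj₂ (proj₂ partial t t<P))) (≤-reflexive (sym (+-assoc (Q * B) _ 1))))
        where
        eq : count (layer t) x ≡ Q * B + count (layer t) r
        eq = trans (cong (count (layer t)) x≡) (trans (∑-periods (λ v → cong ⟦_⟧ (layer-periodic t v)) Q r)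
          (cong (λ z → Q * z + count (layer t) r) (layer-total t t<P)))

-- Counting non-neighbours within one layer

module Distribution where

  open import Data.Bool using (Bool; true; false; _∧_; not)
  open import Data.Empty using (⊥-elim)
  open import Data.List using (_∷_; [])
  open import Data.Nat
  open import Data.Nat.DivMod
  open import Data.Nat.Properties
  open import Data.Nat.Tactic.RingSolver using (solve)
  open import Data.Product using (proj₁; proj₂)
  open import Relation.Binary.PropositionalEquality
  open Sums
  open CircleHall using (count; count≤; periodic-⟦⟧)
  open Cells using (window-bound)
  open Layout
  open Sampling using (equidistributed)

  module Distributed (n k q P m c : ℕ) .{{_ : NonZero n}} .{{_ : NonZero q}} .{{_ : NonZero P}} .{{_ : NonZero m}}
    (k≡ : k ≡ 16 * q * (m * P)) (window≤n : k + suc k ≤ n)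
    (cells≤n : c * (m * P) ≤ n) (n<cells : n < c * (m * P) + m * P)
    (spread : 64 * (q * q * (q * q)) * (40 * q * (m * P) * P) ≤ m * m)
    (adj : ℕ → ℕ → Bool) (perˡ : ∀ y → Periodic n (λ x → adj x y)) (perʳ : ∀ x → Periodic n (adj x))
    (dense : ∀ y → count (λ j → not (adj (y + k) (y + j))) (k + suc k) + 64 * (m * P) ≤ k) where

    -- A vertex whose window, displaced by at most `2 * s`, contains a given cell lies at most `e`
    -- before the start of that cell.
    s w e : ℕ
    s = m * P
    w = k + suc k
    e = k + suc s

    instance
      s-nonZero : NonZero s
      s-nonZero = m*n≢0 m P

    1≤q : 1 ≤ q
    1≤q = >-nonZero⁻¹ q

    1≤s : 1 ≤ s
    1≤s = >-nonZero⁻¹ s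

    s≤k : s ≤ k
    s≤k = ≤-trans (arith q s 1≤q) (≤-reflexive (sym k≡))
      where
      arith : ∀ q s → 1 ≤ q → s ≤ 16 * q * s
      arith q s 1≤q = certify (15 * q * s) (s ⊗ 1≤q) (solve (q ∷ s ∷ []))

    e≤n : e ≤ n
    e≤n = ≤-trans (+-monoʳ-≤ k (s≤s s≤k)) window≤n

    0<c : 0 < c
    0<c = positive c n<cells
      where
      positive : ∀ c → n < c * s + s → 0 < c
      positive zero    n<s = ⊥-elim (<-irrefl refl (<-≤-trans n<s (≤-trans s≤k (≤-trans (m≤m+n k (suc k)) window≤n))))
      positive (suc _) _   = s≤s z≤n

    private
      -- The sets sampled in cell `a` are the non-neighbourhoods of `40 q s` consecutive vertices
      -- beginning `e` before the cell, with `n ∸ e` representing `- e` on the circle. These are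
      -- enough because the relevant sources span fewer than `32 q s + 3 s + 2` places.
      family : ℕ → ℕ → ℕ → ℕ → Bool
      family a i b j = not (adj (a * s + (n ∸ e) + i) (a * s + (b * P + j)))

      rotations : ∀ a → _
      rotations a = equidistributed P (40 * q * (m * P)) q m spread (family a)

    rot : ℕ → ℕ
    rot b = proj₁ (rotations (b / m)) (b % m)

    rot< : ∀ b → rot b < P
    rot< b = proj₁ (proj₂ (rotations (b / m))) (b % m)

    B : ℕ
    B = c * m

    BP≡ : B * P ≡ c * s
    BP≡ = *-assoc c m P

    BP≤n : B * P ≤ n
    BP≤n = ≤-trans (≤-reflexive BP≡) cells≤n

    open Labels n P B BP≤n rot rot< public

    private
      reposition : ∀ Q a b x → Q * n + a * s + (b * P + x) ≡ Q * n + ((a * m + b) * P + x)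
      reposition Q a b x = trans (+-assoc (Q * n) (a * s) (b * P + x)) (cong (Q * n +_) (inner a b x m P))
        where
        inner : ∀ a b x m P → a * (m * P) + (b * P + x) ≡ (a * m + b) * P + x
        inner a b x m P = solve (a ∷ b ∷ x ∷ m ∷ P ∷ [])

    layer-cell-sum : ∀ Q a t (X : ℕ → Bool) → a < c → t < P →
      ∑ s (λ x → ⟦ X (Q * n + a * s + x) ∧ layer t (Q * n + a * s + x) ⟧) ≡ ∑ m (λ b → ⟦ X (Q * n + pos t (a * m + b)) ⟧)
    layer-cell-sum Q a t X a<c t<P = trans (∑-blocks m P _) (∑-cong m λ b b<m →
      trans (∑-cong P λ j _ → cong (λ y → ⟦ X y ∧ layer t y ⟧) (reposition Q a b j))
            (layer-block-sum Q t X (block< a<c b<m) t<P))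

    layer-cell-sum≤ : ∀ Q a t (X : ℕ → Bool) → a < c → t < P →
      ∑ s (λ x → ⟦ X (Q * n + a * s + x) ∧ layer t (Q * n + a * s + x) ⟧) ≤ m
    layer-cell-sum≤ Q a t X a<c t<P = ≤-trans (≤-reflexive (layer-cell-sum Q a t X a<c t<P))
      (≤-trans (∑-mono m λ b _ → ⟦⟧≤1 (X (Q * n + pos t (a * m + b)))) (≤-reflexive (trans (∑-const m 1) (*-identityʳ m))))

    tail-unblocked : ∀ Q j → c * s ≤ j → j < n → blocked (Q * n + j) ≡ false
    tail-unblocked Q j cs≤j = tail-unlabelled Q j (≤-trans (≤-reflexive BP≡) cs≤j)

    tail-layer : ∀ Q j t (X : Bool) → c * s ≤ j → j < n → ⟦ X ∧ layer t (Q * n + j) ⟧ ≡ 0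
    tail-layer Q j t X cs≤j j<n rewrite tail-unblocked Q j cs≤j j<n with X
    ... | true  = refl
    ... | false = refl

    -- The sampling error of a cell is `m * P`, the number of its vertices; distributed as 1 per
    -- vertex, it takes the pointwise form that `window-bound` can sum.
    cell-sample : ∀ Q a t v → a < c → t < P → Q * n + a * s ≤ v + e → v + e < Q * n + a * s + 40 * q * s →
      ∑ s (λ x → 2 * q * (P * ⟦ not (adj v (Q * n + a * s + x)) ∧ layer t (Q * n + a * s + x) ⟧)) ≤
      ∑ s (λ x → 2 * q * ⟦ not (adj v (Q * n + a * s + x)) ⟧ + 1)
    cell-sample Q a t v a<c t<P z≤v+e v+e< = begin
      ∑ s (λ x → 2 * q * (P * ⟦ X (z + x) ∧ layer t (z + x) ⟧))
        ≡⟨ trans (∑-* s (2 * q) _) (cong (2 * q *_) (trans (∑-* s P _) (cong (P *_) (layer-cell-sum Q a t X a<c t<P)))) ⟩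
      2 * q * (P * ∑ m (λ b → ⟦ X (Q * n + pos t (a * m + b)) ⟧))
        ≡⟨ cong (λ y → 2 * q * (P * y)) (∑-cong m λ b b<m → cong ⟦_⟧ (trans (cong X (sym (reposition Q a b _)))
             (trans (translate (b * P + (t + rot (a * m + b)) % P)) (cong (λ r → family a i b ((t + r) % P)) (rot-cell b b<m))))) ⟩
      2 * q * (P * ∑ m (λ b → ⟦ family a i b ((t + rotₐ b) % P) ⟧))
        ≤⟨ proj₂ (proj₂ (rotations a)) i t i< t<P ⟩
      2 * q * ∑ m (λ b → ∑ P λ j → ⟦ family a i b j ⟧) + s
        ≡⟨ cong (λ y → 2 * q * y + s) (trans (∑-cong m λ b _ → ∑-cong P λ j _ → cong ⟦_⟧ (sym (translate (b * P + j))))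
             (sym (∑-blocks m P λ x → ⟦ X (z + x) ⟧))) ⟩
      2 * q * ∑ s (λ x → ⟦ X (z + x) ⟧) + s
        ≡⟨ cong₂ _+_ (∑-* s (2 * q) _) (trans (∑-const s 1) (*-identityʳ s)) ⟨
      ∑ s (λ x → 2 * q * ⟦ X (z + x) ⟧) + ∑ s (λ _ → 1)
        ≡⟨ ∑-+ s _ (λ _ → 1) ⟨
      ∑ s (λ x → 2 * q * ⟦ X (z + x) ⟧ + 1) ∎
      where
      open ≤-Reasoning
      z i : ℕ
      z = Q * n + a * s
      i = v + e ∸ z
      X : ℕ → Bool
      X y = not (adj v y)
      rotₐ : ℕ → ℕ
      rotₐ = proj₁ (rotations a)
      rot-cell : ∀ b → b < m → rot (a * m + b) ≡ rotₐ b
      rot-cell b b<m = cong₂ (λ x y → proj₁ (rotations x) y) (block-/ a b<m) (block-% a b<m)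
      i< : i < 40 * q * s
      i< = +-cancelˡ-< z i (40 * q * s) (≤-trans (s≤s (≤-reflexive (m+[n∸m]≡n z≤v+e))) v+e<)
      source : a * s + (n ∸ e) + i + Q * n ≡ v + n
      source = +-cancelʳ-≡ e _ _ (trans (shuffle (a * s) (n ∸ e) i (Q * n) e)
        (trans (cong₂ _+_ (m+[n∸m]≡n z≤v+e) (m∸n+n≡m e≤n)) (+-swapʳ v e n)))
        where
        shuffle : ∀ x y i u e → x + y + i + u + e ≡ (u + x + i) + (y + e)
        shuffle x y i u e = solve (x ∷ y ∷ i ∷ u ∷ e ∷ [])
      translate : ∀ x → X (z + x) ≡ not (adj (a * s + (n ∸ e) + i) (a * s + x))
      translate x = cong not (trans (sym (perˡ (z + x) v))
        (trans (cong₂ adj (sym source) (trans (+-assoc (Q * n) (a * s) x) (+-comm (Q * n) (a * s + x))))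
          (trans (periodic-* (perˡ (a * s + x + Q * n)) (a * s + (n ∸ e) + i) Q)
            (periodic-* (perʳ (a * s + (n ∸ e) + i)) (a * s + x) Q))))

    non-neighbours-near : ∀ y y′ → y ≤ y′ + 2 * s → y′ ≤ y + 2 * s →
      count (λ j → not (adj (y′ + k) (y + j))) w + 62 * s ≤ k
    non-neighbours-near y y′ y≤ y′≤ = arith (count (λ j → not (adj (y′ + k) (y + j))) w) (count (λ j → not (adj (y′ + k) (y′ + j))) w) s k
      (window-shift (λ x → ⟦ not (adj (y′ + k) x) ⟧) (λ x → ⟦⟧≤1 (not (adj (y′ + k) x))) w (2 * s) y y′ y≤ y′≤) (dense y′)
      where
      arith : ∀ a b s k → a ≤ b + 2 * s → b + 64 * s ≤ k → a + 62 * s ≤ k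
      arith a b s k h₁ h₂ = certify 0 (h₁ ⊕ h₂) (solve (a ∷ b ∷ s ∷ k ∷ []))

    -- The surplus 64 s in the degree condition absorbs the sampling error and the
    -- contributions of the incomplete cells at both ends of the window.
    non-neighbours-in-layer : ∀ y y′ t → t < P → y ≤ y′ + 2 * s → y′ ≤ y + 2 * s →
      count (λ j → not (adj (y′ + k) (y + j)) ∧ layer t (y + j)) w + 43 * m ≤ 16 * q * m
    non-neighbours-in-layer y y′ t t<P y≤ y′≤ = *-cancelˡ-≤ (2 * q * P) (arith q P m k C F k≡
      (*-mono-≤ 1≤q 1≤s) (non-neighbours-near y y′ y≤ y′≤) main)
      where
      instance
        2qP≢0 : NonZero (2 * q * P)
        2qP≢0 = m*n≢0 (2 * q) P {{m*n≢0 2 q}}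
      v C F : ℕ
      v = y′ + k
      C = count (λ j → not (adj v (y + j)) ∧ layer t (y + j)) w
      F = count (λ j → not (adj v (y + j))) w
      main : 2 * q * (P * C) ≤ 2 * q * F + (k + suc k) + (2 * q * (P * m) + 2 * q * (P * m))
      main = subst₂ (λ a b → a ≤ b + (2 * q * (P * m) + 2 * q * (P * m)))
        (trans (∑-* w (2 * q) _) (cong (2 * q *_) (∑-* w P _)))
        (trans (∑-+ w _ (λ _ → 1)) (cong₂ _+_ (∑-* w (2 * q) _) (trans (∑-const w 1) (*-identityʳ w))))
        (window-bound n s c cells≤n 0<c (λ x → 2 * q * ⟦ not (adj v x) ⟧ + 1)
          (λ x → 2 * q * (P * ⟦ not (adj v x) ∧ layer t x ⟧)) y w (2 * q * (P * m))
          (λ Q a a<c y≤z z+s≤ → cell-sample Q a t v a<c t<P (low (Q * n + a * s) z+s≤) (high (Q * n + a * s) y≤z))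
          (λ Q a a<c → ≤-trans (≤-reflexive (trans (∑-* s (2 * q) _) (cong (2 * q *_) (∑-* s P _))))
             (*-monoʳ-≤ (2 * q) (*-monoʳ-≤ P (layer-cell-sum≤ Q a t (λ x → not (adj v x)) a<c t<P))))
          (λ Q j cs≤j j<n → trans (cong (λ z → 2 * q * (P * z)) (tail-layer Q j t (not (adj v (Q * n + j))) cs≤j j<n))
             (trans (cong (2 * q *_) (*-zeroʳ P)) (*-zeroʳ (2 * q)))))
        where
        low : ∀ z → z + s ≤ y + w → z ≤ v + e
        low z h = arith₁ z y y′ k s h y≤
          where
          arith₁ : ∀ z y y′ k s → z + s ≤ y + (k + suc k) → y ≤ y′ + 2 * s → z ≤ y′ + k + (k + suc s)
          arith₁ z y y′ k s h₁ h₂ = certify 0 (h₁ ⊕ h₂) (solve (z ∷ y ∷ y′ ∷ k ∷ s ∷ []))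
        high : ∀ z → y ≤ z → v + e < z + 40 * q * s
        high z h = arith₂ z y y′ k s q h y′≤ k≡ (≤-trans 1≤s (m≤m*n s q)) (s ⊗ 1≤q)
          where
          arith₂ : ∀ z y y′ k s q → y ≤ z → y′ ≤ y + 2 * s → k ≡ 16 * q * s → 1 ≤ s * q → s * 1 ≤ s * q →
            suc (y′ + k + (k + suc s)) ≤ z + 40 * q * s
          arith₂ z y y′ _ s q h₁ h₂ refl h₃ h₄ = certify (3 * q * s) (h₁ ⊕ h₂ ⊕ 2 ⊗ h₃ ⊕ 3 ⊗ h₄)
            (solve (z ∷ y ∷ y′ ∷ s ∷ q ∷ []))
      -- Measured per layer, the surplus of `62 m` loses `16 m` to the sampling error along the
      -- window and `2 m` to the two incomplete cells. Of the `44 m` left, one `m` covers the odd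
      -- vertex of the window.
      arith : ∀ q P m k C F → k ≡ 16 * q * (m * P) → 1 * 1 ≤ q * (m * P) → F + 62 * (m * P) ≤ k →
        2 * q * (P * C) ≤ 2 * q * F + (k + suc k) + (2 * q * (P * m) + 2 * q * (P * m)) →
        2 * q * P * (C + 43 * m) ≤ 2 * q * P * (16 * q * m)
      arith q P m _ C F refl h₁ h₂ h₃ = certify (q * (m * P)) (h₁ ⊕ (2 * q) ⊗ h₂ ⊕ h₃) (solve (q ∷ P ∷ m ∷ C ∷ F ∷ []))

    tail-count : ∀ (X : ℕ → Bool) x l → l ≤ n → (∀ v → X v ≡ true → blocked v ≡ false) → Periodic n X →
      count (λ j → X (x + j)) l ≤ ∑ (n ∸ c * s) (λ j → ⟦ X (c * s + j) ⟧)
    tail-count X x l l≤n tail-only per = begin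
      count (λ j → X (x + j)) l                                      ≤⟨ ∑-mono-range _ l≤n ⟩
      count (λ j → X (x + j)) n                                      ≡⟨ ∑-rotate (periodic-⟦⟧ per) x ⟩
      count X n                                                      ≡⟨ cong (count X) (m+[n∸m]≡n cells≤n) ⟨
      count X (c * s + (n ∸ c * s))                                  ≡⟨ ∑-split (c * s) _ _ ⟩
      count X (c * s) + ∑ (n ∸ c * s) (λ j → ⟦ X (c * s + j) ⟧)      ≡⟨ cong (_+ ∑ (n ∸ c * s) (λ j → ⟦ X (c * s + j) ⟧)) (∑-zero (c * s) head) ⟩
      ∑ (n ∸ c * s) (λ j → ⟦ X (c * s + j) ⟧)                        ∎
      where
      open ≤-Reasoning
      head : ∀ i → i < c * s → ⟦ X i ⟧ ≡ 0
      head i i<cs with X i in Xi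
      ... | false = refl
      ... | true with trans (sym (tail-only i Xi)) (<?ᵇ-true (<-≤-trans (subst (_< c * s) (sym (m<n⇒m%n≡m (<-≤-trans i<cs cells≤n))) i<cs) (≤-reflexive (sym BP≡))))
      ...   | ()

    tail< : n ∸ c * s ≤ s
    tail< = m≤n+o⇒m∸n≤o n (c * s) (<⇒≤ n<cells)

    -- The `k` vertices make up `16 q m` blocks. Of the loss `3 m`, one `m` accounts for the tail,
    -- which has at most `s = m P` vertices, and two for incomplete cells.
    layer-in-half-window : ∀ x t → t < P → 16 * q * m ≤ count (λ j → layer t (x + j)) k + 3 * m
    layer-in-half-window x t t<P = *-cancelˡ-≤ P (arith q P m k C I O k≡ (≤-reflexive (sym in+out)) (≤-trans out tail<) main)
      where
      C I O : ℕ
      C = count (λ j → layer t (x + j)) k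
      I = count (λ j → blocked (x + j)) k
      O = count (λ j → not (blocked (x + j))) k
      in+out : I + O ≡ k
      in+out = trans (sym (∑-+ k _ _)) (trans (∑-cong k λ j _ → ⟦⟧-not (blocked (x + j))) (trans (∑-const k 1) (*-identityʳ k)))
      k≤n : k ≤ n
      k≤n = ≤-trans (m≤m+n k (suc k)) window≤n
      out : O ≤ n ∸ c * s
      out = ≤-trans (tail-count (λ v → not (blocked v)) x k k≤n (λ v → flip (blocked v)) (λ v → cong not (blocked-periodic v)))
        (count≤ (λ j → not (blocked (c * s + j))) (n ∸ c * s))
        where
        flip : ∀ b → not b ≡ true → b ≡ false
        flip false _ = refl
      main : I ≤ P * C + (s + s)
      main = subst (λ y → I ≤ y + (s + s)) (∑-* k P _)
        (window-bound n s c cells≤n 0<c (λ v → P * ⟦ layer t v ⟧) (λ v → ⟦ blocked v ⟧) x k s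
          (λ Q a a<c _ _ → ≤-trans (whole Q a) (≤-reflexive (sym (trans (∑-* s P _) (trans (cong (P *_)
             (trans (layer-cell-sum Q a t (λ _ → true) a<c t<P) (trans (∑-const m 1) (*-identityʳ m)))) (*-comm P m))))))
          (λ Q a _ → whole Q a)
          (λ Q j cs≤j j<n → cong ⟦_⟧ (tail-unblocked Q j cs≤j j<n)))
        where
        whole : ∀ Q a → ∑ s (λ j → ⟦ blocked (Q * n + a * s + j) ⟧) ≤ s
        whole Q a = count≤ (λ j → blocked (Q * n + a * s + j)) s
      arith : ∀ q P m k C I O → k ≡ 16 * q * (m * P) → k ≤ I + O → O ≤ m * P → I ≤ P * C + (m * P + m * P) →
        P * (16 * q * m) ≤ P * (C + 3 * m)
      arith q P m _ C I O refl h₁ h₂ h₃ = certify 0 (h₁ ⊕ h₂ ⊕ h₃) (solve (q ∷ P ∷ m ∷ C ∷ I ∷ O ∷ []))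

-- Layers, reserve and items

module Classes where

  open import Data.Bool using (Bool; true; false; _∧_; not; if_then_else_)
  open import Data.List using (_∷_; [])
  open import Data.Nat
  open import Data.Nat.DivMod
  open import Data.Nat.Properties
  open import Data.Nat.Tactic.RingSolver using (solve)
  open import Data.Product using (∃-syntax; _,_; proj₁; proj₂)
  open import Data.Sum using (inj₁; inj₂)
  open import Relation.Binary.PropositionalEquality
  open Sums
  open Hall using (_==_; ==-refl; ==⇒≡)
  open CircleHall using (count; count≤)
  open Cells using (window-bound)
  open Layout
  open Distribution

  -- The window of a vertex is a set of 2 k + 1 consecutive vertices around it, a cell
  -- consists of m blocks of length P, and there are c cells.  Of the P labels, h M + 1
  -- are used for the layers and h = 7 + 3 q for the reserve: seven for the corners
  -- and 3 q for the pool.  In the degree condition, 1/q is proportional to ε.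
  record Setting : Set where
    field
      n k q P m c h M m′ : ℕ
      {{n≢0}} : NonZero n
      {{q≢0}} : NonZero q
      {{P≢0}} : NonZero P
      {{m≢0}} : NonZero m
      q-large : 65536 ≤ q
      h≡ : h ≡ 3 * q + 7
      M≡ : M ≡ 64 * q
      P≡ : P ≡ h * M + 1 + h
      m≡ : m ≡ m′ * M
      k≡ : k ≡ 16 * q * (m * P)
      window≤n : k + suc k ≤ n
      cells≤n : c * (m * P) ≤ n
      n<cells : n < c * (m * P) + m * P
      spread : 64 * (q * q * (q * q)) * (40 * q * (m * P) * P) ≤ m * m
      adj : ℕ → ℕ → Bool
      perˡ : ∀ y → Periodic n (λ x → adj x y)
      perʳ : ∀ x → Periodic n (adj x)
      adj-sym : ∀ x y → adj x y ≡ adj y x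
      dense : ∀ y → count (λ j → not (adj (y + k) (y + j))) (k + suc k) + 64 * (m * P) ≤ k

  count-below : ∀ r N → count (λ j → j <?ᵇ r) N ≤ r
  count-below r N with ≤-total N r
  ... | inj₁ N≤r = ≤-trans (count≤ (λ j → j <?ᵇ r) N) N≤r
  ... | inj₂ r≤N with m≤n⇒∃[o]m+o≡n r≤N
  ...   | o , refl = ≤-trans (≤-reflexive (trans (∑-split r o (λ j → ⟦ j <?ᵇ r ⟧)) (trans (cong (∑ r (λ j → ⟦ j <?ᵇ r ⟧) +_)
            (∑-zero o λ j _ → cong ⟦_⟧ (<?ᵇ-false (m≤m+n r j)))) (+-identityʳ _)))) (count≤ (λ j → j <?ᵇ r) r)

  -- Decoding the index: division by `h` returns the residue of the block modulo `M`, and the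
  -- remainder returns the reserve label.
  reserve-cases : ∀ L h M .{{_ : NonZero h}} .{{_ : NonZero M}} t b l β r → l ∸ suc L < h →
    ⟦ not (b ∧ (l <?ᵇ suc L)) ∧ ((if b then (β % M) * h + (l ∸ suc L) else r) == t) ⟧ ≤
    ⟦ (β % M == t / h) ∧ (b ∧ (l == suc L + t % h)) ⟧ + ⟦ not b ∧ (r == t) ⟧
  reserve-cases L h M t false l β r l<h = m≤n+m _ _
  reserve-cases L h M t true  l β r l<h = cases (l <?ᵇ suc L) refl
    where
    x : ℕ
    x = l ∸ suc L
    here : (l <?ᵇ suc L) ≡ false → ((β % M) * h + x == t) ≡ true → (β % M == t / h) ∧ (l == suc L + t % h) ≡ true
    here above eq = ∧-true
      (trans (cong (β % M ==_) (trans (cong (_/ h) (sym (==⇒≡ eq))) (block-/ (β % M) l<h))) (==-refl (β % M)))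
      (trans (cong (l ==_) (trans (cong (suc L +_) (trans (cong (_% h) (sym (==⇒≡ eq))) (block-% (β % M) l<h)))
        (m+[n∸m]≡n (≮⇒≥ λ lt → true≢false (<?ᵇ-true lt) above)))) (==-refl l))
    cases : ∀ y → (l <?ᵇ suc L) ≡ y → ⟦ not y ∧ ((β % M) * h + x == t) ⟧ ≤ ⟦ (β % M == t / h) ∧ (l == suc L + t % h) ⟧ + 0
    cases true  _  = z≤n
    cases false eq = ≤-trans (⟦⟧-mono (here eq)) (m≤m+n _ 0)

  module Classified (S : Setting) where

    open Setting S public
    open Distributed n k q P m c k≡ window≤n cells≤n n<cells spread adj perˡ perʳ dense public

    L : ℕ
    L = h * M

    L≢0 : NonZero L
    L≢0 = >-nonZero (≤-trans (s≤s z≤n) (*-mono-≤ (≤-trans (≤-trans (s≤s z≤n) (m≤n+m 7 (3 * q))) (≤-reflexive (sym h≡)))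
      (≤-trans (*-mono-≤ {1} {64} (s≤s z≤n) 1≤q) (≤-reflexive (sym M≡)))))

    instance
      L-nonZero : NonZero L
      L-nonZero = L≢0

      h-nonZero : NonZero h
      h-nonZero = m*n≢0⇒m≢0 h {{L≢0}}

      M-nonZero : NonZero M
      M-nonZero = m*n≢0⇒n≢0 h {{L≢0}}

    P≡1+L+h : P ≡ suc L + h
    P≡1+L+h = trans P≡ (cong (_+ h) (+-comm L 1))

    h<L : h < L
    h<L = ≤-trans (≤-trans (+-monoˡ-≤ h (>-nonZero⁻¹ h)) (≤-reflexive (cong (h +_) (sym (+-identityʳ h)))))
      (≤-trans (≤-reflexive (*-comm 2 h)) (*-monoʳ-≤ h (≤-trans (≤-trans (s≤s (s≤s z≤n)) (*-monoʳ-≤ 64 1≤q)) (≤-reflexive (sym M≡)))))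

    inner : ℕ → Bool
    inner v = blocked v ∧ (label v <?ᵇ suc L)

    -- The stage at which a reserve vertex is to be inserted. Since `L = h * M`, the reserve
    -- vertices of `M` consecutive blocks receive each stage exactly once; the vertices of the tail
    -- are dealt out cyclically.
    reserve-index : ℕ → ℕ
    reserve-index v = if blocked v then (block v % M) * h + (label v ∸ suc L) else (v % n ∸ c * s) % L

    reserve : ℕ → ℕ → Bool
    reserve t v = not (inner v) ∧ (reserve-index v == t)

    inner-periodic : Periodic n inner
    inner-periodic = %n-periodic λ x → (x <?ᵇ B * P) ∧ ((x % P + (P ∸ rot (x / P))) % P <?ᵇ suc L)

    reserve-index-periodic : Periodic n reserve-index
    reserve-index-periodic = %n-periodic λ x → if x <?ᵇ B * P
      then ((x / P) % M) * h + ((x % P + (P ∸ rot (x / P))) % P ∸ suc L) else (x ∸ c * s) % L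

    reserve-periodic : ∀ t → Periodic n (reserve t)
    reserve-periodic t v = cong₂ (λ a b → not a ∧ (b == t)) (inner-periodic v) (reserve-index-periodic v)

    private
      label-rest< : ∀ v → label v ∸ suc L < h
      label-rest< v = m<n+o⇒m∸n<o (label v) (suc L) (<-≤-trans (label< v) (≤-reflexive P≡1+L+h))

    reserve-index< : ∀ v → reserve-index v < L
    reserve-index< v = cases (blocked v)
      where
      cases : ∀ b → (if b then (block v % M) * h + (label v ∸ suc L) else (v % n ∸ c * s) % L) < L
      cases true  = <-≤-trans (block< (m%n<n (block v) M) (label-rest< v)) (≤-reflexive (*-comm M h))
      cases false = m%n<n (v % n ∸ c * s) L

    private
      tail-part : ℕ → ℕ → Bool
      tail-part t v = not (blocked v) ∧ ((v % n ∸ c * s) % L == t)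

      tail-part-periodic : ∀ t → Periodic n (tail-part t)
      tail-part-periodic t = %n-periodic λ x → not (x <?ᵇ B * P) ∧ ((x ∸ c * s) % L == t)

      in-block : ℕ → ℕ → Bool
      in-block t v = block v % M == t / h

      reserve-split : ∀ t v → ⟦ reserve t v ⟧ ≤ ⟦ in-block t v ∧ layer (suc L + t % h) v ⟧ + ⟦ tail-part t v ⟧
      reserve-split t v = reserve-cases L h M t (blocked v) (label v) (block v) ((v % n ∸ c * s) % L) (label-rest< v)

    -- A window spans about `32 q m` blocks, of which a fraction `1 / M` with `M = 64 q` serves the
    -- stage `t`: about `m / 2`, and at most `m` with the incomplete cells. The tail has at most
    -- `s ≤ 2 m L` vertices and so adds at most `2 m`.
    reserve-in-window : ∀ x t → t < L → count (λ j → reserve t (x + j)) w ≤ 3 * m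
    reserve-in-window x t t<L = begin
      count (λ j → reserve t (x + j)) w
        ≤⟨ ∑-mono w (λ j _ → reserve-split t (x + j)) ⟩
      ∑ w (λ j → ⟦ in-block t (x + j) ∧ layer τ (x + j) ⟧ + ⟦ tail-part t (x + j) ⟧)
        ≡⟨ ∑-+ w _ _ ⟩
      C + count (λ j → tail-part t (x + j)) w
        ≤⟨ +-mono-≤ C≤m tail≤2m ⟩
      m + 2 * m
        ≡⟨⟩
      3 * m ∎
      where
      open ≤-Reasoning
      τ C : ℕ
      τ = suc L + t % h
      C = count (λ j → in-block t (x + j) ∧ layer τ (x + j)) w
      τ<P : τ < P
      τ<P = ≤-trans (+-monoʳ-< (suc L) (m%n<n t h)) (≤-reflexive (sym P≡1+L+h))
      cell-sum : ∀ Q a → a < c → ∑ s (λ j → M * (P * ⟦ in-block t (Q * n + a * s + j) ∧ layer τ (Q * n + a * s + j) ⟧)) ≡ s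
      cell-sum Q a a<c = trans (∑-* s M _) (trans (cong (M *_) (trans (∑-* s P _) (cong (P *_) (trans
        (layer-cell-sum Q a τ (in-block t) a<c τ<P) (trans (∑-cong m λ b b<m → cong (λ z → ⟦ z == t / h ⟧)
          (trans (cong (_% M) (pos-block Q τ (block< a<c b<m))) (reduce a b)))
        (trans (cong (λ z → ∑ z (λ b → ⟦ b % M == t / h ⟧)) m≡) (residue-count M m′ (m<n*o⇒m/o<n (<-≤-trans t<L (≤-reflexive (*-comm h M)))))))))))
        (trans (regroup M P m′) (cong (_* P) (sym m≡))))
        where
        regroup : ∀ M P m′ → M * (P * m′) ≡ m′ * M * P
        regroup M P m′ = solve (M ∷ P ∷ m′ ∷ [])
        reduce : ∀ a b → (a * m + b) % M ≡ b % M
        reduce a b = trans (cong (λ z → (a * z + b) % M) m≡) (trans (cong (_% M)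
          (trans (+-comm (a * (m′ * M)) b) (cong (b +_) (sym (*-assoc a m′ M))))) ([m+kn]%n≡m%n b (a * m′) M))
      main : M * (P * C) ≤ w + (s + s)
      main = subst₂ (λ a b → a ≤ b + (s + s))
        (trans (∑-* w M _) (cong (M *_) (∑-* w P _))) (trans (∑-const w 1) (*-identityʳ w))
        (window-bound n s c cells≤n 0<c (λ _ → 1) (λ v → M * (P * ⟦ in-block t v ∧ layer τ v ⟧)) x w s
          (λ Q a a<c _ _ → ≤-reflexive (trans (cell-sum Q a a<c) (sym (trans (∑-const s 1) (*-identityʳ s)))))
          (λ Q a a<c → ≤-reflexive (cell-sum Q a a<c))
          (λ Q j cs≤j j<n → trans (cong (λ z → M * (P * z)) (tail-layer Q j τ (in-block t (Q * n + j)) cs≤j j<n))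
             (trans (cong (M *_) (*-zeroʳ P)) (*-zeroʳ M))))
      C≤m : C ≤ m
      C≤m = *-cancelˡ-≤ (64 * q * P) {{m*n≢0 (64 * q) P {{m*n≢0 64 q}}}} (arith q P m k C k≡ (*-mono-≤ 1≤q 1≤s) (s ⊗ 1≤q)
        (subst (λ M → M * (P * C) ≤ w + (s + s)) M≡ main))
        where
        arith : ∀ q P m k C → k ≡ 16 * q * (m * P) → 1 * 1 ≤ q * (m * P) → m * P * 1 ≤ m * P * q →
          64 * q * (P * C) ≤ k + suc k + (m * P + m * P) → 64 * q * P * C ≤ 64 * q * P * m
        arith q P m _ C refl h₁ h₂ h₃ = certify (29 * q * (m * P)) (h₁ ⊕ 2 ⊗ h₂ ⊕ h₃) (solve (q ∷ P ∷ m ∷ C ∷ []))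
      tail≤2m : count (λ j → tail-part t (x + j)) w ≤ 2 * m
      tail≤2m = begin
        count (λ j → tail-part t (x + j)) w
          ≤⟨ tail-count (tail-part t) x w window≤n (λ v e → not-blocked (proj₁ (∧-true⁻ {not (blocked v)} e))) (tail-part-periodic t) ⟩
        ∑ (n ∸ c * s) (λ j → ⟦ tail-part t (c * s + j) ⟧)
          ≤⟨ ∑-mono (n ∸ c * s) (λ j j< → ⟦⟧-mono λ e → trans (cong (λ z → z % L == t) (sym (strip j j<))) (proj₂ (∧-true⁻ {not (blocked (c * s + j))} e))) ⟩
        ∑ (n ∸ c * s) (λ j → ⟦ j % L == t ⟧)
          ≤⟨ ∑-mono-range _ (≤-trans tail< s≤2mL) ⟩
        ∑ (2 * m * L) (λ j → ⟦ j % L == t ⟧)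
          ≡⟨ residue-count L (2 * m) t<L ⟩
        2 * m ∎
        where
        not-blocked : ∀ {b} → not b ≡ true → b ≡ false
        not-blocked {false} _ = refl
        strip : ∀ j → j < n ∸ c * s → (c * s + j) % n ∸ c * s ≡ j
        strip j j< = trans (cong (_∸ c * s) (m<n⇒m%n≡m (<-≤-trans (+-monoʳ-< (c * s) j<) (≤-reflexive (m+[n∸m]≡n cells≤n))))) (m+n∸m≡n (c * s) j)
        s≤2mL : s ≤ 2 * m * L
        s≤2mL = ≤-trans (*-monoʳ-≤ m (≤-trans (≤-reflexive P≡1+L+h) (≤-trans (≤-reflexive (sym (+-suc L h))) (+-monoʳ-≤ L h<L))))
          (≤-reflexive (arith m L))
          where
          arith : ∀ m L → m * (L + L) ≡ 2 * m * L
          arith m L = solve (m ∷ L ∷ [])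

    -- The first five offsets of a block serve as names for its five slots. Placing the names on the
    -- circle turns the search for distinct link and mid vertices into an instance of
    -- `sparse-matching`.
    item : ℕ → Bool
    item v = blocked v ∧ (offset v <?ᵇ 5)

    item-periodic : Periodic n item
    item-periodic = %n-periodic λ x → (x <?ᵇ B * P) ∧ (x % P <?ᵇ 5)

    -- Five items in each of about `32 q m` blocks give `160 q m`; the remaining `q m` takes care of
    -- the ends of the window.
    capacity : ℕ
    capacity = 161 * q * m

    items-in-window : ∀ x → count (λ j → item (x + j)) w ≤ capacity
    items-in-window x = *-cancelˡ-≤ P (arith q P m k C k≡ 1≤s (s ⊗ ≤-trans (m≤m+n 15 65521) q-large) main)
      where
      C : ℕ
      C = count (λ j → item (x + j)) w
      cell-sum : ∀ Q a → a < c → ∑ s (λ j → P * ⟦ item (Q * n + a * s + j) ⟧) ≤ 5 * s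
      cell-sum Q a a<c = begin
        ∑ s (λ j → P * ⟦ item (Q * n + a * s + j) ⟧)                          ≡⟨ ∑-* s P _ ⟩
        P * ∑ s (λ j → ⟦ item (Q * n + a * s + j) ⟧)                          ≡⟨ cong (P *_) (∑-blocks m P _) ⟩
        P * ∑ m (λ b → ∑ P λ j → ⟦ item (Q * n + a * s + (b * P + j)) ⟧)      ≤⟨ *-monoʳ-≤ P (∑-mono m λ b b<m →
               ≤-trans (∑-mono P λ j j<P → ⟦⟧-mono λ e → trans (cong (_<?ᵇ 5) (sym (at b j b<m j<P))) (proj₂ (∧-true⁻ {blocked (Q * n + a * s + (b * P + j))} e)))
                       (count-below 5 P)) ⟩
        P * ∑ m (λ _ → 5)                                                     ≡⟨ cong (P *_) (∑-const m 5) ⟩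
        P * (m * 5)                                                           ≡⟨ regroup P m ⟩
        5 * s                                                                 ∎
        where
        open ≤-Reasoning
        regroup : ∀ P m → P * (m * 5) ≡ 5 * (m * P)
        regroup P m = solve (P ∷ m ∷ [])
        at : ∀ b j → b < m → j < P → offset (Q * n + a * s + (b * P + j)) ≡ j
        at b j b<m j<P = trans (cong offset (trans (+-assoc (Q * n) (a * s) (b * P + j)) (cong (Q * n +_) (place a b j m P))))
          (lift-offset Q (block< a<c b<m) j<P)
          where
          place : ∀ a b j m P → a * (m * P) + (b * P + j) ≡ (a * m + b) * P + j
          place a b j m P = solve (a ∷ b ∷ j ∷ m ∷ P ∷ [])
      main : P * C ≤ w * 5 + (5 * s + 5 * s)
      main = subst₂ (λ a b → a ≤ b + (5 * s + 5 * s)) (∑-* w P _) (∑-const w 5)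
        (window-bound n s c cells≤n 0<c (λ _ → 5) (λ v → P * ⟦ item v ⟧) x w (5 * s)
          (λ Q a a<c _ _ → ≤-trans (cell-sum Q a a<c) (≤-reflexive (sym (trans (∑-const s 5) (*-comm s 5)))))
          cell-sum
          (λ Q j cs≤j j<n → trans (cong (λ z → P * ⟦ z ∧ (offset (Q * n + j) <?ᵇ 5) ⟧) (tail-unblocked Q j cs≤j j<n)) (*-zeroʳ P)))
      arith : ∀ q P m k C → k ≡ 16 * q * (m * P) → 1 ≤ m * P → m * P * 15 ≤ m * P * q →
        P * C ≤ (k + suc k) * 5 + (5 * (m * P) + 5 * (m * P)) → P * C ≤ P * (161 * q * m)
      arith q P m _ C refl h₁ h₂ h₃ = certify 0 (5 ⊗ h₁ ⊕ h₂ ⊕ h₃) (solve (q ∷ P ∷ m ∷ C ∷ []))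

-- Common neighbours in the pool

module Gadgets where

  open import Data.Bool using (Bool; true; false; _∧_; _∨_; not)
  open import Data.Empty using (⊥-elim)
  open import Data.List using (_∷_; [])
  open import Data.Bool.Properties using (∧-zeroʳ)
  open import Data.Nat
  open import Data.Nat.DivMod
  open import Data.Nat.Properties
  open import Data.Nat.Tactic.RingSolver using (solve)
  open import Data.Product using (∃-syntax; _×_; _,_; proj₁; proj₂)
  open import Relation.Binary.PropositionalEquality
  open import Relation.Nullary using (yes; no)
  open Sums
  open Hall using (_==_; ==-refl; ≢⇒==false)
  open CircleHall using (count)
  open Layout
  open Classes

  -- Double counting the pairs of a point of `W` and an unmasked index that suits it. A masked index
  -- has no pairs and therefore cannot reach the positive average, so successive choices are
  -- distinct.
  pigeonhole-step : ∀ r w (W : ℕ → Bool) (mask : ℕ → Bool) (p : ℕ → ℕ → Bool) → 0 < r → 0 < count W w →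
    (∀ x → x < w → W x ≡ true → 1 ≤ ∑ r (λ i → ⟦ not (mask i) ∧ p i x ⟧)) →
    ∃[ a ] a < r × mask a ≡ false × count W w ≤ r * count (λ x → W x ∧ p a x) w
  pigeonhole-step r w W mask p 0<r 0<N often = a , a<r , fresh , le′
    where
    f : ℕ → ℕ
    f a = count (λ x → W x ∧ (not (mask a) ∧ p a x)) w
    expand : ∀ x → x < w → ⟦ W x ⟧ ≤ ∑ r (λ a → ⟦ W x ∧ (not (mask a) ∧ p a x) ⟧)
    expand x x<w with W x in Wx
    ... | false = z≤n
    ... | true  = often x x<w Wx
    average : ∃[ a ] a < r × count W w ≤ r * f a
    average = ∑-average r f (count W w) 0<r (≤-trans (∑-mono w expand)
      (≤-reflexive (∑-swap w r λ x a → ⟦ W x ∧ (not (mask a) ∧ p a x) ⟧)))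
    a : ℕ
    a = proj₁ average
    a<r : a < r
    a<r = proj₁ (proj₂ average)
    le : count W w ≤ r * f a
    le = proj₂ (proj₂ average)
    fresh : mask a ≡ false
    fresh with mask a in masked
    ... | false = refl
    ... | true  = ⊥-elim (<-irrefl refl (<-≤-trans 0<N (≤-trans le (≤-reflexive (trans (cong (r *_)
            (∑-zero w λ x _ → cong ⟦_⟧ (trans (cong (λ y → W x ∧ (not y ∧ p a x)) masked) (∧-zeroʳ (W x))))) (*-zeroʳ r))))))
    le′ : count W w ≤ r * count (λ x → W x ∧ p a x) w
    le′ = ≤-trans le (*-monoʳ-≤ r (∑-mono w λ x _ → ⟦⟧-mono λ e →
      ∧-true (proj₁ (∧-true⁻ {W x} e)) (proj₂ (∧-true⁻ {not (mask a)} (proj₂ (∧-true⁻ {W x} e))))))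

  mask-add : (ℕ → Bool) → ℕ → ℕ → Bool
  mask-add mask a i = mask i ∨ (i == a)

  unmask-one : ∀ r (mask : ℕ → Bool) (p : ℕ → Bool) a → a < r →
    ∑ r (λ i → ⟦ not (mask i) ∧ p i ⟧) ≤ ∑ r (λ i → ⟦ not (mask-add mask a i) ∧ p i ⟧) + 1
  unmask-one r mask p a a<r = ≤-trans (∑-mono r λ i _ → pointwise (mask i) (i == a) (p i))
    (≤-reflexive (trans (∑-+ r _ _) (cong (∑ r (λ i → ⟦ not (mask-add mask a i) ∧ p i ⟧) +_)
      (trans (∑-single r _ a<r λ j _ j≢a → cong ⟦_⟧ (≢⇒==false j≢a)) (cong ⟦_⟧ (==-refl a))))))
    where
    pointwise : ∀ x y z → ⟦ not x ∧ z ⟧ ≤ ⟦ not (x ∨ y) ∧ z ⟧ + ⟦ y ⟧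
    pointwise true  y     z = z≤n
    pointwise false true  z = ≤-trans (⟦⟧≤1 z) ≤-refl
    pointwise false false z = m≤m+n ⟦ z ⟧ 0

  record Quadruple (r w : ℕ) (W : ℕ → Bool) (p : ℕ → ℕ → Bool) : Set where
    field
      a₁ a₂ a₃ a₄ : ℕ
      a₁<r : a₁ < r
      a₂<r : a₂ < r
      a₃<r : a₃ < r
      a₄<r : a₄ < r
      a₁≢a₂ : a₁ ≢ a₂
      a₁≢a₃ : a₁ ≢ a₃
      a₁≢a₄ : a₁ ≢ a₄
      a₂≢a₃ : a₂ ≢ a₃
      a₂≢a₄ : a₂ ≢ a₄
      a₃≢a₄ : a₃ ≢ a₄
      popular : count W w ≤ r * (r * (r * (r * count (λ x → (((W x ∧ p a₁ x) ∧ p a₂ x) ∧ p a₃ x) ∧ p a₄ x) w)))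

  private
    choose-four : ∀ r w (W : ℕ → Bool) (p : ℕ → ℕ → Bool) → 0 < r → 0 < count W w →
      (∀ x → x < w → W x ≡ true → 4 ≤ ∑ r (λ i → ⟦ p i x ⟧)) → Quadruple r w W p
    choose-four r w W p 0<r 0<W four = record
      { a₁ = a₁ ; a₂ = a₂ ; a₃ = a₃ ; a₄ = a₄
      ; a₁<r = proj₁ (proj₂ s₁) ; a₂<r = proj₁ (proj₂ s₂) ; a₃<r = proj₁ (proj₂ s₃) ; a₄<r = proj₁ (proj₂ s₄)
      ; a₁≢a₂ = differ mask₁ fresh₂ (==-refl a₁)
      ; a₁≢a₃ = differ mask₂ fresh₃ (∨-trueˡ (==-refl a₁))
      ; a₁≢a₄ = differ mask₃ fresh₄ (∨-trueˡ (∨-trueˡ (==-refl a₁)))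
      ; a₂≢a₃ = differ mask₂ fresh₃ (∨-trueʳ {mask₁ a₂} (==-refl a₂))
      ; a₂≢a₄ = differ mask₃ fresh₄ (∨-trueˡ (∨-trueʳ {mask₁ a₂} (==-refl a₂)))
      ; a₃≢a₄ = differ mask₃ fresh₄ (∨-trueʳ {mask₂ a₃} (==-refl a₃))
      ; popular = ≤-trans le₁ (*-monoʳ-≤ r (≤-trans le₂ (*-monoʳ-≤ r (≤-trans le₃ (*-monoʳ-≤ r le₄))))) }
      where
      positive : ∀ {N C} → 0 < N → N ≤ r * C → 0 < C
      positive {N} {zero}  0<N le = ⊥-elim (<-irrefl refl (<-≤-trans 0<N (≤-trans le (≤-reflexive (*-zeroʳ r)))))
      positive {N} {suc C} _   _  = s≤s z≤n
      differ : ∀ (mask : ℕ → Bool) {a b} → mask b ≡ false → mask a ≡ true → a ≢ b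
      differ mask b∉ a∈ refl with trans (sym b∉) a∈
      ... | ()
      drop : ∀ d (W mask : ℕ → Bool) a → a < r → (∀ x → x < w → W x ≡ true → suc d ≤ ∑ r (λ i → ⟦ not (mask i) ∧ p i x ⟧)) →
        ∀ x → x < w → W x ∧ p a x ≡ true → d ≤ ∑ r (λ i → ⟦ not (mask-add mask a i) ∧ p i x ⟧)
      drop d W mask a a<r h x x<w e = +-cancelʳ-≤ 1 d _ (≤-trans (≤-reflexive (+-comm d 1))
        (≤-trans (h x x<w (proj₁ (∧-true⁻ {W x} e))) (unmask-one r mask (λ i → p i x) a a<r)))
      weaken : ∀ d (W mask : ℕ → Bool) → (∀ x → x < w → W x ≡ true → suc d ≤ ∑ r (λ i → ⟦ not (mask i) ∧ p i x ⟧)) →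
        ∀ x → x < w → W x ≡ true → 1 ≤ ∑ r (λ i → ⟦ not (mask i) ∧ p i x ⟧)
      weaken d W mask h x x<w Wx = ≤-trans (s≤s z≤n) (h x x<w Wx)
      s₁ = pigeonhole-step r w W (λ _ → false) p 0<r 0<W (weaken 3 W (λ _ → false) four)
      a₁ = proj₁ s₁
      le₁ = proj₂ (proj₂ (proj₂ s₁))
      mask₁ W₁ : ℕ → Bool
      mask₁ i = i == a₁
      W₁ x = W x ∧ p a₁ x
      h₁ = drop 3 W (λ _ → false) a₁ (proj₁ (proj₂ s₁)) four
      s₂ = pigeonhole-step r w W₁ mask₁ p 0<r (positive 0<W le₁) (weaken 2 W₁ mask₁ h₁)
      a₂ = proj₁ s₂
      fresh₂ = proj₁ (proj₂ (proj₂ s₂))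
      le₂ = proj₂ (proj₂ (proj₂ s₂))
      mask₂ W₂ : ℕ → Bool
      mask₂ = mask-add mask₁ a₂
      W₂ x = W₁ x ∧ p a₂ x
      h₂ = drop 2 W₁ mask₁ a₂ (proj₁ (proj₂ s₂)) h₁
      s₃ = pigeonhole-step r w W₂ mask₂ p 0<r (positive (positive 0<W le₁) le₂) (weaken 1 W₂ mask₂ h₂)
      a₃ = proj₁ s₃
      fresh₃ = proj₁ (proj₂ (proj₂ s₃))
      le₃ = proj₂ (proj₂ (proj₂ s₃))
      mask₃ W₃ : ℕ → Bool
      mask₃ = mask-add mask₂ a₃
      W₃ x = W₂ x ∧ p a₃ x
      h₃ = drop 1 W₂ mask₂ a₃ (proj₁ (proj₂ s₃)) h₂
      s₄ = pigeonhole-step r w W₃ mask₃ p 0<r (positive (positive (positive 0<W le₁) le₂) le₃) (weaken 0 W₃ mask₃ h₃)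
      a₄ = proj₁ s₄
      fresh₄ = proj₁ (proj₂ (proj₂ s₄))
      le₄ = proj₂ (proj₂ (proj₂ s₄))

  abstract
    quadruple : ∀ r w (W : ℕ → Bool) (p : ℕ → ℕ → Bool) → 0 < r → 0 < count W w →
      (∀ x → x < w → W x ≡ true → 4 ≤ ∑ r (λ i → ⟦ p i x ⟧)) → Quadruple r w W p
    quadruple = choose-four

  label-shift-unique : ∀ l T N → ∑ N (λ τ → ⟦ l == T + τ ⟧) ≤ 1
  label-shift-unique l T zero    = z≤n
  label-shift-unique l T (suc N) with l ≟ T + N
  ... | no  _    = ≤-trans (≤-reflexive (+-identityʳ _)) (label-shift-unique l T N)
  ... | yes refl = ≤-reflexive (cong (_+ 1) (∑-zero N λ τ τ<N → cong ⟦_⟧ (≢⇒==false λ e → <-irrefl (sym (+-cancelˡ-≡ T N τ e)) τ<N)))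

  ∑-mono-sum : ∀ r (N : ℕ → ℕ) a b → (∀ i → i < r → N i + a ≤ b) → ∑ r N + r * a ≤ r * b
  ∑-mono-sum r N a b le = subst₂ _≤_ (trans (∑-+ r N (λ _ → a)) (cong (∑ r N +_) (∑-const r a))) (∑-const r b) (∑-mono r le)

  -- If at most three of the seven conditions hold, at least four fail.
  score-or-failures : ∀ r (p : ℕ → Bool) l → r ≡ 7 →
    4 * ⟦ l ⟧ ≤ 4 * ⟦ (3 <?ᵇ ∑ r (λ i → ⟦ p i ⟧)) ∧ l ⟧ + ∑ r (λ i → ⟦ not (p i) ∧ l ⟧)
  score-or-failures r p false r≡7 = z≤n
  score-or-failures r p true  r≡7 with 3 <? ∑ r (λ i → ⟦ p i ⟧)
  ... | yes _ = m≤m+n 4 _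
  ... | no  ≮ = +-cancelˡ-≤ 3 4 _ (≤-trans (≤-reflexive (sym complement))
                  (+-mono-≤ (≮⇒≥ ≮) (∑-mono r λ i _ → ⟦⟧-mono λ e → ∧-true e refl)))
    where
    complement : ∑ r (λ i → ⟦ p i ⟧) + ∑ r (λ i → ⟦ not (p i) ⟧) ≡ 7
    complement = trans (sym (∑-+ r _ _)) (trans (∑-cong r λ i _ → ⟦⟧-not (p i)) (trans (∑-const r 1) (trans (*-identityʳ r) r≡7)))

  -- Four pigeonhole steps cost a factor `r⁴`. For `r = 7` this gives 2401 · 166 = 398566, which is
  -- below 12 · 65536; hence the bound `q-large`.
  popular-enough : ∀ r q m N C → .{{_ : NonZero r}} → r * r * r * r * 166 ≤ 12 * q → 1 ≤ q * m → 12 * q * (q * m) ≤ N →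
    N ≤ r * (r * (r * (r * C))) → 161 * q * m + 5 ≤ C
  popular-enough r q m N C small 1≤qm N≥ N≤ = *-cancelˡ-≤ (r * r * r * r)
    {{m*n≢0 (r * r * r) r {{m*n≢0 (r * r) r {{m*n≢0 r r}}}}}} (begin
      r * r * r * r * (161 * q * m + 5)      ≤⟨ *-monoʳ-≤ (r * r * r * r) (five q m 1≤qm) ⟩
      r * r * r * r * (166 * (q * m))        ≡⟨ *-assoc (r * r * r * r) 166 (q * m) ⟨
      r * r * r * r * 166 * (q * m)          ≤⟨ *-monoˡ-≤ (q * m) small ⟩
      12 * q * (q * m)                       ≤⟨ ≤-trans N≥ N≤ ⟩
      r * (r * (r * (r * C)))                ≡⟨ reassociate r C ⟩
      r * r * r * r * C                      ∎)
    where
    open ≤-Reasoning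
    five : ∀ q m → 1 ≤ q * m → 161 * q * m + 5 ≤ 166 * (q * m)
    five q m h = certify 0 (5 ⊗ h) (solve (q ∷ m ∷ []))
    reassociate : ∀ r C → r * (r * (r * (r * C))) ≡ r * r * r * r * C
    reassociate r C = solve (r ∷ C ∷ [])

  module Gadget (S : Setting) where

    open Classified S public

    pool : ℕ → Bool
    pool v = blocked v ∧ (L + 7 <?ᵇ label v)

    pool-periodic : Periodic n pool
    pool-periodic = %n-periodic λ x → (x <?ᵇ B * P) ∧ (L + 7 <?ᵇ (x % P + (P ∸ rot (x / P))) % P)

    Near : ℕ → ℕ → Set
    Near y v = k ≤ v × v ≤ y + k + 2 * s × y + k ≤ v + 2 * s

    layer-in-window : ∀ y t → t < P → 32 * q * m ≤ count (λ j → layer t (y + j)) w + 6 * m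
    layer-in-window y t t<P = arith q m (count (λ j → layer t (y + j)) k) (count (λ j → layer t (y + k + j)) k) (count (λ j → layer t (y + j)) w)
      (layer-in-half-window y t t<P) (layer-in-half-window (y + k) t t<P) split
      where
      split : count (λ j → layer t (y + j)) k + count (λ j → layer t (y + k + j)) k ≤ count (λ j → layer t (y + j)) w
      split = ≤-trans (+-monoʳ-≤ _ (≤-trans (∑-mono-range _ (n≤1+n k))
        (≤-reflexive (∑-cong (suc k) λ j _ → cong (λ x → ⟦ layer t x ⟧) (+-assoc y k j)))))
        (≤-reflexive (sym (∑-split k (suc k) (λ j → ⟦ layer t (y + j) ⟧))))
      arith : ∀ q m A B C → 16 * q * m ≤ A + 3 * m → 16 * q * m ≤ B + 3 * m → A + B ≤ C → 32 * q * m ≤ C + 6 * m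
      arith q m A B C h₁ h₂ h₃ = certify 0 (h₁ ⊕ h₂ ⊕ h₃) (solve (q ∷ m ∷ A ∷ B ∷ C ∷ []))

    few-non-neighbours : ∀ y v t → t < P → Near y v →
      count (λ j → not (adj v (y + j)) ∧ layer t (y + j)) w + 43 * m ≤ 16 * q * m
    few-non-neighbours y v t t<P (k≤v , v≤ , ≤v) = subst (λ u → count (λ j → not (adj u (y + j)) ∧ layer t (y + j)) w + 43 * m ≤ 16 * q * m)
      (m∸n+n≡m k≤v) (non-neighbours-in-layer y (v ∸ k) t t<P
        (+-cancelʳ-≤ k _ _ (≤-trans ≤v (≤-reflexive (trans (cong (_+ 2 * s) (sym (m∸n+n≡m k≤v))) (+-swapʳ (v ∸ k) k (2 * s))))))
        (+-cancelʳ-≤ k _ _ (≤-trans (≤-reflexive (m∸n+n≡m k≤v)) (≤-trans v≤ (≤-reflexive (+-swapʳ y k (2 * s)))))))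

    first-pool-label : ℕ
    first-pool-label = suc (L + 7)

    pool-label< : ∀ τ → τ < 3 * q → first-pool-label + τ < P
    pool-label< τ τ< = ≤-trans (+-monoʳ-< first-pool-label τ<) (≤-reflexive (trans (trans (cong suc (+-assoc L 7 (3 * q)))
      (cong (λ z → suc (L + z)) (trans (+-comm 7 (3 * q)) (sym h≡)))) (sym P≡1+L+h)))

    pool-layers : ∀ v (X : Bool) → ∑ (3 * q) (λ τ → ⟦ X ∧ layer (first-pool-label + τ) v ⟧) ≤ ⟦ pool v ∧ X ⟧
    pool-layers v X = cases (blocked v) (label v) X
      where
      cases : ∀ b l X → ∑ (3 * q) (λ τ → ⟦ X ∧ (b ∧ (l == first-pool-label + τ)) ⟧) ≤ ⟦ (b ∧ (L + 7 <?ᵇ l)) ∧ X ⟧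
      cases b     l false = ≤-trans (≤-reflexive (∑-zero (3 * q) λ _ _ → refl)) z≤n
      cases false l true  = ≤-reflexive (∑-zero (3 * q) λ _ _ → refl)
      cases true  l true with L + 7 <? l
      ... | yes _  = label-shift-unique l first-pool-label (3 * q)
      ... | no  ≮ = ≤-reflexive (∑-zero (3 * q) λ τ _ → cong ⟦_⟧ (≢⇒==false λ { refl → ≮ (m≤m+n first-pool-label τ) }))

    pool-count : ∀ y N (X : ℕ → Bool) → (∀ τ → τ < 3 * q → N ≤ count (λ j → X (y + j) ∧ layer (first-pool-label + τ) (y + j)) w) →
      3 * q * N ≤ count (λ j → pool (y + j) ∧ X (y + j)) w
    pool-count y N X each = begin
      3 * q * N                                                                                 ≡⟨ ∑-const (3 * q) N ⟨
      ∑ (3 * q) (λ _ → N)                                                                       ≤⟨ ∑-mono (3 * q) each ⟩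
      ∑ (3 * q) (λ τ → ∑ w λ j → ⟦ X (y + j) ∧ layer (first-pool-label + τ) (y + j) ⟧)          ≡⟨ ∑-swap (3 * q) w _ ⟩
      ∑ w (λ j → ∑ (3 * q) λ τ → ⟦ X (y + j) ∧ layer (first-pool-label + τ) (y + j) ⟧)          ≤⟨ ∑-mono w (λ j _ → pool-layers (y + j) (X (y + j))) ⟩
      count (λ j → pool (y + j) ∧ X (y + j)) w                                                  ∎
      where open ≤-Reasoning

    1≤m : 1 ≤ m
    1≤m = >-nonZero⁻¹ m

    -- Within one pool label, the whole layer minus both sets of non-neighbours leaves `(32 q m - 6
    -- m) - 2 (16 q m - 43 m) = 80 m`: the main terms cancel and the surplus remains. The `3 q` pool
    -- labels together give `240 q m`.
    common-neighbours : ∀ y v₁ v₂ → Near y v₁ → Near y v₂ →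
      capacity ≤ count (λ j → pool (y + j) ∧ (adj v₁ (y + j) ∧ adj v₂ (y + j))) w
    common-neighbours y v₁ v₂ near₁ near₂ = ≤-trans (enough q m) (pool-count y (80 * m) (λ x → adj v₁ x ∧ adj v₂ x) each)
      where
      enough : ∀ q m → 161 * q * m ≤ 3 * q * (80 * m)
      enough q m = ≤-trans (m≤m+n (161 * q * m) (79 * (q * m))) (≤-reflexive (eq q m))
        where
        eq : ∀ q m → 161 * q * m + 79 * (q * m) ≡ 3 * q * (80 * m)
        eq q m = solve (q ∷ m ∷ [])
      each : ∀ τ → τ < 3 * q → 80 * m ≤ count (λ j → (adj v₁ (y + j) ∧ adj v₂ (y + j)) ∧ layer (first-pool-label + τ) (y + j)) w
      each τ τ< = arith q m (count (λ j → not (adj v₁ (y + j)) ∧ layer t (y + j)) w) (count (λ j → not (adj v₂ (y + j)) ∧ layer t (y + j)) w)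
        (count (λ j → layer t (y + j)) w) (count (λ j → (adj v₁ (y + j) ∧ adj v₂ (y + j)) ∧ layer t (y + j)) w)
        (few-non-neighbours y v₁ t t<P near₁) (few-non-neighbours y v₂ t t<P near₂)
        (layer-in-window y t t<P) (≤-trans (∑-mono w λ j _ → pointwise (adj v₁ (y + j)) (adj v₂ (y + j)) (layer t (y + j)))
          (≤-reflexive (trans (∑-+ w _ _) (cong (_+ count (λ j → not (adj v₂ (y + j)) ∧ layer t (y + j)) w) (∑-+ w _ _)))))
        where
        t : ℕ
        t = first-pool-label + τ
        t<P : t < P
        t<P = pool-label< τ τ<
        pointwise : ∀ a b l → ⟦ l ⟧ ≤ ⟦ (a ∧ b) ∧ l ⟧ + ⟦ not a ∧ l ⟧ + ⟦ not b ∧ l ⟧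
        pointwise a     b     false = z≤n
        pointwise true  true  true  = s≤s z≤n
        pointwise true  false true  = s≤s z≤n
        pointwise false b     true  = s≤s z≤n
        arith : ∀ q m N₁ N₂ A C → N₁ + 43 * m ≤ 16 * q * m → N₂ + 43 * m ≤ 16 * q * m → 32 * q * m ≤ A + 6 * m →
          A ≤ C + N₁ + N₂ → 80 * m ≤ C
        arith q m N₁ N₂ A C h₁ h₂ h₃ h₄ = certify 0 (h₁ ⊕ h₂ ⊕ h₃ ⊕ h₄) (solve (q ∷ m ∷ N₁ ∷ N₂ ∷ A ∷ C ∷ []))

    -- Seven vertices miss 7/2 < 4 times the size of the pool altogether, so on a
    -- positive fraction of the pool at least four of them are adjacent.
    module _ (y : ℕ) (vs : ℕ → ℕ) (near : ∀ i → i < 7 → Near y (vs i)) where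

      private
        score : ℕ → ℕ
        score x = ∑ 7 λ i → ⟦ adj (vs i) x ⟧

        good : ℕ → Bool
        good x = 3 <?ᵇ score x

        W : ℕ → Bool
        W j = pool (y + j) ∧ good (y + j)

        -- In each pool label, four times the number of good vertices is at least
        -- `4 (32 q m - 6 m) - 7 (16 q m - 43 m)`, hence at least `16 q m`.
        many-good : 12 * q * (q * m) ≤ count W w
        many-good = ≤-trans (≤-reflexive (eq q m)) (pool-count y (4 * q * m) good each)
          where
          eq : ∀ q m → 12 * q * (q * m) ≡ 3 * q * (4 * q * m)
          eq q m = solve (q ∷ m ∷ [])
          each : ∀ τ → τ < 3 * q → 4 * q * m ≤ count (λ j → good (y + j) ∧ layer (first-pool-label + τ) (y + j)) w
          each τ τ< = *-cancelˡ-≤ 4 (arith q m (count (λ j → layer t (y + j)) w) (count (λ j → good (y + j) ∧ layer t (y + j)) w) (∑ 7 N)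
            (layer-in-window y t t<P) total lower)
            where
            t : ℕ
            t = first-pool-label + τ
            t<P : t < P
            t<P = pool-label< τ τ<
            N : ℕ → ℕ
            N i = count (λ j → not (adj (vs i) (y + j)) ∧ layer t (y + j)) w
            total : ∑ 7 N + 301 * m ≤ 112 * q * m
            total = subst₂ _≤_ (cong (∑ 7 N +_) (sym (*-assoc 7 43 m))) (fold q m)
              (∑-mono-sum 7 N (43 * m) (16 * q * m) λ i i<7 → few-non-neighbours y (vs i) t t<P (near i i<7))
              where
              fold : ∀ q m → 7 * (16 * q * m) ≡ 112 * q * m
              fold q m = solve (q ∷ m ∷ [])
            lower : 4 * count (λ j → layer t (y + j)) w ≤ 4 * count (λ j → good (y + j) ∧ layer t (y + j)) w + ∑ 7 N
            lower = subst₂ _≤_ (∑-* w 4 _) (trans (∑-+ w _ _) (cong₂ _+_ (∑-* w 4 _)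
              (∑-swap w 7 λ j i → ⟦ not (adj (vs i) (y + j)) ∧ layer t (y + j) ⟧)))
              (∑-mono w λ j _ → score-or-failures 7 (λ i → adj (vs i) (y + j)) (layer t (y + j)) refl)
            arith : ∀ q m A G N → 32 * q * m ≤ A + 6 * m → N + 301 * m ≤ 112 * q * m → 4 * A ≤ 4 * G + N → 4 * (4 * q * m) ≤ 4 * G
            arith q m A G N h₁ h₂ h₃ = certify (277 * m) (4 ⊗ h₁ ⊕ h₂ ⊕ h₃) (solve (q ∷ m ∷ A ∷ G ∷ N ∷ []))

      four : Quadruple 7 w W (λ i j → adj (vs i) (y + j))
      four = quadruple 7 w W (λ i j → adj (vs i) (y + j)) (s≤s z≤n)
        (≤-trans (*-mono-≤ (≤-trans 1≤q (m≤n*m q 12)) (*-mono-≤ 1≤q 1≤m)) many-good)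
        λ j _ e → <?ᵇ-true⁻ (proj₂ (∧-true⁻ {pool (y + j)} e))

      open Quadruple four public

      -- The additional 5 allows the window to be moved from the start of the block to the offset of
      -- an item.
      four-common-neighbours : capacity + 5 ≤
        count (λ j → pool (y + j) ∧ ((adj (vs a₁) (y + j) ∧ adj (vs a₂) (y + j)) ∧ (adj (vs a₃) (y + j) ∧ adj (vs a₄) (y + j)))) w
      four-common-neighbours = ≤-trans
        (popular-enough 7 q m (count W w) (count (λ j → (((W j ∧ adj (vs a₁) (y + j)) ∧ adj (vs a₂) (y + j)) ∧ adj (vs a₃) (y + j)) ∧ adj (vs a₄) (y + j)) w)
          (≤-trans (m≤m+n 398566 387866) (*-monoʳ-≤ 12 q-large)) (*-mono-≤ 1≤q 1≤m) many-good popular)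
        (∑-mono w λ j _ → ⟦⟧-mono λ e →
          reorganise (pool (y + j)) (good (y + j)) (adj (vs a₁) (y + j)) (adj (vs a₂) (y + j)) (adj (vs a₃) (y + j)) (adj (vs a₄) (y + j)) e)
        where
        reorganise : ∀ p g a b c d → ((((p ∧ g) ∧ a) ∧ b) ∧ c) ∧ d ≡ true → p ∧ ((a ∧ b) ∧ (c ∧ d)) ≡ true
        reorganise true true true true true true _ = refl

-- Weaving strands and matchings into one orbit

module Weave where

  open import Data.Bool using (Bool; true; false; _∧_; _∨_)
  open import Data.Empty using (⊥-elim)
  open import Data.Nat
  open import Data.Nat.Properties
  open import Data.Product using (∃-syntax; _×_; _,_; proj₁; proj₂)
  open import Data.Sum using (_⊎_; inj₁; inj₂)
  open import Relation.Binary.PropositionalEquality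
  open import Relation.Nullary using (yes; no)
  open Sums
  open Hall using (_==_; ==-refl; ==⇒≡)
  open Merge

  data Corner : Set where
    in₁ in₂ out₁ out₂ : Corner

  data Slot : Set where
    link₁ link₂ link₃ mid₁ mid₂ : Slot

  module Cyclic (B : ℕ) where

    prev next : ℕ → ℕ
    prev zero    = B ∸ 1
    prev (suc b) = b
    next b with suc b ≟ B
    ... | yes _ = 0
    ... | no  _ = suc b

    prev< : ∀ {b} → b < B → prev b < B
    prev< {zero}  (s≤s _) = ≤-refl
    prev< {suc b} b<B     = <-trans (n<1+n b) b<B

    next< : ∀ {b} → b < B → next b < B
    next< {b} b<B with suc b ≟ B
    ... | yes _ = ≤-<-trans z≤n b<B
    ... | no ne = ≤∧≢⇒< b<B ne

    prev-next : ∀ {b} → b < B → prev (next b) ≡ b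
    prev-next {b} b<B with suc b ≟ B
    ... | yes refl = refl
    ... | no  _    = refl

    next-prev : ∀ {b} → b < B → next (prev b) ≡ b
    next-prev {zero} (s≤s {n = r} _) with suc r ≟ suc r
    ... | yes _ = refl
    ... | no ne = ⊥-elim (ne refl)
    next-prev {suc b} b<B with suc b ≟ B
    ... | yes e = ⊥-elim (<-irrefl e b<B)
    ... | no  _ = refl

  -- The strand of block b runs u b → link₁ → in₁ b → mid₁ → out₁ b → link₂ →
  -- in₂ (prev b) → mid₂ → out₂ (prev b) → link₃ → w b, where link and mid vertices
  -- are the values of f; the four corners V κ b of block b are shared by two
  -- consecutive strands, which can exchange mid₁ and mid₂ of block b.
  module Strands (n B : ℕ) (u w : ℕ → ℕ) (V : Corner → ℕ → ℕ) (f : ℕ → Slot → ℕ) where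

    open Cyclic B public

    source target : ℕ → Slot → ℕ
    source b link₁ = u b
    source b link₂ = V out₁ b
    source b link₃ = V out₂ (prev b)
    source b mid₁  = V in₁ b
    source b mid₂  = V in₂ b
    target b link₁ = V in₁ b
    target b link₂ = V in₂ (prev b)
    target b link₃ = w b
    target b mid₁  = V out₁ b
    target b mid₂  = V out₂ b

    -- Mid slots are indexed by the block of their corners and links by the block of their strand.
    -- As the strand of block `b` passes through `out₂` of the previous block, the link leaving
    -- `out₂` of `b` belongs to the next one.
    exit-block : Corner → ℕ → ℕ
    exit-block out₂ b = next b
    exit-block in₁  b = b
    exit-block in₂  b = b
    exit-block out₁ b = b

    exit-slot : Corner → Slot
    exit-slot in₁  = mid₁
    exit-slot in₂  = mid₂
    exit-slot out₁ = link₂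
    exit-slot out₂ = link₃

    is-corner is-middle used : ℕ → Bool
    is-corner v = any< B λ b → ((v == V in₁ b) ∨ (v == V in₂ b)) ∨ ((v == V out₁ b) ∨ (v == V out₂ b))
    is-middle v = any< B λ b → (((v == f b link₁) ∨ (v == f b link₂)) ∨ (v == f b link₃)) ∨ ((v == f b mid₁) ∨ (v == f b mid₂))
    used v = is-corner v ∨ is-middle v

    corner-used : ∀ κ {b} → b < B → used (V κ b) ≡ true
    corner-used κ {b} b<B = ∨-trueˡ (any<-intro B b<B (here κ))
      where
      here : ∀ κ → ((V κ b == V in₁ b) ∨ (V κ b == V in₂ b)) ∨ ((V κ b == V out₁ b) ∨ (V κ b == V out₂ b)) ≡ true
      here in₁  = ∨-trueˡ (∨-trueˡ (==-refl (V in₁ b)))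
      here in₂  = ∨-trueˡ (∨-trueʳ {V in₂ b == V in₁ b} (==-refl (V in₂ b)))
      here out₁ = ∨-trueʳ {(V out₁ b == V in₁ b) ∨ (V out₁ b == V in₂ b)} (∨-trueˡ (==-refl (V out₁ b)))
      here out₂ = ∨-trueʳ {(V out₂ b == V in₁ b) ∨ (V out₂ b == V in₂ b)} (∨-trueʳ {V out₂ b == V out₁ b} (==-refl (V out₂ b)))

    middle-used : ∀ {b} sl → b < B → used (f b sl) ≡ true
    middle-used {b} sl b<B = ∨-trueʳ {is-corner (f b sl)} (any<-intro B b<B (here sl))
      where
      here : ∀ sl → (((f b sl == f b link₁) ∨ (f b sl == f b link₂)) ∨ (f b sl == f b link₃)) ∨ ((f b sl == f b mid₁) ∨ (f b sl == f b mid₂)) ≡ true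
      here link₁ = ∨-trueˡ (∨-trueˡ (∨-trueˡ (==-refl (f b link₁))))
      here link₂ = ∨-trueˡ (∨-trueˡ (∨-trueʳ {f b link₂ == f b link₁} (==-refl (f b link₂))))
      here link₃ = ∨-trueˡ (∨-trueʳ {(f b link₃ == f b link₁) ∨ (f b link₃ == f b link₂)} (==-refl (f b link₃)))
      here mid₁  = ∨-trueʳ {((f b mid₁ == f b link₁) ∨ (f b mid₁ == f b link₂)) ∨ (f b mid₁ == f b link₃)} (∨-trueˡ (==-refl (f b mid₁)))
      here mid₂  = ∨-trueʳ {((f b mid₂ == f b link₁) ∨ (f b mid₂ == f b link₂)) ∨ (f b mid₂ == f b link₃)}
                     (∨-trueʳ {f b mid₂ == f b mid₁} (==-refl (f b mid₂)))

    corner-found : ∀ v → is-corner v ≡ true → ∃[ κ ] ∃[ b ] b < B × v ≡ V κ b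
    corner-found v e with any<-elim B e
    ... | b , b<B , e′ with ∨-true⁻ {(v == V in₁ b) ∨ (v == V in₂ b)} e′
    ...   | inj₁ l with ∨-true⁻ {v == V in₁ b} l
    ...     | inj₁ x = in₁ , b , b<B , ==⇒≡ x
    ...     | inj₂ x = in₂ , b , b<B , ==⇒≡ x
    corner-found v e | b , b<B , e′ | inj₂ r with ∨-true⁻ {v == V out₁ b} r
    ...     | inj₁ x = out₁ , b , b<B , ==⇒≡ x
    ...     | inj₂ x = out₂ , b , b<B , ==⇒≡ x

    middle-found : ∀ v → is-middle v ≡ true → ∃[ b ] ∃[ sl ] b < B × v ≡ f b sl
    middle-found v e with any<-elim B e
    ... | b , b<B , e′ with ∨-true⁻ {((v == f b link₁) ∨ (v == f b link₂)) ∨ (v == f b link₃)} e′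
    ...   | inj₂ r with ∨-true⁻ {v == f b mid₁} r
    ...     | inj₁ x = b , mid₁ , b<B , ==⇒≡ x
    ...     | inj₂ x = b , mid₂ , b<B , ==⇒≡ x
    middle-found v e | b , b<B , e′ | inj₁ l with ∨-true⁻ {(v == f b link₁) ∨ (v == f b link₂)} l
    ...     | inj₂ x = b , link₃ , b<B , ==⇒≡ x
    ...     | inj₁ l′ with ∨-true⁻ {v == f b link₁} l′
    ...       | inj₁ x = b , link₁ , b<B , ==⇒≡ x
    ...       | inj₂ x = b , link₂ , b<B , ==⇒≡ x

    -- Intended reading: `inner` marks the layers, `stage` is the label of an inner vertex and the
    -- stage of insertion of any other vertex, and `to t` is the matching of stage `t`, in effect on
    -- the vertices outside the strands.
    module Weaving (L : ℕ) (adj : ℕ → ℕ → Bool) (adj-sym : ∀ x y → adj x y ≡ adj y x)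
      (inner : ℕ → Bool) (stage : ℕ → ℕ)
      (u< : ∀ {b} → b < B → u b < n) (w< : ∀ {b} → b < B → w b < n)
      (V< : ∀ κ {b} → b < B → V κ b < n) (f< : ∀ {b} sl → b < B → f b sl < n)
      (u-inner : ∀ {b} → b < B → inner (u b) ≡ true) (u-stage : ∀ {b} → b < B → stage (u b) ≡ L)
      (w-inner : ∀ {b} → b < B → inner (w b) ≡ true) (w-stage : ∀ {b} → b < B → stage (w b) ≡ 0)
      (V-outer : ∀ κ {b} → b < B → inner (V κ b) ≡ false) (f-outer : ∀ {b} sl → b < B → inner (f b sl) ≡ false)
      (u-onto : ∀ {v} → v < n → inner v ≡ true → stage v ≡ L → ∃[ b ] b < B × v ≡ u b)
      (inner-stage : ∀ {v} → inner v ≡ true → stage v ≤ L) (outer-stage : ∀ {v} → inner v ≡ false → stage v < L)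
      (u-injective : ∀ {b b′} → b < B → b′ < B → u b ≡ u b′ → b ≡ b′)
      (w-injective : ∀ {b b′} → b < B → b′ < B → w b ≡ w b′ → b ≡ b′)
      (V-injective : ∀ κ κ′ {b b′} → b < B → b′ < B → V κ b ≡ V κ′ b′ → κ ≡ κ′ × b ≡ b′)
      (f-injective : ∀ {b b′} sl sl′ → b < B → b′ < B → f b sl ≡ f b′ sl′ → b ≡ b′ × sl ≡ sl′)
      (f≢V : ∀ {b b′} sl κ → b < B → b′ < B → f b sl ≢ V κ b′)
      (source-adj : ∀ {b} sl → b < B → adj (source b sl) (f b sl) ≡ true)
      (target-adj : ∀ {b} sl → b < B → adj (f b sl) (target b sl) ≡ true)
      (cross₁ : ∀ {b} → b < B → adj (V in₁ b) (f b mid₂) ≡ true)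
      (cross₂ : ∀ {b} → b < B → adj (V in₂ b) (f b mid₁) ≡ true)
      (0<B : 0 < B)
      (to : ℕ → ℕ → ℕ)
      (to< : ∀ {v} → v < n → used v ≡ false → stage v < L → to (stage v) v < n)
      (to-adj : ∀ {v} → v < n → used v ≡ false → stage v < L → adj v (to (stage v) v) ≡ true)
      (to-class : ∀ {v} → v < n → used v ≡ false → stage v < L →
        (inner (to (stage v) v) ≡ true × stage (to (stage v) v) ≡ suc (stage v)) ⊎
        (inner v ≡ true × inner (to (stage v) v) ≡ false × used (to (stage v) v) ≡ false × stage (to (stage v) v) ≡ stage v))
      (to-injective : ∀ {t v v′} → v < n → v′ < n → used v ≡ false → used v′ ≡ false → stage v ≡ t → stage v′ ≡ t → t < L →
        to t v ≡ to t v′ → v ≡ v′)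
      where

      data View (v : ℕ) : Set where
        start  : ∀ b → b < B → v ≡ u b → View v
        corner : ∀ κ b → b < B → v ≡ V κ b → View v
        middle : ∀ b sl → b < B → v ≡ f b sl → View v
        free   : used v ≡ false → stage v < L → View v

      view : ∀ {v} → v < n → View v
      view {v} v<n with is-corner v in cor | is-middle v in mid
      ... | true  | _    with corner-found v cor
      ...   | κ , b , b<B , e = corner κ b b<B e
      view {v} v<n | false | true with middle-found v mid
      ...   | b , sl , b<B , e = middle b sl b<B e
      view {v} v<n | false | false with inner v in inn
      ...   | false = free (cong₂ _∨_ cor mid) (outer-stage inn)
      ...   | true with m≤n⇒m<n∨m≡n (inner-stage inn)
      ...     | inj₁ st<L = free (cong₂ _∨_ cor mid) st<L
      ...     | inj₂ st≡L with u-onto v<n inn st≡L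
      ...       | b , b<B , e = start b b<B e

      successor : ∀ {v} → View v → ℕ
      successor (start b _ _)     = f b link₁
      successor (corner κ b _ _)  = f (exit-block κ b) (exit-slot κ)
      successor (middle b sl _ _) = target b sl
      successor {v} (free _ _)    = to (stage v) v

      exit-block< : ∀ κ {b} → b < B → exit-block κ b < B
      exit-block< in₁  b<B = b<B
      exit-block< in₂  b<B = b<B
      exit-block< out₁ b<B = b<B
      exit-block< out₂ b<B = next< b<B

      exit-source : ∀ κ {b} → b < B → source (exit-block κ b) (exit-slot κ) ≡ V κ b
      exit-source in₁  b<B = refl
      exit-source in₂  b<B = refl
      exit-source out₁ b<B = refl
      exit-source out₂ b<B = cong (V out₂) (prev-next b<B)

      successor< : ∀ {v} → v < n → (c : View v) → successor c < n
      successor< v<n (start b b<B _)     = f< link₁ b<B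
      successor< v<n (corner κ b b<B _)  = f< (exit-slot κ) (exit-block< κ b<B)
      successor< v<n (middle b sl b<B _) = target< sl
        where
        target< : ∀ sl → target b sl < n
        target< link₁ = V< in₁ b<B
        target< link₂ = V< in₂ (prev< b<B)
        target< link₃ = w< b<B
        target< mid₁  = V< out₁ b<B
        target< mid₂  = V< out₂ b<B
      successor< v<n (free ¬used st<L)   = to< v<n ¬used st<L

      successor-adj : ∀ {v} → v < n → (c : View v) → adj v (successor c) ≡ true
      successor-adj v<n (start b b<B refl)     = source-adj link₁ b<B
      successor-adj v<n (corner κ b b<B refl)  = subst (λ x → adj x (f (exit-block κ b) (exit-slot κ)) ≡ true)
        (exit-source κ b<B) (source-adj (exit-slot κ) (exit-block< κ b<B))
      successor-adj v<n (middle b sl b<B refl) = target-adj sl b<B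
      successor-adj v<n (free ¬used st<L)      = to-adj v<n ¬used st<L

      source-injective : ∀ κ κ′ {b b′} → b < B → b′ < B →
        f (exit-block κ b) (exit-slot κ) ≡ f (exit-block κ′ b′) (exit-slot κ′) → V κ b ≡ V κ′ b′
      source-injective κ κ′ b<B b′<B e with f-injective (exit-slot κ) (exit-slot κ′) (exit-block< κ b<B) (exit-block< κ′ b′<B) e
      ... | be , se = trans (sym (exit-source κ b<B)) (trans (cong₂ source be se) (exit-source κ′ b′<B))

      target-view : ∀ {b} sl → b < B → target b sl ≡ w b × sl ≡ link₃ ⊎ ∃[ κ ] ∃[ b′ ] b′ < B × target b sl ≡ V κ b′
      target-view link₁ b<B = inj₂ (in₁ , _ , b<B , refl)
      target-view link₂ b<B = inj₂ (in₂ , _ , prev< b<B , refl)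
      target-view link₃ b<B = inj₁ (refl , refl)
      target-view mid₁  b<B = inj₂ (out₁ , _ , b<B , refl)
      target-view mid₂  b<B = inj₂ (out₂ , _ , b<B , refl)

      f≢target : ∀ {b b′} sl sl′ → b < B → b′ < B → f b sl ≢ target b′ sl′
      f≢target sl sl′ b<B b′<B e with target-view sl′ b′<B
      ... | inj₂ (κ , β , β<B , e′) = f≢V sl κ b<B β<B (trans e e′)
      ... | inj₁ (e′ , _) = true≢false (w-inner b′<B) (trans (cong inner (sym (trans e e′))) (f-outer sl b<B))

      w≢V : ∀ {b b′} κ → b < B → b′ < B → w b ≢ V κ b′
      w≢V κ b<B b′<B e = true≢false (w-inner b<B) (trans (cong inner e) (V-outer κ b′<B))

      entry-block : Corner → ℕ → ℕ
      entry-block in₂  b = next b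
      entry-block in₁  b = b
      entry-block out₁ b = b
      entry-block out₂ b = b

      entry-slot : Corner → Slot
      entry-slot in₁  = link₁
      entry-slot in₂  = link₂
      entry-slot out₁ = mid₁
      entry-slot out₂ = mid₂

      target-entry : ∀ {b} sl → b < B → sl ≢ link₃ → ∃[ κ ] ∃[ β ] β < B × target b sl ≡ V κ β × b ≡ entry-block κ β × sl ≡ entry-slot κ
      target-entry link₁ b<B _  = in₁ , _ , b<B , refl , refl , refl
      target-entry link₂ b<B _  = in₂ , _ , prev< b<B , refl , sym (next-prev b<B) , refl
      target-entry link₃ b<B ne = ⊥-elim (ne refl)
      target-entry mid₁  b<B _  = out₁ , _ , b<B , refl , refl , refl
      target-entry mid₂  b<B _  = out₂ , _ , b<B , refl , refl , refl

      link₃? : ∀ sl → sl ≡ link₃ ⊎ sl ≢ link₃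
      link₃? link₁ = inj₂ λ ()
      link₃? link₂ = inj₂ λ ()
      link₃? link₃ = inj₁ refl
      link₃? mid₁  = inj₂ λ ()
      link₃? mid₂  = inj₂ λ ()

      target-injective : ∀ {b b′} sl sl′ → b < B → b′ < B → target b sl ≡ target b′ sl′ → f b sl ≡ f b′ sl′
      target-injective sl sl′ b<B b′<B e with link₃? sl | link₃? sl′
      ... | inj₁ refl | inj₁ refl = cong (λ β → f β link₃) (w-injective b<B b′<B e)
      ... | inj₁ refl | inj₂ ne with target-entry sl′ b′<B ne
      ...   | κ , β , β<B , e′ , _ = ⊥-elim (w≢V κ b<B β<B (trans e e′))
      target-injective sl sl′ b<B b′<B e | inj₂ ne | inj₁ refl with target-entry sl b<B ne
      ...   | κ , β , β<B , e′ , _ = ⊥-elim (w≢V κ b′<B β<B (trans (sym e) e′))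
      target-injective sl sl′ b<B b′<B e | inj₂ ne | inj₂ ne′ with target-entry sl b<B ne | target-entry sl′ b′<B ne′
      ...   | κ , β , β<B , e₁ , refl , refl | κ′ , β′ , β′<B , e₂ , refl , refl with V-injective κ κ′ β<B β′<B (trans (sym e₁) (trans e e₂))
      ...     | refl , refl = refl

      f-not-to : ∀ {b sl v} → b < B → v < n → used v ≡ false → stage v < L → f b sl ≢ to (stage v) v
      f-not-to {b} {sl} b<B v<n ¬used st<L e with to-class v<n ¬used st<L
      ... | inj₁ (inn , _) = true≢false inn (trans (cong inner (sym e)) (f-outer sl b<B))
      ... | inj₂ (_ , _ , ¬used′ , _) = true≢false (middle-used sl b<B) (trans (cong used e) ¬used′)

      V-not-to : ∀ {κ b v} → b < B → v < n → used v ≡ false → stage v < L → V κ b ≢ to (stage v) v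
      V-not-to {κ} {b} b<B v<n ¬used st<L e with to-class v<n ¬used st<L
      ... | inj₁ (inn , _) = true≢false inn (trans (cong inner (sym e)) (V-outer κ b<B))
      ... | inj₂ (_ , _ , ¬used′ , _) = true≢false (corner-used κ b<B) (trans (cong used e) ¬used′)

      target-not-to : ∀ {b sl v} → b < B → v < n → used v ≡ false → stage v < L → target b sl ≢ to (stage v) v
      target-not-to {b} {sl} b<B v<n ¬used st<L e with target-view sl b<B
      ... | inj₂ (κ , β , β<B , e′) = V-not-to {κ} β<B v<n ¬used st<L (trans (sym e′) e)
      ... | inj₁ (e′ , _) with to-class v<n ¬used st<L
      ...   | inj₁ (_ , st) with trans (sym (w-stage b<B)) (trans (cong stage (trans (sym e′) e)) st)
      ...     | ()
      target-not-to {b} {sl} b<B v<n ¬used st<L e | inj₁ (e′ , _) | inj₂ (_ , out , _) =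
        true≢false (w-inner b<B) (trans (cong inner (trans (sym e′) e)) out)

      -- The image reveals the stage: a vertex of layer `t + 1` and a spare vertex of index `t` are
      -- both reached from stage `t` only, and `inner` tells the two kinds apart.
      to-stage : ∀ {v v′} → v < n → v′ < n → used v ≡ false → used v′ ≡ false → stage v < L → stage v′ < L →
        to (stage v) v ≡ to (stage v′) v′ → stage v ≡ stage v′
      to-stage v<n v′<n ¬used ¬used′ st<L st′<L e with to-class v<n ¬used st<L | to-class v′<n ¬used′ st′<L
      ... | inj₁ (_ , s₁) | inj₁ (_ , s₂) = suc-injective (trans (sym s₁) (trans (cong stage e) s₂))
      ... | inj₁ (i₁ , _) | inj₂ (_ , o₂ , _) = ⊥-elim (true≢false i₁ (trans (cong inner e) o₂))
      ... | inj₂ (_ , o₁ , _) | inj₁ (i₂ , _) = ⊥-elim (true≢false i₂ (trans (cong inner (sym e)) o₁))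
      ... | inj₂ (_ , _ , _ , s₁) | inj₂ (_ , _ , _ , s₂) = trans (sym s₁) (trans (cong stage e) s₂)

      no-link₁ : ∀ κ → link₁ ≢ exit-slot κ
      no-link₁ in₁ ()
      no-link₁ in₂ ()
      no-link₁ out₁ ()
      no-link₁ out₂ ()

      successor-injective : ∀ {v v′} → v < n → v′ < n → (c : View v) (c′ : View v′) → successor c ≡ successor c′ → v ≡ v′
      successor-injective v<n v′<n (start b b<B refl) (start b′ b′<B refl) e = cong u (proj₁ (f-injective link₁ link₁ b<B b′<B e))
      successor-injective v<n v′<n (start b b<B _) (corner κ b′ b′<B _) e =
        ⊥-elim (no-link₁ κ (proj₂ (f-injective link₁ (exit-slot κ) b<B (exit-block< κ b′<B) e)))
      successor-injective v<n v′<n (corner κ b b<B _) (start b′ b′<B _) e =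
        ⊥-elim (no-link₁ κ (proj₂ (f-injective link₁ (exit-slot κ) b′<B (exit-block< κ b<B) (sym e))))
      successor-injective v<n v′<n (corner κ b b<B refl) (corner κ′ b′ b′<B refl) e = source-injective κ κ′ b<B b′<B e
      successor-injective v<n v′<n (middle b sl b<B refl) (middle b′ sl′ b′<B refl) e = target-injective sl sl′ b<B b′<B e
      successor-injective v<n v′<n (start b b<B _) (middle b′ sl′ b′<B _) e = ⊥-elim (f≢target link₁ sl′ b<B b′<B e)
      successor-injective v<n v′<n (middle b sl b<B _) (start b′ b′<B _) e = ⊥-elim (f≢target link₁ sl b′<B b<B (sym e))
      successor-injective v<n v′<n (corner κ b b<B _) (middle b′ sl′ b′<B _) e = ⊥-elim (f≢target (exit-slot κ) sl′ (exit-block< κ b<B) b′<B e)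
      successor-injective v<n v′<n (middle b sl b<B _) (corner κ b′ b′<B _) e = ⊥-elim (f≢target (exit-slot κ) sl (exit-block< κ b′<B) b<B (sym e))
      successor-injective v<n v′<n (start b b<B _) (free ¬used st<L) e = ⊥-elim (f-not-to b<B v′<n ¬used st<L e)
      successor-injective v<n v′<n (free ¬used st<L) (start b b<B _) e = ⊥-elim (f-not-to b<B v<n ¬used st<L (sym e))
      successor-injective v<n v′<n (corner κ b b<B _) (free ¬used st<L) e = ⊥-elim (f-not-to (exit-block< κ b<B) v′<n ¬used st<L e)
      successor-injective v<n v′<n (free ¬used st<L) (corner κ b b<B _) e = ⊥-elim (f-not-to (exit-block< κ b<B) v<n ¬used st<L (sym e))
      successor-injective v<n v′<n (middle b sl b<B _) (free ¬used st<L) e = ⊥-elim (target-not-to {sl = sl} b<B v′<n ¬used st<L e)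
      successor-injective v<n v′<n (free ¬used st<L) (middle b sl b<B _) e = ⊥-elim (target-not-to {sl = sl} b<B v<n ¬used st<L (sym e))
      successor-injective {v} {v′} v<n v′<n (free ¬used st<L) (free ¬used′ st′<L) e =
        to-injective v<n v′<n ¬used ¬used′ refl (sym same) st<L (trans e (cong (λ t → to t v′) (sym same)))
        where
        same : stage v ≡ stage v′
        same = to-stage v<n v′<n ¬used ¬used′ st<L st′<L e

      σ : ℕ → ℕ
      σ v with v <? n
      ... | yes v<n = successor (view v<n)
      ... | no  _   = v

      σ-view : ∀ {v} → v < n → ∃[ c ] σ v ≡ successor {v} c
      σ-view {v} v<n with v <? n
      ... | yes v<n′ = view v<n′ , refl
      ... | no  v≮n  = ⊥-elim (v≮n v<n)

      open Permutes n

      σ-perm : Perm σ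
      σ-perm = record { closed = cl ; injective = inj }
        where
        cl : ∀ {v} → v < n → σ v < n
        cl v<n with σ-view v<n
        ... | c , e = subst (_< n) (sym e) (successor< v<n c)
        inj : ∀ {v v′} → v < n → v′ < n → σ v ≡ σ v′ → v ≡ v′
        inj v<n v′<n e with σ-view v<n | σ-view v′<n
        ... | c , e₁ | c′ , e₂ = successor-injective v<n v′<n c c′ (trans (sym e₁) (trans e e₂))

      σ-adj : ∀ {v} → v < n → adj v (σ v) ≡ true
      σ-adj {v} v<n with σ-view v<n
      ... | c , e = trans (cong (adj v) e) (successor-adj v<n c)

      u≢V : ∀ {b b′} κ → b < B → b′ < B → u b ≢ V κ b′
      u≢V κ b<B b′<B e = true≢false (u-inner b<B) (trans (cong inner e) (V-outer κ b′<B))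

      u≢f : ∀ {b b′} sl → b < B → b′ < B → u b ≢ f b′ sl
      u≢f sl b<B b′<B e = true≢false (u-inner b<B) (trans (cong inner e) (f-outer sl b′<B))

      σ-u : ∀ {b} → b < B → σ (u b) ≡ f b link₁
      σ-u {b} b<B with σ-view (u< b<B)
      ... | start b′ b′<B e , eq = trans eq (cong (λ β → f β link₁) (sym (u-injective b<B b′<B e)))
      ... | corner κ b′ b′<B e , _ = ⊥-elim (u≢V κ b<B b′<B e)
      ... | middle b′ sl b′<B e , _ = ⊥-elim (u≢f sl b<B b′<B e)
      ... | free _ st<L , _ = ⊥-elim (<-irrefl (u-stage b<B) st<L)

      σ-V : ∀ κ {b} → b < B → σ (V κ b) ≡ f (exit-block κ b) (exit-slot κ)
      σ-V κ {b} b<B with σ-view (V< κ b<B)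
      ... | start b′ b′<B e , _ = ⊥-elim (u≢V κ b′<B b<B (sym e))
      ... | middle b′ sl b′<B e , _ = ⊥-elim (f≢V sl κ b′<B b<B (sym e))
      ... | free ¬used _ , _ = ⊥-elim (true≢false (corner-used κ b<B) ¬used)
      ... | corner κ′ b′ b′<B e , eq with V-injective κ κ′ b<B b′<B e
      ...   | refl , refl = eq

      σ-f : ∀ {b} sl → b < B → σ (f b sl) ≡ target b sl
      σ-f {b} sl b<B with σ-view (f< sl b<B)
      ... | start b′ b′<B e , _ = ⊥-elim (u≢f sl b′<B b<B (sym e))
      ... | corner κ b′ b′<B e , _ = ⊥-elim (f≢V sl κ b<B b′<B e)
      ... | free ¬used _ , _ = ⊥-elim (true≢false (middle-used sl b<B) ¬used)
      ... | middle b′ sl′ b′<B e , eq with f-injective sl sl′ b<B b′<B e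
      ...   | refl , refl = eq

      -- In every block the corners `in₁` and `in₂` exchange their successors, the two mid vertices,
      -- if this joins two orbits; in either case they end up in the same one.
      merged : ∃[ τ ] Perm τ × (∀ x → x < n → adj x (τ x) ≡ true) × (∀ x → x < n → Reach τ x (σ x)) ×
        (∀ b → b < B → Reach τ (V in₁ b) (V in₂ b))
      merged = merge adj σ-perm σ-adj B (V in₁) (V in₂) (λ b b<B → V< in₁ b<B , V< in₂ b<B)
        (λ b b′ b<B b′<B ne → (λ e → ne (proj₂ (V-injective in₁ in₁ b<B b′<B e))) , (λ e → ne (proj₂ (V-injective in₂ in₂ b<B b′<B e))))
        (λ b b′ b<B b′<B e → in₁≢in₂ (proj₁ (V-injective in₁ in₂ b<B b′<B e)))
        (λ b b<B → trans (cong (adj (V in₁ b)) (σ-V in₂ b<B)) (cross₁ b<B) ,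
                   trans (cong (adj (V in₂ b)) (σ-V in₁ b<B)) (cross₂ b<B))
        where
        in₁≢in₂ : in₁ ≢ in₂
        in₁≢in₂ ()

      module Connected {τ : ℕ → ℕ} (τ-perm : Perm τ) (coarser : ∀ x → x < n → Reach τ x (σ x))
        (joined : ∀ b → b < B → Reach τ (V in₁ b) (V in₂ b)) where

        Conn : ℕ → Set
        Conn v = Reach τ v (u 0)

        sym-conn : ∀ {v x} → v < n → Reach τ v x → Conn v → Conn x
        sym-conn v<n r c = reach-trans (reach-sym τ-perm v<n r) c

        via-V : ∀ κ {b} → b < B → Reach τ (V κ b) (target (exit-block κ b) (exit-slot κ))
        via-V κ {b} b<B = reach-trans (subst (Reach τ (V κ b)) (σ-V κ b<B) (coarser (V κ b) (V< κ b<B)))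
          (via-f (exit-slot κ) (exit-block< κ b<B))
          where
          via-f : ∀ {b} sl → b < B → Reach τ (f b sl) (target b sl)
          via-f {b} sl b<B = subst (Reach τ (f b sl)) (σ-f sl b<B) (coarser (f b sl) (f< sl b<B))

        from-u : ∀ {b} → b < B → Reach τ (u b) (V in₁ b)
        from-u {b} b<B = reach-trans (subst (Reach τ (u b)) (σ-u b<B) (coarser (u b) (u< b<B)))
          (subst (Reach τ (f b link₁)) (σ-f link₁ b<B) (coarser (f b link₁) (f< link₁ b<B)))

        -- The strand of `b` enters the previous block at `in₂` and the strand of that block enters
        -- it at `in₁`. These corners have been joined, which chains all strands together.
        u-prev : ∀ {b} → b < B → Reach τ (u b) (u (prev b))
        u-prev {b} b<B = reach-trans (from-u b<B) (reach-trans (via-V in₁ b<B) (reach-trans (via-V out₁ b<B)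
          (reach-sym τ-perm (u< (prev< b<B)) (reach-trans (from-u (prev< b<B)) (joined (prev b) (prev< b<B))))))

        conn-u : ∀ b → b < B → Conn (u b)
        conn-u zero    _   = reach-refl
        conn-u (suc b) b<B = reach-trans (u-prev b<B) (conn-u b (<-trans (n<1+n b) b<B))

        conn-in₁ : ∀ {b} → b < B → Conn (V in₁ b)
        conn-in₁ {b} b<B = sym-conn (u< b<B) (from-u b<B) (conn-u b b<B)

        conn-in₂ : ∀ {b} → b < B → Conn (V in₂ b)
        conn-in₂ {b} b<B = sym-conn (V< in₁ b<B) (joined b b<B) (conn-in₁ b<B)

        conn-V : ∀ κ {b} → b < B → Conn (V κ b)
        conn-V in₁  b<B = conn-in₁ b<B
        conn-V in₂  b<B = conn-in₂ b<B
        conn-V out₁ b<B = sym-conn (V< in₁ b<B) (via-V in₁ b<B) (conn-in₁ b<B)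
        conn-V out₂ b<B = sym-conn (V< in₂ b<B) (via-V in₂ b<B) (conn-in₂ b<B)

        conn-f : ∀ {b} sl → b < B → Conn (f b sl)
        conn-f {b} link₁ b<B = sym-conn (u< b<B) (subst (Reach τ (u b)) (σ-u b<B) (coarser (u b) (u< b<B))) (conn-u b b<B)
        conn-f {b} link₂ b<B = sym-conn (V< out₁ b<B) (subst (Reach τ (V out₁ b)) (σ-V out₁ b<B) (coarser _ (V< out₁ b<B))) (conn-V out₁ b<B)
        conn-f {b} link₃ b<B = sym-conn (V< out₂ (prev< b<B)) (subst (Reach τ (V out₂ (prev b)))
          (trans (σ-V out₂ (prev< b<B)) (cong (λ β → f β link₃) (next-prev b<B))) (coarser _ (V< out₂ (prev< b<B)))) (conn-V out₂ (prev< b<B))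
        conn-f {b} mid₁ b<B = sym-conn (V< in₁ b<B) (subst (Reach τ (V in₁ b)) (σ-V in₁ b<B) (coarser _ (V< in₁ b<B))) (conn-V in₁ b<B)
        conn-f {b} mid₂ b<B = sym-conn (V< in₂ b<B) (subst (Reach τ (V in₂ b)) (σ-V in₂ b<B) (coarser _ (V< in₂ b<B))) (conn-V in₂ b<B)

        -- A vertex outside the strands moves on to the next layer, with at most one
        -- stop outside the layers, until it arrives at some u b.
        conn-inner : ∀ r {v} → v < n → inner v ≡ true → stage v + r ≡ L → Conn v
        conn-outer : ∀ r {v} → v < n → inner v ≡ false → used v ≡ false → stage v + suc r ≡ L → Conn v

        conn-inner zero {v} v<n inn st with u-onto v<n inn (trans (sym (+-identityʳ (stage v))) st)
        ... | b , b<B , refl = conn-u b b<B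
        conn-inner (suc r) {v} v<n inn st with σ-view v<n
        ... | start b b<B refl , _ = conn-u b b<B
        ... | corner κ b b<B refl , _ = conn-V κ b<B
        ... | middle b sl b<B refl , _ = conn-f sl b<B
        ... | free ¬used st<L , e with to-class v<n ¬used st<L
        ...   | inj₁ (inn′ , st′) = reach-trans (subst (Reach τ v) e (coarser v v<n))
                  (conn-inner r (to< v<n ¬used st<L) inn′ (trans (cong (_+ r) st′) (trans (sym (+-suc (stage v) r)) st)))
        ...   | inj₂ (_ , out , ¬used′ , st′) = reach-trans (subst (Reach τ v) e (coarser v v<n))
                  (conn-outer r (to< v<n ¬used st<L) out ¬used′ (trans (cong (_+ suc r) st′) st))
        conn-outer r {v} v<n out ¬used st with σ-view v<n
        ... | start b b<B refl , _ = conn-u b b<B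
        ... | corner κ b b<B refl , _ = conn-V κ b<B
        ... | middle b sl b<B refl , _ = conn-f sl b<B
        ... | free ¬used′ st<L , e with to-class v<n ¬used′ st<L
        ...   | inj₁ (inn′ , st′) = reach-trans (subst (Reach τ v) e (coarser v v<n))
                  (conn-inner r (to< v<n ¬used′ st<L) inn′ (trans (cong (_+ r) st′) (trans (sym (+-suc (stage v) r)) st)))
        ...   | inj₂ (inn , _) = ⊥-elim (true≢false inn out)

        conn : ∀ {v} → v < n → Conn v
        conn {v} v<n with view v<n
        ... | start b b<B refl     = conn-u b b<B
        ... | corner κ b b<B refl  = conn-V κ b<B
        ... | middle b sl b<B refl = conn-f sl b<B
        ... | free ¬used st<L with inner v in inn
        ...   | true  = conn-inner (L ∸ stage v) v<n inn (m+[n∸m]≡n (<⇒≤ st<L))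
        ...   | false = conn-outer (L ∸ suc (stage v)) v<n inn ¬used
                          (trans (+-suc (stage v) _) (m+[n∸m]≡n st<L))

      single-orbit : ∃[ τ ] Perm τ × (∀ x → x < n → adj x (τ x) ≡ true) × (∀ x → x < n → Reach τ (u 0) x)
      single-orbit with merged
      ... | τ , τ-perm , τ-adj , coarser , joined = τ , τ-perm , τ-adj ,
              λ x x<n → reach-sym τ-perm x<n (Connected.conn τ-perm coarser joined x<n)

-- Corners and the slots between them

module Assembly where

  open import Data.Bool using (Bool; true; false; _∧_)
  open import Data.Empty using (⊥-elim)
  open import Data.List using (_∷_; [])
  open import Data.Nat
  open import Data.Nat.DivMod
  open import Data.Nat.Properties
  open import Data.Nat.Tactic.RingSolver using (solve)
  open import Data.Product using (∃-syntax; _,_; proj₁; proj₂)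
  open import Data.Sum using (_⊎_; inj₁; inj₂)
  open import Relation.Binary.PropositionalEquality
  open Sums
  open Hall
  open CircleHall
  open Layout
  open Classes
  open Gadgets
  open Weave

  decide : ∀ (b : Bool) → b ≡ true ⊎ b ≡ false
  decide true  = inj₁ refl
  decide false = inj₂ refl

  slot : ℕ → Slot
  slot 0 = link₁
  slot 1 = link₂
  slot 2 = link₃
  slot 3 = mid₁
  slot _ = mid₂

  code : Slot → ℕ
  code link₁ = 0
  code link₂ = 1
  code link₃ = 2
  code mid₁  = 3
  code mid₂  = 4

  slot-code : ∀ sl → slot (code sl) ≡ sl
  slot-code link₁ = refl
  slot-code link₂ = refl
  slot-code link₃ = refl
  slot-code mid₁  = refl
  slot-code mid₂  = refl

  code<5 : ∀ sl → code sl < 5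
  code<5 link₁ = s≤s z≤n
  code<5 link₂ = s≤s (s≤s z≤n)
  code<5 link₃ = s≤s (s≤s (s≤s z≤n))
  code<5 mid₁  = s≤s (s≤s (s≤s (s≤s z≤n)))
  code<5 mid₂  = s≤s (s≤s (s≤s (s≤s (s≤s z≤n))))

  module Assembled (S : Setting) where

    open Gadget S public

    source-label : ℕ → ℕ
    source-label i = suc L + i

    u sink : ℕ → ℕ
    u = pos L
    sink = pos 0

    z : ℕ → ℕ → ℕ
    z i = pos (source-label i)

    -- The start of the window centred at `p`, lifted by two turns. One turn keeps it nonnegative;
    -- the other leaves room for vertices before block 0, which are lifted by one turn only.
    window-at : ℕ → ℕ
    window-at p = p + (2 * n ∸ k)

    k≤2n : k ≤ 2 * n
    k≤2n = ≤-trans (≤-trans (m≤m+n k (suc k)) window≤n) (m≤m+n n (n + 0))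

    centre : ∀ p → window-at p + k ≡ p + 2 * n
    centre p = trans (+-assoc p (2 * n ∸ k) k) (cong (p +_) (m∸n+n≡m k≤2n))

    64≤m : 64 ≤ m
    64≤m = ≤-trans (*-mono-≤ {1} {m′} {64} (n≢0⇒n>0 λ m′≡0 → ≢-nonZero⁻¹ m (trans m≡ (cong (_* M) m′≡0)))
      (≤-trans (*-monoʳ-≤ 64 1≤q) (≤-reflexive (sym M≡)))) (≤-reflexive (sym m≡))

    2P≤s : P + P ≤ s
    2P≤s = ≤-trans (≤-reflexive (cong (P +_) (sym (+-identityʳ P)))) (*-monoˡ-≤ P (≤-trans (s≤s (s≤s z≤n)) 64≤m))

    2P≤2s : P + P ≤ 2 * s
    2P≤2s = ≤-trans 2P≤s (m≤m+n s (s + 0))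

    near-2n : ∀ p x → x ≤ p + 2 * s → p ≤ x + 2 * s → Near (window-at p) (x + 2 * n)
    near-2n p x x≤ p≤ = ≤-trans k≤2n (m≤n+m (2 * n) x) ,
      ≤-trans (+-monoˡ-≤ (2 * n) x≤) (≤-reflexive (trans (+-swapʳ p (2 * s) (2 * n)) (cong (_+ 2 * s) (sym (centre p))))) ,
      ≤-trans (≤-reflexive (centre p)) (≤-trans (+-monoˡ-≤ (2 * n) p≤) (≤-reflexive (+-swapʳ x (2 * s) (2 * n))))

    near-1n : ∀ p x → x ≤ n → p + n ≤ x + 2 * s → Near (window-at p) (x + 1 * n)
    near-1n p x x≤n p+n≤ = ≤-trans (≤-trans (≤-trans (m≤m+n k (suc k)) window≤n) (m≤m+n n 0)) (m≤n+m (1 * n) x) ,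
      subst (λ y → x + 1 * n ≤ y + 2 * s) (sym (centre p)) (arith₁ n x s p x≤n) ,
      subst (_≤ x + 1 * n + 2 * s) (sym (centre p)) (arith₂ n x s p p+n≤)
      where
      arith₁ : ∀ n x s p → x ≤ n → x + 1 * n ≤ p + 2 * n + 2 * s
      arith₁ n x s p h = certify (p + 2 * s) h (solve (n ∷ x ∷ s ∷ p ∷ []))
      arith₂ : ∀ n x s p → p + n ≤ x + 2 * s → p + 2 * n ≤ x + 1 * n + 2 * s
      arith₂ n x s p h = certify 0 h (solve (n ∷ x ∷ s ∷ p ∷ []))

    block-close : ∀ b i j → i < P → j < P → b * P + i ≤ b * P + j + 2 * s
    block-close b i j i<P j<P = ≤-trans (+-monoʳ-≤ (b * P) (≤-trans (<⇒≤ i<P) (≤-trans (m≤m+n P P) (≤-trans 2P≤2s (m≤n+m (2 * s) j)))))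
      (≤-reflexive (sym (+-assoc (b * P) j (2 * s))))

    near-same : ∀ t b j → j < P → Near (window-at (b * P + j)) (pos t b + 2 * n)
    near-same t b j j<P = near-2n (b * P + j) (pos t b) (block-close b _ j (m%n<n (t + rot b) P) j<P) (block-close b j _ j<P (m%n<n (t + rot b) P))

    open Cyclic B using (prev; prev<)

    -- The block before block 0 is the last one, at distance less than P plus the
    -- length of the tail.
    near-prev : ∀ t b j → b < B → j < P → ∃[ l ] Near (window-at (b * P + j)) (pos t (prev b) + l * n)
    near-prev t zero    j b<B j<P = 1 , near-1n j (pos t (B ∸ 1)) (<⇒≤ (pos< 0 t (prev< b<B)))
      (≤-trans (+-mono-≤ (<⇒≤ j<P) (≤-trans (<⇒≤ n<cells) (≤-reflexive (cong (_+ s) (sym BP≡)))))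
        (≤-trans (arith P s (B * P) ((B ∸ 1) * P) 2P≤s last) (+-monoˡ-≤ (2 * s) (m≤m+n ((B ∸ 1) * P) _))))
      where
      last : B * P ≤ (B ∸ 1) * P + P
      last = ≤-reflexive (trans (cong (_* P) (sym (m+[n∸m]≡n b<B))) (+-comm P _))
      arith : ∀ P s BP b → P + P ≤ s → BP ≤ b + P → P + (BP + s) ≤ b + 2 * s
      arith P s BP b h₁ h₂ = certify 0 (h₁ ⊕ h₂) (solve (P ∷ s ∷ BP ∷ b ∷ []))
    near-prev t (suc b) j b<B j<P = 2 , near-2n (suc b * P + j) (pos t b)
      (≤-trans (≤-trans (+-monoʳ-≤ (b * P) (<⇒≤ (m%n<n (t + rot b) P))) (≤-trans (≤-reflexive (+-comm (b * P) P)) (m≤m+n (suc b * P) j)))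
        (m≤m+n (suc b * P + j) (2 * s)))
      (≤-trans (≤-trans (+-monoʳ-≤ (suc b * P) (<⇒≤ j<P)) (≤-trans (≤-reflexive (rearrange P (b * P))) (+-monoʳ-≤ (b * P) 2P≤2s)))
        (+-monoˡ-≤ (2 * s) (m≤m+n (b * P) _)))
      where
      rearrange : ∀ P x → P + x + P ≡ x + (P + P)
      rearrange P x = solve (P ∷ x ∷ [])

    0<P : 0 < P
    0<P = >-nonZero⁻¹ P

    candidate : ℕ → ℕ → ℕ
    candidate b i = z i b + 2 * n

    candidate-near : ∀ b i → i < 7 → Near (window-at (b * P + 0)) (candidate b i)
    candidate-near b i _ = near-same (source-label i) b 0 0<P

    -- Among the seven vertices of block b with labels above L, the corners are
    -- chosen so as to have many common neighbours in the pool.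
    corners : ∀ b → _
    corners b = four (window-at (b * P + 0)) (candidate b) (candidate-near b)

    corner-index : Corner → ℕ → ℕ
    corner-index in₁  b = Quadruple.a₁ (corners b)
    corner-index in₂  b = Quadruple.a₂ (corners b)
    corner-index out₁ b = Quadruple.a₃ (corners b)
    corner-index out₂ b = Quadruple.a₄ (corners b)

    corner-index< : ∀ κ b → corner-index κ b < 7
    corner-index< in₁  b = Quadruple.a₁<r (corners b)
    corner-index< in₂  b = Quadruple.a₂<r (corners b)
    corner-index< out₁ b = Quadruple.a₃<r (corners b)
    corner-index< out₂ b = Quadruple.a₄<r (corners b)

    corner-index-injective : ∀ κ κ′ b → corner-index κ b ≡ corner-index κ′ b → κ ≡ κ′
    corner-index-injective in₁  in₁  b _ = refl
    corner-index-injective in₁  in₂  b e = ⊥-elim (Quadruple.a₁≢a₂ (corners b) e)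
    corner-index-injective in₁  out₁ b e = ⊥-elim (Quadruple.a₁≢a₃ (corners b) e)
    corner-index-injective in₁  out₂ b e = ⊥-elim (Quadruple.a₁≢a₄ (corners b) e)
    corner-index-injective in₂  in₁  b e = ⊥-elim (Quadruple.a₁≢a₂ (corners b) (sym e))
    corner-index-injective in₂  in₂  b _ = refl
    corner-index-injective in₂  out₁ b e = ⊥-elim (Quadruple.a₂≢a₃ (corners b) e)
    corner-index-injective in₂  out₂ b e = ⊥-elim (Quadruple.a₂≢a₄ (corners b) e)
    corner-index-injective out₁ in₁  b e = ⊥-elim (Quadruple.a₁≢a₃ (corners b) (sym e))
    corner-index-injective out₁ in₂  b e = ⊥-elim (Quadruple.a₂≢a₃ (corners b) (sym e))
    corner-index-injective out₁ out₁ b _ = refl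
    corner-index-injective out₁ out₂ b e = ⊥-elim (Quadruple.a₃≢a₄ (corners b) e)
    corner-index-injective out₂ in₁  b e = ⊥-elim (Quadruple.a₁≢a₄ (corners b) (sym e))
    corner-index-injective out₂ in₂  b e = ⊥-elim (Quadruple.a₂≢a₄ (corners b) (sym e))
    corner-index-injective out₂ out₁ b e = ⊥-elim (Quadruple.a₃≢a₄ (corners b) (sym e))
    corner-index-injective out₂ out₂ b _ = refl

    V : Corner → ℕ → ℕ
    V κ b = z (corner-index κ b) b

    private
      module Ends = Strands n B u sink V (λ _ _ → 0)

    open Ends using (source; target) public

    -- Requiring both mid vertices to be adjacent to all four corners makes the exchange possible,
    -- and lets the same count serve for both slots.
    fits : ℕ → Slot → ℕ → Bool
    fits b link₁ v = adj (source b link₁) v ∧ adj (target b link₁) v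
    fits b link₂ v = adj (source b link₂) v ∧ adj (target b link₂) v
    fits b link₃ v = adj (source b link₃) v ∧ adj (target b link₃) v
    fits b mid₁  v = (adj (V in₁ b) v ∧ adj (V in₂ b) v) ∧ (adj (V out₁ b) v ∧ adj (V out₂ b) v)
    fits b mid₂  v = (adj (V in₁ b) v ∧ adj (V in₂ b) v) ∧ (adj (V out₁ b) v ∧ adj (V out₂ b) v)

    unlift : ∀ x l v → adj (x + l * n) v ≡ adj x v
    unlift x l v = periodic-* (perˡ v) x l

    link-fits : ∀ y x₁ x₂ l₁ l₂ → Near y (x₁ + l₁ * n) → Near y (x₂ + l₂ * n) →
      capacity ≤ count (λ i → pool (y + i) ∧ (adj x₁ (y + i) ∧ adj x₂ (y + i))) w
    link-fits y x₁ x₂ l₁ l₂ near₁ near₂ = ≤-trans (common-neighbours y _ _ near₁ near₂)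
      (≤-reflexive (∑-cong w λ i _ → cong (λ b → ⟦ pool (y + i) ∧ b ⟧) (cong₂ _∧_ (unlift x₁ l₁ (y + i)) (unlift x₂ l₂ (y + i)))))

    unlift-four : ∀ x₁ x₂ x₃ x₄ v →
      (adj (x₁ + 2 * n) v ∧ adj (x₂ + 2 * n) v) ∧ (adj (x₃ + 2 * n) v ∧ adj (x₄ + 2 * n) v) ≡ (adj x₁ v ∧ adj x₂ v) ∧ (adj x₃ v ∧ adj x₄ v)
    unlift-four x₁ x₂ x₃ x₄ v = cong₂ _∧_ (cong₂ _∧_ (unlift x₁ 2 v) (unlift x₂ 2 v)) (cong₂ _∧_ (unlift x₃ 2 v) (unlift x₄ 2 v))

    mid-fits-start : ∀ b → let y = window-at (b * P + 0) in capacity + 5 ≤ count (λ i → pool (y + i) ∧ fits b mid₁ (y + i)) w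
    mid-fits-start b = ≤-trans (four-common-neighbours (window-at (b * P + 0)) (candidate b) (candidate-near b))
      (≤-reflexive (∑-cong w λ i _ → cong (λ c → ⟦ pool (window-at (b * P + 0) + i) ∧ c ⟧)
        (unlift-four (V in₁ b) (V in₂ b) (V out₁ b) (V out₂ b) (window-at (b * P + 0) + i))))

    mid-fits : ∀ b j → j < 5 → capacity ≤ count (λ i → pool (window-at (b * P + j) + i) ∧ fits b mid₁ (window-at (b * P + j) + i)) w
    mid-fits b j j<5 = +-cancelʳ-≤ 5 capacity _ (≤-trans (mid-fits-start b)
      (window-shift (λ v → ⟦ pool v ∧ fits b mid₁ v ⟧) (λ v → ⟦⟧≤1 (pool v ∧ fits b mid₁ v)) w 5 (window-at (b * P + 0)) (window-at (b * P + j))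
        (≤-trans (+-monoˡ-≤ (2 * n ∸ k) (+-monoʳ-≤ (b * P) z≤n)) (m≤m+n (window-at (b * P + j)) 5))
        (≤-trans (+-monoˡ-≤ (2 * n ∸ k) (+-monoʳ-≤ (b * P) (<⇒≤ j<5))) (≤-reflexive (rearrange (b * P) (2 * n ∸ k))))))
      where
      rearrange : ∀ x y → x + 5 + y ≡ x + 0 + y + 5
      rearrange x y = solve (x ∷ y ∷ [])

    5<P : 5 < P
    5<P = ≤-trans (s≤s (≤-trans (m≤m+n 5 2) (≤-trans (≤-trans (m≤n+m 7 (3 * q)) (≤-reflexive (sym h≡))) (m≤n+m h L)))) (≤-reflexive (sym P≡1+L+h))

    -- The two ends of a link lie in the same block or in consecutive ones, so they are near the
    -- item and share enough neighbours. Mid slots rely on the choice of corners instead.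
    rich-block : ∀ b j → b < B → j < 5 →
      capacity ≤ count (λ i → pool (window-at (b * P + j) + i) ∧ fits b (slot j) (window-at (b * P + j) + i)) w
    rich-block b 0 b<B _ = link-fits _ _ _ 2 2 (near-same L b 0 0<P) (near-same _ b 0 0<P)
    rich-block b 1 b<B j<5 = link-fits _ _ _ 2 (proj₁ prior) (near-same _ b 1 1<P) (proj₂ prior)
      where
      1<P : 1 < P
      1<P = <-trans j<5 5<P
      prior = near-prev (source-label (corner-index in₂ (prev b))) b 1 b<B 1<P
    rich-block b 2 b<B j<5 = link-fits _ _ _ (proj₁ prior) 2 (proj₂ prior) (near-same 0 b 2 2<P)
      where
      2<P : 2 < P
      2<P = <-trans j<5 5<P
      prior = near-prev (source-label (corner-index out₂ (prev b))) b 2 b<B 2<P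
    rich-block b 3 b<B j<5 = mid-fits b 3 j<5
    rich-block b 4 b<B j<5 = mid-fits b 4 j<5
    rich-block b (suc (suc (suc (suc (suc j))))) b<B j<5 = ⊥-elim (<-irrefl refl (≤-trans j<5 (m≤m+n 5 j)))

    item-fits : ℕ → ℕ → Bool
    item-fits x y = fits (block x) (slot (offset x)) y

-- The matching of items and the matchings between layers

module Stages where

  open import Data.Bool using (Bool; true; false; _∧_; _∨_; not)
  open import Data.Empty using (⊥-elim)
  open import Data.List using (_∷_; [])
  open import Data.Bool.Properties using (∨-comm)
  open import Data.Nat
  open import Data.Nat.DivMod
  open import Data.Nat.Properties
  open import Data.Nat.Tactic.RingSolver using (solve)
  open import Data.Product using (_×_; _,_; proj₁; proj₂)
  open import Data.Sum using ([_,_]′)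
  open import Relation.Binary.PropositionalEquality
  open Sums
  open Hall
  open CircleHall
  open Layout
  open Classes
  open Weave
  open Merge
  open Assembly

  count-translate : ∀ {n} {X : ℕ → Bool} → Periodic n X → ∀ y y′ l l′ → y + l * n ≡ y′ + l′ * n → ∀ w →
    count (λ i → X (y + i)) w ≡ count (λ i → X (y′ + i)) w
  count-translate {n} {X} per y y′ l l′ eq w = ∑-cong w λ i _ → cong ⟦_⟧ (begin
    X (y + i)            ≡⟨ periodic-* per (y + i) l ⟨
    X (y + i + l * n)    ≡⟨ cong X (trans (+-swapʳ y i (l * n)) (trans (cong (_+ i) eq) (+-swapʳ y′ (l′ * n) i))) ⟩
    X (y′ + i + l′ * n)  ≡⟨ periodic-* per (y′ + i) l′ ⟩
    X (y′ + i)           ∎)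
    where
    open ≡-Reasoning

  ⟦∨⟧-disjoint : ∀ a b → (a ≡ true → b ≡ false) → ⟦ a ⟧ + ⟦ b ⟧ ≡ ⟦ a ∨ b ⟧
  ⟦∨⟧-disjoint true  b disjoint = cong (λ c → 1 + ⟦ c ⟧) (disjoint refl)
  ⟦∨⟧-disjoint false b disjoint = refl

  module Staged (S : Setting) where

    open Assembled S public

    fits-periodic : ∀ b sl → Periodic n (fits b sl)
    fits-periodic b link₁ v = cong₂ _∧_ (perʳ _ v) (perʳ _ v)
    fits-periodic b link₂ v = cong₂ _∧_ (perʳ _ v) (perʳ _ v)
    fits-periodic b link₃ v = cong₂ _∧_ (perʳ _ v) (perʳ _ v)
    fits-periodic b mid₁  v = cong₂ _∧_ (cong₂ _∧_ (perʳ _ v) (perʳ _ v)) (cong₂ _∧_ (perʳ _ v) (perʳ _ v))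
    fits-periodic b mid₂  v = cong₂ _∧_ (cong₂ _∧_ (perʳ _ v) (perʳ _ v)) (cong₂ _∧_ (perʳ _ v) (perʳ _ v))

    item-fits-periodic : ∀ y → Periodic n (λ x → item-fits x y)
    item-fits-periodic y = %n-periodic λ x → fits (x / P) (slot (x % P)) y

    -- Carries `rich-block` over from the window of an item in the standard lift to its windows in
    -- all other lifts.
    rich : ∀ y → item (y + k) ≡ true → capacity ≤ count (λ i → pool (y + i) ∧ item-fits (y + k) (y + i)) w
    rich y it = ≤-trans (rich-block b j b<B (<?ᵇ-true⁻ (proj₂ (∧-true⁻ {blocked (y + k)} it))))
      (≤-reflexive (count-translate {X = λ v → pool v ∧ fits b (slot j) v}
        (λ v → cong₂ _∧_ (pool-periodic v) (fits-periodic b (slot j) v)) (window-at (b * P + j)) y ((y + k) / n) 2 position w))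
      where
      b j : ℕ
      b = block (y + k)
      j = offset (y + k)
      b<B : b < B
      b<B = m<n*o⇒m/o<n (<?ᵇ-true⁻ (proj₁ (∧-true⁻ {blocked (y + k)} it)))
      r≡ : b * P + j ≡ (y + k) % n
      r≡ = trans (+-comm (b * P) j) (sym (m≡m%n+[m/n]*n ((y + k) % n) P))
      position : window-at (b * P + j) + (y + k) / n * n ≡ y + 2 * n
      position = +-cancelʳ-≡ k _ _ (trans (+-swapʳ (window-at (b * P + j)) ((y + k) / n * n) k)
        (trans (cong (_+ (y + k) / n * n) (trans (centre (b * P + j)) (cong (_+ 2 * n) r≡)))
          (trans (+-swapʳ ((y + k) % n) (2 * n) ((y + k) / n * n)) (trans (cong (_+ 2 * n) (sym (m≡m%n+[m/n]*n (y + k) n))) (+-swapʳ y k (2 * n))))))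

    abstract
      -- No window contains more than `capacity` items and each item finds at least `capacity`
      -- suitable pool vertices in its own window, so all strands obtain distinct link and mid
      -- vertices simultaneously.
      items : Matching n item (λ x y → pool y ∧ item-fits x y) item
      items = sparse-matching n k item pool item-fits item-periodic pool-periodic item-fits-periodic
        (λ x → fits-periodic (block x) (slot (offset x))) capacity items-in-window rich

    module _ {t b : ℕ} (t<P : t < P) (b<B : b < B) where

      blocked-pos : blocked (pos t b) ≡ true
      blocked-pos = pos-blocked 0 t b<B

      label-pos : label (pos t b) ≡ t
      label-pos = pos-label 0 t b<B t<P

      block-pos : block (pos t b) ≡ b
      block-pos = pos-block 0 t b<B

      pos<n : pos t b < n
      pos<n = pos< 0 t b<B

      inner-pos : t ≤ L → inner (pos t b) ≡ true
      inner-pos t≤L = ∧-true blocked-pos (<?ᵇ-true (≤-trans (s≤s (≤-reflexive label-pos)) (s≤s t≤L)))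

      outer-pos : L < t → inner (pos t b) ≡ false
      outer-pos L<t = trans (cong (_∧ (label (pos t b) <?ᵇ suc L)) blocked-pos) (<?ᵇ-false (≤-trans L<t (≤-reflexive (sym label-pos))))

    L<P : L < P
    L<P = ≤-trans (m≤m+n (suc L) h) (≤-reflexive (sym P≡1+L+h))

    corner-label< : ∀ κ b → source-label (corner-index κ b) < P
    corner-label< κ b = ≤-trans (+-monoʳ-< (suc L) (≤-trans (corner-index< κ b) (≤-trans (m≤n+m 7 (3 * q)) (≤-reflexive (sym h≡)))))
      (≤-reflexive (sym P≡1+L+h))

    pos-injective : ∀ {t t′ b b′} → t < P → t′ < P → b < B → b′ < B → pos t b ≡ pos t′ b′ → t ≡ t′ × b ≡ b′
    pos-injective t<P t′<P b<B b′<B e =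
      trans (sym (label-pos t<P b<B)) (trans (cong label e) (label-pos t′<P b′<B)) ,
      trans (sym (block-pos t<P b<B)) (trans (cong block e) (block-pos t′<P b′<B))

    V-injective : ∀ κ κ′ {b b′} → b < B → b′ < B → V κ b ≡ V κ′ b′ → κ ≡ κ′ × b ≡ b′
    V-injective κ κ′ {b} {b′} b<B b′<B e = same (pos-injective (corner-label< κ b) (corner-label< κ′ b′) b<B b′<B e)
      where
      same : ∀ {b′} → source-label (corner-index κ b) ≡ source-label (corner-index κ′ b′) × b ≡ b′ → κ ≡ κ′ × b ≡ b′
      same (i≡ , refl) = corner-index-injective κ κ′ b (+-cancelˡ-≡ (suc L) _ _ i≡) , refl

    item-position : ℕ → Slot → ℕ
    item-position b sl = b * P + code sl

    code<P : ∀ sl → code sl < P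
    code<P sl = <-trans (code<5 sl) 5<P

    item-at : ∀ {b} sl → b < B → item (item-position b sl) ≡ true
    item-at sl b<B = ∧-true (lift-blocked 0 b<B (code<P sl)) (<?ᵇ-true (≤-trans (s≤s (≤-reflexive (lift-offset 0 b<B (code<P sl)))) (code<5 sl)))

    item-position< : ∀ {b} sl → b < B → item-position b sl < n
    item-position< sl b<B = <-≤-trans (block< b<B (code<P sl)) BP≤n

    f : ℕ → Slot → ℕ
    f b sl = Matching.to items (item-position b sl)

    f< : ∀ {b} sl → b < B → f b sl < n
    f< sl b<B = Matching.to< items (item-position< sl b<B) (item-at sl b<B)

    f-spec : ∀ {b} sl → b < B → (pool (f b sl) ∧ item-fits (item-position b sl) (f b sl)) ≡ true
    f-spec sl b<B = Matching.to-rel items (item-position< sl b<B) (item-at sl b<B)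

    f-pool : ∀ {b} sl → b < B → pool (f b sl) ≡ true
    f-pool {b} sl b<B = proj₁ (∧-true⁻ {pool (f b sl)} (f-spec sl b<B))

    f-fits : ∀ {b} sl → b < B → fits b sl (f b sl) ≡ true
    f-fits {b} sl b<B = subst₂ (λ β τ → fits β τ (f b sl) ≡ true) (lift-block 0 b<B (code<P sl))
      (trans (cong slot (lift-offset 0 b<B (code<P sl))) (slot-code sl)) (proj₂ (∧-true⁻ {pool (f b sl)} (f-spec sl b<B)))

    f-injective : ∀ {b b′} sl sl′ → b < B → b′ < B → f b sl ≡ f b′ sl′ → b ≡ b′ × sl ≡ sl′
    f-injective {b} {b′} sl sl′ b<B b′<B e =
      trans (sym (block-/ b (code<P sl))) (trans (cong (_/ P) same) (block-/ b′ (code<P sl′))) ,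
      trans (sym (slot-code sl)) (trans (cong slot (trans (sym (block-% b (code<P sl))) (trans (cong (_% P) same) (block-% b′ (code<P sl′))))) (slot-code sl′))
      where
      same : item-position b sl ≡ item-position b′ sl′
      same = Matching.injective items (item-position< sl b<B) (item-position< sl′ b′<B) (item-at sl b<B) (item-at sl′ b′<B) e

    pool-label> : ∀ {v} → pool v ≡ true → L + 7 < label v
    pool-label> {v} e = <?ᵇ-true⁻ (proj₂ (∧-true⁻ {blocked v} e))

    pool-outer : ∀ {v} → pool v ≡ true → inner v ≡ false
    pool-outer {v} e = trans (cong (_∧ (label v <?ᵇ suc L)) (proj₁ (∧-true⁻ {blocked v} e)))
      (<?ᵇ-false (≤-trans (s≤s (m≤m+n L 7)) (pool-label> e)))

    f≢V : ∀ {b b′} sl κ → b < B → b′ < B → f b sl ≢ V κ b′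
    f≢V {b} {b′} sl κ b<B b′<B e = <-irrefl refl (<-≤-trans (pool-label> (f-pool sl b<B)) (≤-trans
      (≤-reflexive (trans (cong label e) (label-pos (corner-label< κ b′) b′<B)))
      (≤-trans (≤-reflexive (sym (+-suc L (corner-index κ b′)))) (+-monoʳ-≤ L (corner-index< κ b′)))))

    open Strands n B u sink V f using (used)

    ∧-left : ∀ a b → a ∧ b ≡ true → a ≡ true
    ∧-left true b _ = refl

    ∧-right : ∀ a b → a ∧ b ≡ true → b ≡ true
    ∧-right true b e = e

    fits-source : ∀ b sl v → fits b sl v ≡ true → adj (source b sl) v ≡ true
    fits-source b link₁ v e = ∧-left (adj (source b link₁) v) (adj (target b link₁) v) e
    fits-source b link₂ v e = ∧-left (adj (source b link₂) v) (adj (target b link₂) v) e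
    fits-source b link₃ v e = ∧-left (adj (source b link₃) v) (adj (target b link₃) v) e
    fits-source b mid₁  v e = ∧-left (adj (V in₁ b) v) (adj (V in₂ b) v) (∧-left (adj (V in₁ b) v ∧ adj (V in₂ b) v) (adj (V out₁ b) v ∧ adj (V out₂ b) v) e)
    fits-source b mid₂  v e = ∧-right (adj (V in₁ b) v) (adj (V in₂ b) v) (∧-left (adj (V in₁ b) v ∧ adj (V in₂ b) v) (adj (V out₁ b) v ∧ adj (V out₂ b) v) e)

    fits-target : ∀ b sl v → fits b sl v ≡ true → adj (target b sl) v ≡ true
    fits-target b link₁ v e = ∧-right (adj (source b link₁) v) (adj (target b link₁) v) e
    fits-target b link₂ v e = ∧-right (adj (source b link₂) v) (adj (target b link₂) v) e
    fits-target b link₃ v e = ∧-right (adj (source b link₃) v) (adj (target b link₃) v) e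
    fits-target b mid₁  v e = ∧-left (adj (V out₁ b) v) (adj (V out₂ b) v) (∧-right (adj (V in₁ b) v ∧ adj (V in₂ b) v) (adj (V out₁ b) v ∧ adj (V out₂ b) v) e)
    fits-target b mid₂  v e = ∧-right (adj (V out₁ b) v) (adj (V out₂ b) v) (∧-right (adj (V in₁ b) v ∧ adj (V in₂ b) v) (adj (V out₁ b) v ∧ adj (V out₂ b) v) e)

    fits-cross₁ : ∀ b v → fits b mid₂ v ≡ true → adj (V in₁ b) v ≡ true
    fits-cross₁ b v e = ∧-left (adj (V in₁ b) v) (adj (V in₂ b) v) (∧-left (adj (V in₁ b) v ∧ adj (V in₂ b) v) (adj (V out₁ b) v ∧ adj (V out₂ b) v) e)

    fits-cross₂ : ∀ b v → fits b mid₁ v ≡ true → adj (V in₂ b) v ≡ true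
    fits-cross₂ b v e = ∧-right (adj (V in₁ b) v) (adj (V in₂ b) v) (∧-left (adj (V in₁ b) v ∧ adj (V in₂ b) v) (adj (V out₁ b) v ∧ adj (V out₂ b) v) e)

    source-adj : ∀ {b} sl → b < B → adj (source b sl) (f b sl) ≡ true
    source-adj {b} sl b<B = fits-source b sl (f b sl) (f-fits {b} sl b<B)

    target-adj : ∀ {b} sl → b < B → adj (f b sl) (target b sl) ≡ true
    target-adj {b} sl b<B = trans (adj-sym (f b sl) (target b sl)) (fits-target b sl (f b sl) (f-fits {b} sl b<B))

    cross₁ : ∀ {b} → b < B → adj (V in₁ b) (f b mid₂) ≡ true
    cross₁ {b} b<B = fits-cross₁ b (f b mid₂) (f-fits {b} mid₂ b<B)

    cross₂ : ∀ {b} → b < B → adj (V in₂ b) (f b mid₁) ≡ true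
    cross₂ {b} b<B = fits-cross₂ b (f b mid₁) (f-fits {b} mid₁ b<B)

    -- The strands are built from vertices below `n`, hence the reduction modulo `n` before `used`
    -- is asked.
    spare : ℕ → ℕ → Bool
    spare t v = reserve t v ∧ not (used (v % n))

    spare-periodic : ∀ t → Periodic n (spare t)
    spare-periodic t v = cong₂ _∧_ (reserve-periodic t v) (%n-periodic (λ x → not (used x)) v)

    spare⇒reserve : ∀ t v → spare t v ≡ true → reserve t v ≡ true
    spare⇒reserve t v e = proj₁ (∧-true⁻ {reserve t v} e)

    spare-outer : ∀ t v → spare t v ≡ true → inner v ≡ false
    spare-outer t v e = not-inner (proj₁ (∧-true⁻ {not (inner v)} (spare⇒reserve t v e)))
      where
      not-inner : ∀ {b} → not b ≡ true → b ≡ false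
      not-inner {false} _ = refl

    layer-inner : ∀ t v → t ≤ L → layer t v ≡ true → inner v ≡ true
    layer-inner t v t≤L e = ∧-true (proj₁ (∧-true⁻ {blocked v} e))
      (<?ᵇ-true (≤-trans (s≤s (≤-reflexive (==⇒≡ (proj₂ (∧-true⁻ {blocked v} e))))) (s≤s t≤L)))

    layer-or-spare : ℕ → ℕ → ℕ → Bool
    layer-or-spare t e v = layer t v ∨ spare e v

    -- Edges between two spare vertices are not used, which excludes cycles that
    -- avoid the layers.
    stage-rel : ℕ → ℕ → Bool
    stage-rel x y = adj x y ∧ (inner x ∨ inner y)

    private
      -- A layer contains at most `16 q m - 43 m` non-neighbours in the window, and the reserve of
      -- one stage adds at most `3 m` vertices.
      κ : ℕ
      κ = 16 * q * m ∸ 40 * m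

      κ≡ : κ + 40 * m ≡ 16 * q * m
      κ≡ = m∸n+n≡m (*-monoˡ-≤ m (≤-trans (≤-trans (m≤m+n 40 65496) q-large) (m≤n*m q 16)))

    module Stage (t : ℕ) (t<L : t < L) where

      -- A spare vertex occurs on both sides, once to be left and once to be entered. As `stage-rel`
      -- forbids edges between spare vertices, it is entered from layer `t` and left towards layer
      -- `t + 1`.
      from-part to-part : ℕ → Bool
      from-part = layer-or-spare t t
      to-part = layer-or-spare (suc t) t

      layer-not-spare : ∀ e → e ≤ L → ∀ v → layer e v ≡ true → spare t v ≡ false
      layer-not-spare e e≤L v lay = [ (λ sp → ⊥-elim (true≢false (layer-inner e v e≤L lay) (spare-outer t v sp))) , (λ eq → eq) ]′ (decide (spare t v))

      part-count : ∀ e → e ≤ L → ∀ x → count (layer e) x + count (spare t) x ≡ count (layer-or-spare e t) x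
      part-count e e≤L = count-partition (layer-or-spare e t) (layer e) (spare t) λ v → ⟦∨⟧-disjoint (layer e v) (spare t v) (layer-not-spare e e≤L v)

      -- The spare vertices are common to both sides and cancel, so the near equality of prefixes is
      -- inherited from the layers.
      close : ∀ e e′ → e ≤ L → e′ ≤ L → ∀ x → count (layer-or-spare e t) x ≤ count (layer-or-spare e′ t) x + 1
      close e e′ e≤L e′≤L x = subst₂ (λ a b → a ≤ b + 1) (part-count e e≤L x) (part-count e′ e′≤L x)
        (arith (count (layer e) x) (count (layer e′) x) (count (spare t) x) (proj₁ (layer-prefix x))
          (proj₂ (proj₂ (layer-prefix x) e (≤-<-trans e≤L L<P))) (proj₁ (proj₂ (layer-prefix x) e′ (≤-<-trans e′≤L L<P))))
        where
        arith : ∀ a a′ s N → a ≤ N + 1 → N ≤ a′ → a + s ≤ a′ + s + 1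
        arith a a′ s N h₁ h₂ = certify 0 (h₁ ⊕ h₂) (solve (a ∷ a′ ∷ s ∷ N ∷ []))

      total : count from-part n ≡ count to-part n
      total = trans (sym (part-count t (<⇒≤ t<L) n)) (trans (cong (_+ count (spare t) n)
        (trans (layer-total t (<-trans t<L L<P)) (sym (layer-total (suc t) (≤-<-trans t<L L<P))))) (part-count (suc t) t<L n))

      half : ∀ e → e ≤ L → ∀ x → κ + 2 ≤ count (λ j → layer-or-spare e t (x + j)) k
      half e e≤L x = ≤-trans (arith κ (16 * q * m) (count (λ j → layer e (x + j)) k) m κ≡ (layer-in-half-window x e (≤-<-trans e≤L L<P)) 1≤m)
        (∑-mono k λ j _ → ⟦⟧-mono (∨-trueˡ {layer e (x + j)}))
        where
        arith : ∀ κ Q C m → κ + 40 * m ≡ Q → Q ≤ C + 3 * m → 1 ≤ m → κ + 2 ≤ C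
        arith κ _ C m refl h₁ h₂ = certify (35 * m) (h₁ ⊕ 2 ⊗ h₂) (solve (κ ∷ C ∷ m ∷ []))

      -- Besides the non-neighbours in the layer, all reserve vertices of the stage are counted as
      -- lost, which covers the pairs of spare vertices excluded by `stage-rel`.
      few : ∀ e → e ≤ L → ∀ y → (link : ℕ → Bool) → (∀ j → not (link j) ≡ not (adj (y + k) (y + j) ∧ (inner (y + k) ∨ inner (y + j)))) →
        count (λ j → layer-or-spare e t (y + j) ∧ not (link j)) w ≤ κ
      few e e≤L y link link≡ = arith κ (16 * q * m) m _ _ _ κ≡ (non-neighbours-in-layer y y e (≤-<-trans e≤L L<P) (m≤m+n y (2 * s)) (m≤m+n y (2 * s)))
        (reserve-in-window y t t<L) (≤-trans (∑-mono w λ j _ → pointwise j) (≤-reflexive (∑-+ w _ _)))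
        where
        cases : ∀ l s r a i i′ → (l ≡ true → i′ ≡ true) → (s ≡ true → r ≡ true) →
          ⟦ (l ∨ s) ∧ not (a ∧ (i ∨ i′)) ⟧ ≤ ⟦ not a ∧ l ⟧ + ⟦ r ⟧
        cases true  s     r true  i     i′    li sr = ≤-trans (⟦⟧-mono {not (i ∨ i′)} λ e → ⊥-elim (not-true⁻ e (∨-trueʳ {i} (li refl)))) z≤n
        cases true  s     r false i     i′    li sr = s≤s z≤n
        cases false true  r a     i     i′    li sr = ≤-trans (⟦⟧≤1 (not (a ∧ (i ∨ i′)))) (≤-trans (≤-reflexive (sym (cong ⟦_⟧ (sr refl)))) (m≤n+m _ _))
        cases false false r a     i     i′    li sr = z≤n
        pointwise : ∀ j → ⟦ layer-or-spare e t (y + j) ∧ not (link j) ⟧ ≤ ⟦ not (adj (y + k) (y + j)) ∧ layer e (y + j) ⟧ + ⟦ reserve t (y + j) ⟧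
        pointwise j = subst (λ b → ⟦ layer-or-spare e t (y + j) ∧ b ⟧ ≤ ⟦ not (adj (y + k) (y + j)) ∧ layer e (y + j) ⟧ + ⟦ reserve t (y + j) ⟧)
          (sym (link≡ j)) (cases (layer e (y + j)) (spare t (y + j)) (reserve t (y + j)) (adj (y + k) (y + j)) (inner (y + k)) (inner (y + j))
            (layer-inner e (y + j) e≤L) (spare⇒reserve t (y + j)))
        arith : ∀ κ Q m C N R → κ + 40 * m ≡ Q → N + 43 * m ≤ Q → R ≤ 3 * m → C ≤ N + R → C ≤ κ
        arith κ _ m C N R refl h₁ h₂ h₃ = certify 0 (h₁ ⊕ h₂ ⊕ h₃) (solve (κ ∷ m ∷ C ∷ N ∷ R ∷ []))

      part-periodic : ∀ e → Periodic n (layer-or-spare e t)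
      part-periodic e v = cong₂ _∨_ (layer-periodic e v) (spare-periodic t v)

      abstract
        matching : Matching n from-part (λ x y → to-part y ∧ stage-rel x y) from-part
        matching = dense-matching n k from-part to-part stage-rel (part-periodic t) (part-periodic (suc t))
          (λ y x → cong₂ (λ a b → a ∧ (b ∨ inner y)) (perˡ y x) (inner-periodic x))
          (λ x y → cong₂ (λ a b → a ∧ (inner x ∨ b)) (perʳ x y) (inner-periodic y))
          κ (close t (suc t) (<⇒≤ t<L) t<L) (close (suc t) t t<L (<⇒≤ t<L)) total (half t (<⇒≤ t<L)) (half (suc t) t<L)
          (λ y _ → few (suc t) t<L y (λ j → stage-rel (y + k) (y + j)) λ j → refl)
          (λ y _ → few t (<⇒≤ t<L) y (λ j → stage-rel (y + j) (y + k)) λ j → cong not (cong₂ _∧_ (adj-sym (y + j) (y + k)) (∨-comm (inner (y + j)) (inner (y + k)))))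

-- Assembling the single orbit

module Finish where

  open import Data.Bool using (true; false; _∧_; _∨_; not; if_then_else_)
  open import Data.Empty using (⊥-elim)
  open import Data.Nat
  open import Data.Nat.DivMod
  open import Data.Nat.Properties
  open import Data.Product using (∃-syntax; _×_; _,_; proj₁; proj₂)
  open import Data.Sum using (_⊎_; inj₁; inj₂; [_,_]′)
  open import Relation.Binary.PropositionalEquality
  open import Relation.Nullary using (Dec; yes; no)
  open Sums
  open Hall
  open Layout
  open Classes
  open Weave
  open Merge
  open Assembly
  open Stages

  module Finished (S : Setting) where

    open Staged S
    open Permutes n
    open Strands n B u sink V f using (used)

    stage : ℕ → ℕ
    stage v = if inner v then label v else reserve-index v

    inner⇒stage : ∀ {v} → inner v ≡ true → stage v ≡ label v
    inner⇒stage {v} inn = cong (λ b → if b then label v else reserve-index v) inn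

    outer⇒stage : ∀ {v} → inner v ≡ false → stage v ≡ reserve-index v
    outer⇒stage {v} out = cong (λ b → if b then label v else reserve-index v) out

    inner-label : ∀ {v} → inner v ≡ true → label v ≤ L
    inner-label {v} inn = s≤s⁻¹ (<?ᵇ-true⁻ (proj₂ (∧-true⁻ {blocked v} inn)))

    inner-stage : ∀ {v} → inner v ≡ true → stage v ≤ L
    inner-stage {v} inn = ≤-trans (≤-reflexive (inner⇒stage inn)) (inner-label {v} inn)

    outer-stage : ∀ {v} → inner v ≡ false → stage v < L
    outer-stage {v} out = ≤-trans (s≤s (≤-reflexive (outer⇒stage out))) (reserve-index< v)

    u-onto : ∀ {v} → v < n → inner v ≡ true → stage v ≡ L → ∃[ b ] b < B × v ≡ u b
    u-onto {v} v<n inn st = block v , proj₁ located , trans (proj₂ located) (cong (λ t → pos t (block v)) (trans (sym (inner⇒stage inn)) st))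
      where
      located = layer⇒pos v v<n (proj₁ (∧-true⁻ {blocked v} inn))

    -- The identity is a filler for `t ≥ L`: the vertices of layer `L` continue along a strand.
    choose : ∀ t → Dec (t < L) → ℕ → ℕ
    choose t (yes t<L) = Matching.to (Stage.matching t t<L)
    choose t (no _)    = λ v → v

    to : ℕ → ℕ → ℕ
    to t = choose t (t <? L)

    module _ {t : ℕ} (t<L : t < L) where

      private
        -- The decision procedure brings its own proof of `t < L`; the matching built from that very
        -- proof has to be recovered.
        Choice : Set
        Choice = ∃[ p ] (∀ v → to t v ≡ Matching.to (Stage.matching t p) v)

        choice : Choice
        choice = go (t <? L) refl
          where
          go : (d : Dec (t < L)) → (t <? L) ≡ d → Choice
          go (yes p) eq = p , λ v → cong (λ d → choose t d v) eq
          go (no ¬p) _  = ⊥-elim (¬p t<L)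

        matched : Matching n (layer-or-spare t t) (λ x y → layer-or-spare (suc t) t y ∧ stage-rel x y) (layer-or-spare t t)
        matched = Stage.matching t (proj₁ choice)

        same : ∀ v → to t v ≡ Matching.to matched v
        same = proj₂ choice

      to-bounded : ∀ {v} → v < n → layer-or-spare t t v ≡ true → to t v < n
      to-bounded {v} v<n part = subst (_< n) (sym (same v)) (Matching.to< matched v<n part)

      to-rel : ∀ {v} → v < n → layer-or-spare t t v ≡ true → (layer-or-spare (suc t) t (to t v) ∧ stage-rel v (to t v)) ≡ true
      to-rel {v} v<n part = subst (λ y → (layer-or-spare (suc t) t y ∧ stage-rel v y) ≡ true) (sym (same v)) (Matching.to-rel matched v<n part)

      to-one-one : ∀ {v v′} → v < n → v′ < n → layer-or-spare t t v ≡ true → layer-or-spare t t v′ ≡ true → to t v ≡ to t v′ → v ≡ v′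
      to-one-one {v} {v′} v<n v′<n part part′ e = Matching.injective matched v<n v′<n part part′ (trans (sym (same v)) (trans e (same v′)))

    in-part : ∀ {v} → v < n → used v ≡ false → layer-or-spare (stage v) (stage v) v ≡ true
    in-part {v} v<n ¬used = [ from-inner , from-outer ]′ (decide (inner v))
      where
      from-inner : inner v ≡ true → layer-or-spare (stage v) (stage v) v ≡ true
      from-inner inn = ∨-trueˡ (∧-true (proj₁ (∧-true⁻ {blocked v} inn)) (trans (cong (label v ==_) (inner⇒stage inn)) (==-refl (label v))))
      from-outer : inner v ≡ false → layer-or-spare (stage v) (stage v) v ≡ true
      from-outer out = ∨-trueʳ {layer (stage v) v} (∧-true
        (∧-true (cong not out) (trans (cong (reserve-index v ==_) (outer⇒stage out)) (==-refl (reserve-index v))))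
        (cong not (trans (cong used (m<n⇒m%n≡m v<n)) ¬used)))

    to< : ∀ {v} → v < n → used v ≡ false → stage v < L → to (stage v) v < n
    to< v<n ¬used st<L = to-bounded st<L v<n (in-part v<n ¬used)

    to-adj : ∀ {v} → v < n → used v ≡ false → stage v < L → adj v (to (stage v) v) ≡ true
    to-adj {v} v<n ¬used st<L = ∧-left (adj v y) (inner v ∨ inner y) (∧-right (layer-or-spare (suc (stage v)) (stage v) y) (stage-rel v y)
      (to-rel st<L v<n (in-part v<n ¬used)))
      where
      y : ℕ
      y = to (stage v) v

    Arrival : ℕ → ℕ → Set
    Arrival v y = (inner y ≡ true × stage y ≡ suc (stage v)) ⊎ (inner v ≡ true × inner y ≡ false × used y ≡ false × stage y ≡ stage v)

    arrive-layer : ∀ v y → stage v < L → layer (suc (stage v)) y ≡ true → Arrival v y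
    arrive-layer v y st<L lay = inj₁ (inn , trans (inner⇒stage inn) (==⇒≡ (∧-right (blocked y) (label y == suc (stage v)) lay)))
      where
      inn : inner y ≡ true
      inn = layer-inner (suc (stage v)) y st<L lay

    arrive-spare : ∀ v y → y < n → spare (stage v) y ≡ true → (inner v ∨ inner y) ≡ true → Arrival v y
    arrive-spare v y y<n sp one-inner = inj₂ (
      trans (sym (∨-identity (inner v) out)) one-inner ,
      out ,
      trans (sym (cong used (m<n⇒m%n≡m y<n))) (not-true′ (∧-right (reserve (stage v) y) (not (used (y % n))) sp)) ,
      trans (outer⇒stage out) (==⇒≡ (∧-right (not (inner y)) (reserve-index y == stage v) (spare⇒reserve (stage v) y sp))))
      where
      out : inner y ≡ false
      out = spare-outer (stage v) y sp
      ∨-identity : ∀ a {b} → b ≡ false → a ∨ b ≡ a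
      ∨-identity true  refl = refl
      ∨-identity false refl = refl
      not-true′ : ∀ {b} → not b ≡ true → b ≡ false
      not-true′ {false} _ = refl

    arrive : ∀ v y → y < n → stage v < L → (layer-or-spare (suc (stage v)) (stage v) y ∧ stage-rel v y) ≡ true → Arrival v y
    arrive v y y<n st<L rel = [ arrive-layer v y st<L , (λ sp → arrive-spare v y y<n sp
        (∧-right (adj v y) (inner v ∨ inner y) (∧-right (layer-or-spare (suc (stage v)) (stage v) y) (stage-rel v y) rel))) ]′
      (∨-true⁻ {layer (suc (stage v)) y} {spare (stage v) y} (∧-left (layer-or-spare (suc (stage v)) (stage v) y) (stage-rel v y) rel))

    to-class : ∀ {v} → v < n → used v ≡ false → stage v < L → Arrival v (to (stage v) v)
    to-class {v} v<n ¬used st<L = arrive v (to (stage v) v) (to< {v} v<n ¬used st<L) st<L (to-rel st<L v<n (in-part {v} v<n ¬used))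

    to-injective : ∀ {t v v′} → v < n → v′ < n → used v ≡ false → used v′ ≡ false → stage v ≡ t → stage v′ ≡ t → t < L →
      to t v ≡ to t v′ → v ≡ v′
    to-injective {v = v} {v′} v<n v′<n ¬used ¬used′ refl e′ t<L =
      to-one-one t<L v<n v′<n (in-part v<n ¬used) (subst (λ t → layer-or-spare t t v′ ≡ true) e′ (in-part v′<n ¬used′))

    0<B : 0 < B
    0<B = *-mono-≤ 0<c 1≤m

    one-cycle : ∃[ τ ] Perm τ × (∀ x → x < n → adj x (τ x) ≡ true) × (∀ x → x < n → Reach τ (u 0) x)
    one-cycle = Strands.Weaving.single-orbit n B u sink V f L adj adj-sym inner stage
      (λ b<B → pos<n L<P b<B) (λ b<B → pos<n 0<P b<B) (λ κ {b} b<B → pos<n (corner-label< κ b) b<B) f<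
      (λ b<B → inner-pos L<P b<B ≤-refl) (λ b<B → trans (inner⇒stage (inner-pos L<P b<B ≤-refl)) (label-pos L<P b<B))
      (λ b<B → inner-pos 0<P b<B z≤n) (λ b<B → trans (inner⇒stage (inner-pos 0<P b<B z≤n)) (label-pos 0<P b<B))
      (λ κ {b} b<B → outer-pos (corner-label< κ b) b<B (s≤s (m≤m+n L (corner-index κ b))))
      (λ {b} sl b<B → pool-outer {f b sl} (f-pool sl b<B))
      u-onto inner-stage outer-stage
      (λ b<B b′<B e → proj₂ (pos-injective L<P L<P b<B b′<B e)) (λ b<B b′<B e → proj₂ (pos-injective 0<P 0<P b<B b′<B e))
      V-injective f-injective f≢V source-adj target-adj cross₁ cross₂ 0<B to to< to-adj to-class to-injective

    u₀<n : u 0 < n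
    u₀<n = pos<n L<P 0<B

    module Cycle (τ : ℕ → ℕ) (τ-perm : Perm τ) (all : ∀ x → x < n → Reach τ (u 0) x) =
      SingleOrbit τ-perm (u 0) u₀<n (λ {x} → all x)

-- From the real number ε to integer inequalities

module Reals where

  open import Data.Integer as ℤ using (ℤ; +_)
  import Data.Integer.Properties as ℤ
  open import Data.Nat as ℕ using (ℕ; zero; suc; z≤n; s≤s)
  import Data.Nat.Properties as ℕ
  open import Data.Nat.Coprimality using (sym; 1-coprimeTo)
  open import Data.Product using (∃-syntax; _×_; _,_; proj₁; proj₂)
  open import Data.Rational
  open import Data.Rational.Properties
  open import Data.Rational.Solver using (module +-*-Solver)
  open import Data.Sum using (inj₁; inj₂)
  open import Relation.Binary.PropositionalEquality hiding (sym)
  import Relation.Binary.PropositionalEquality as ≡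
  open import Relation.Nullary using (¬_; Dec; yes; no)
  open import Defs using (ℝ; seq; cauchy; recip; fromℕ; fromℚ; module Reciprocal)
    renaming (_<_ to _<ᴿ_; _≤_ to _≤ᴿ_; _+_ to _+ᴿ_; _*_ to _*ᴿ_; _^_ to _^ᴿ_)
  open +-*-Solver

  ι : ℕ → ℚ
  ι n = + n / 1

  ι-mkℚ : ∀ n → ι n ≡ mkℚ (+ n) 0 (sym (1-coprimeTo n))
  ι-mkℚ n = ↥p/↧p≡p (mkℚ (+ n) 0 (sym (1-coprimeTo n)))

  ι-mono : ∀ {m n} → m ℕ.≤ n → ι m ≤ ι n
  ι-mono {m} {n} m≤n rewrite ι-mkℚ m | ι-mkℚ n = *≤* (ℤ.*-monoʳ-≤-nonNeg (+ 1) (ℤ.+≤+ m≤n))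

  ι-+ : ∀ m n → ι (m ℕ.+ n) ≡ ι m + ι n
  ι-+ m n rewrite ι-mkℚ m | ι-mkℚ n = cong (_/ 1) (trans (ℤ.pos-+ m n) (≡.sym (cong₂ ℤ._+_ (ℤ.*-identityʳ (+ m)) (ℤ.*-identityʳ (+ n)))))

  ι-* : ∀ m n → ι (m ℕ.* n) ≡ ι m * ι n
  ι-* m n rewrite ι-mkℚ m | ι-mkℚ n = cong (_/ 1) (ℤ.pos-* m n)

  ι-pos : ∀ {n} → 0 ℕ.< n → 0ℚ < ι n
  ι-pos {n} 0<n rewrite ι-mkℚ n = *<* (ℤ.*-monoʳ-<-pos (+ 1) (ℤ.+<+ 0<n))

  0≤ι : ∀ n → 0ℚ ≤ ι n
  0≤ι n = ι-mono {0} {n} z≤n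

  ≤∣∣ : ∀ p → p ≤ ∣ p ∣
  ≤∣∣ p with ≤-total 0ℚ p
  ... | inj₁ 0≤p = ≤-reflexive (≡.sym (0≤p⇒∣p∣≡p 0≤p))
  ... | inj₂ p≤0 = ≤-trans p≤0 (0≤∣p∣ p)

  0<* : ∀ {p q} → 0ℚ < p → 0ℚ < q → 0ℚ < p * q
  0<* {p} {q} 0<p 0<q = positive⁻¹ (p * q) {{pos*pos⇒pos p {{positive 0<p}} q {{positive 0<q}}}}

  *-mono : ∀ {p q r s} → 0ℚ ≤ p → 0ℚ ≤ s → p ≤ q → r ≤ s → p * r ≤ q * s
  *-mono {p} {q} {r} {s} 0≤p 0≤s p≤q r≤s = ≤-trans
    (*-monoˡ-≤-nonNeg p {{nonNegative 0≤p}} r≤s) (*-monoʳ-≤-nonNeg s {{nonNegative 0≤s}} p≤q)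

  inverse : ∀ {p} → 0ℚ < p → ∃[ q ] 0ℚ < q × p * q ≡ 1ℚ
  inverse {p} 0<p = (1/ p) {{>-nonZero 0<p}} ,
    positive⁻¹ ((1/ p) {{>-nonZero 0<p}}) {{1/pos⇒pos p {{positive 0<p}}}} , *-inverseʳ p {{>-nonZero 0<p}}

  <+⇒-< : ∀ p q r → p - q < r → p < r + q
  <+⇒-< p q r h = subst (_< r + q) (solve 2 (λ p q → p :- q :+ q := p) refl p q) (+-mono-<-≤ h (≤-refl {q}))

  power-bound : ∀ x n Q → ι Q ≤ seq x n → ∀ m → ι (Q ℕ.^ m) ≤ seq (x ^ᴿ m) n
  power-bound x n Q Q≤ zero    = ≤-refl
  power-bound x n Q Q≤ (suc m) = ≤-trans (≤-reflexive (ι-* Q (Q ℕ.^ m)))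
    (*-mono (0≤ι Q) (≤-trans (0≤ι (Q ℕ.^ m)) (power-bound x n Q Q≤ m)) Q≤ (power-bound x n Q Q≤ m))

  module _ (ε : ℝ) (ε>0 : fromℕ 0 <ᴿ ε) (K Q : ℕ) (0<Q : 0 ℕ.< Q) (K<Q : K ℕ.< Q ℕ.^ 121)
    (ε-large : recip ε ε>0 ^ᴿ 121 ≤ᴿ fromℕ K) where

    private
      t : ℚ
      t = proj₁ (inverse (ι-pos 0<Q))

      0<t : 0ℚ < t
      0<t = proj₁ (proj₂ (inverse (ι-pos 0<Q)))

      Qt≡1 : ι Q * t ≡ 1ℚ
      Qt≡1 = proj₂ (proj₂ (inverse (ι-pos 0<Q)))

      N₀ : ℕ
      N₀ = proj₁ (proj₂ (proj₂ ε>0))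

    -- Otherwise the reciprocal would be at least `Q` from some index on, and its power at least
    -- `Q ^ 121 ≥ K + 1`, which refutes `ε-large` with a gap of 1.
    not-eventually-small : ∀ N → ¬ (∀ n → N ℕ.≤ n → seq ε n ≤ t)
    not-eventually-small N small = ε-large (1ℚ , positive⁻¹ 1ℚ , N , bound)
      where
      recip-bound : ∀ n → N ℕ.≤ n → ι Q ≤ seq (recip ε ε>0) n
      recip-bound n N≤n = begin
        ι Q                       ≡⟨ *-identityʳ (ι Q) ⟨
        ι Q * 1ℚ                  ≡⟨ cong (ι Q *_) (*-inverseʳ e {{>-nonZero 0<e}}) ⟨
        ι Q * (e * r)             ≤⟨ *-monoˡ-≤-nonNeg (ι Q) {{nonNegative (0≤ι Q)}}
                                       (*-monoʳ-≤-nonNeg r {{nonNegative (<⇒≤ 0<r)}} (small (N₀ ℕ.+ n) (ℕ.m≤n⇒m≤o+n N₀ N≤n))) ⟩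
        ι Q * (t * r)             ≡⟨ *-assoc (ι Q) t r ⟨
        ι Q * t * r               ≡⟨ cong (_* r) Qt≡1 ⟩
        1ℚ * r                    ≡⟨ *-identityˡ r ⟩
        r                         ∎
        where
        open ≤-Reasoning
        e r : ℚ
        e = seq ε (N₀ ℕ.+ n)
        r = seq (recip ε ε>0) n
        0<e : 0ℚ < e
        0<e = Reciprocal.0<term ε (proj₁ ε>0) (proj₁ (proj₂ ε>0)) N₀ (proj₂ (proj₂ (proj₂ ε>0))) n
        0<r : 0ℚ < r
        0<r = positive⁻¹ r {{1/pos⇒pos e {{positive 0<e}}}}
      bound : ∀ n → N ℕ.≤ n → ι K + 1ℚ ≤ seq (recip ε ε>0 ^ᴿ 121) n
      bound n N≤n = ≤-trans (≤-reflexive (≡.sym (ι-+ K 1))) (≤-trans (ι-mono (ℕ.≤-trans (ℕ.≤-reflexive (ℕ.+-comm K 1)) K<Q))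
        (power-bound (recip ε ε>0) n Q (recip-bound n N≤n) 121))

    private module Short (g d : ℕ) (short : 2 ℕ.* Q ℕ.* d ℕ.< (Q ℕ.+ 2) ℕ.* g) where

      open ≤-Reasoning
      ¼ u η h : ℚ
      ¼ = ½ * ½
      u = proj₁ (inverse (ι-pos (s≤s (z≤n {g}))))
      η = t * ¼ * u
      h = η * ½
      0<u : 0ℚ < u
      0<u = proj₁ (proj₂ (inverse (ι-pos (s≤s (z≤n {g})))))
      0<t¼ : 0ℚ < t * ¼
      0<t¼ = 0<* 0<t (positive⁻¹ ¼)
      0<η : 0ℚ < η
      0<η = 0<* 0<t¼ 0<u
      N : ℕ
      N = proj₁ (cauchy ε h (0<* 0<η (positive⁻¹ ½)))
      close : ∀ m n → N ℕ.≤ m → N ℕ.≤ n → seq ε m < h + seq ε n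
      close m n N≤m N≤n = <+⇒-< (seq ε m) (seq ε n) h (≤-<-trans (≤∣∣ (seq ε m - seq ε n))
        (proj₂ (cauchy ε h (0<* 0<η (positive⁻¹ ½))) m n N≤m N≤n))
      -- Integrality supplies the gap: a failing degree inequality means `2 Q d + 1 ≤ (Q + 2) g`,
      -- and dividing by `2 Q` leaves `t / 2` with `t = 1 / Q`.
      deficit : ι d + t * ½ ≤ (½ + t) * ι g
      deficit = begin
        ι d + t * ½                                   ≡⟨ cong (_+ t * ½) (trans (cong (_* ι d) Qt≡1) (*-identityˡ (ι d))) ⟨
        ι Q * t * ι d + t * ½                         ≡⟨ solve 3 (λ q t d → q :* t :* d :+ t :* con ½ := (con (ι 2) :* q :* d :+ con 1ℚ) :* (t :* con ½)) refl (ι Q) t (ι d) ⟩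
        (ι 2 * ι Q * ι d + 1ℚ) * (t * ½)              ≡⟨ cong (λ x → (x + 1ℚ) * (t * ½)) (trans (ι-* (2 ℕ.* Q) d) (cong (_* ι d) (ι-* 2 Q))) ⟨
        (ι (2 ℕ.* Q ℕ.* d) + ι 1) * (t * ½)           ≡⟨ cong (_* (t * ½)) (ι-+ (2 ℕ.* Q ℕ.* d) 1) ⟨
        ι (2 ℕ.* Q ℕ.* d ℕ.+ 1) * (t * ½)             ≤⟨ *-monoʳ-≤-nonNeg (t * ½) {{nonNegative (<⇒≤ (0<* 0<t (positive⁻¹ ½)))}}
                                                           (ι-mono (ℕ.≤-trans (ℕ.≤-reflexive (ℕ.+-comm (2 ℕ.* Q ℕ.* d) 1)) short)) ⟩
        ι ((Q ℕ.+ 2) ℕ.* g) * (t * ½)                 ≡⟨ cong (_* (t * ½)) (trans (ι-* (Q ℕ.+ 2) g) (cong (_* ι g) (ι-+ Q 2))) ⟩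
        (ι Q + ι 2) * ι g * (t * ½)                   ≡⟨ solve 3 (λ q t g → (q :+ con (ι 2)) :* g :* (t :* con ½) := (con ½ :* (q :* t) :+ t) :* g) refl (ι Q) t (ι g) ⟩
        (½ * (ι Q * t) + t) * ι g                     ≡⟨ cong (λ x → (½ * x + t) * ι g) Qt≡1 ⟩
        (½ * 1ℚ + t) * ι g                            ≡⟨⟩
        (½ + t) * ι g                                 ∎
      ug≤1 : ι g * u ≤ 1ℚ
      ug≤1 = ≤-trans (*-monoʳ-≤-nonNeg u {{nonNegative (<⇒≤ 0<u)}} (ι-mono (ℕ.n≤1+n g)))
        (≤-reflexive (proj₂ (proj₂ (inverse (ι-pos (s≤s (z≤n {g})))))))
      ηg≤ : ι g * η ≤ t * ¼
      ηg≤ = begin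
        ι g * (t * ¼ * u)     ≡⟨ solve 3 (λ g c u → g :* (c :* u) := c :* (g :* u)) refl (ι g) (t * ¼) u ⟩
        t * ¼ * (ι g * u)     ≤⟨ *-monoˡ-≤-nonNeg (t * ¼) {{nonNegative (<⇒≤ 0<t¼)}} ug≤1 ⟩
        t * ¼ * 1ℚ            ≡⟨ *-identityʳ (t * ¼) ⟩
        t * ¼                 ∎
      near-or-above : t - h ≤ seq ε N → ∀ n → N ℕ.≤ n → ι d + t * ¼ ≤ (½ + seq ε n) * ι g
      near-or-above above n N≤n = begin
        ι d + t * ¼                                   ≡⟨ solve 2 (λ d t → d :+ t :* con ¼ := (d :+ t :* con ½) :- t :* con ¼) refl (ι d) t ⟩
        (ι d + t * ½) - t * ¼                         ≤⟨ +-mono-≤ deficit (neg-antimono-≤ ηg≤) ⟩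
        (½ + t) * ι g - ι g * η                       ≡⟨ solve 3 (λ t g η → (con ½ :+ t) :* g :- g :* η := (con ½ :+ (t :- η)) :* g) refl t (ι g) η ⟩
        (½ + (t - η)) * ι g                           ≤⟨ *-monoʳ-≤-nonNeg (ι g) {{nonNegative (0≤ι g)}} (+-monoʳ-≤ ½ (begin
          t - η                   ≡⟨ solve 2 (λ t η → t :- η := (t :- η :* con ½) :- η :* con ½) refl t η ⟩
          (t - h) - h             ≤⟨ +-monoˡ-≤ (- h) (≤-trans above (<⇒≤ (close N n ℕ.≤-refl N≤n))) ⟩
          (h + seq ε n) - h       ≡⟨ solve 2 (λ h e → (h :+ e) :- h := e) refl h (seq ε n) ⟩
          seq ε n                 ∎)) ⟩
        (½ + seq ε n) * ι g                           ∎
      -- One rational comparison decides. If the term at `N` is at least `t - h`, all later terms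
      -- are at least `t - η` and the degree condition on `d` fails; if not, all later terms are at
      -- most `t`, contrary to `not-eventually-small`.
      contradiction : Dec (t - h ≤ seq ε N) → ¬ (((fromℚ ½ +ᴿ ε) *ᴿ fromℕ g) ≤ᴿ fromℕ d)
      contradiction (yes above) le = le (t * ¼ , 0<t¼ , N , near-or-above above)
      contradiction (no ¬above) _ = not-eventually-small N λ n N≤n → begin
        seq ε n                   ≤⟨ <⇒≤ (close n N N≤n ℕ.≤-refl) ⟩
        h + seq ε N               ≤⟨ +-monoʳ-≤ h (<⇒≤ (≰⇒> ¬above)) ⟩
        h + (t - h)               ≡⟨ solve 2 (λ h t → h :+ (t :- h) := t) refl h t ⟩
        t                         ∎

    -- Up to the precision needed here ε ≥ 1/Q, since otherwise ε⁻¹²¹ ≥ Q¹²¹ > K.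
    degree-bound : ∀ g d → ((fromℚ ½ +ᴿ ε) *ᴿ fromℕ g) ≤ᴿ fromℕ d → (Q ℕ.+ 2) ℕ.* g ℕ.≤ 2 ℕ.* Q ℕ.* d
    degree-bound g d le = ℕ.≮⇒≥ λ short → Short.contradiction g d short (_ ≤? _) le

-- Degrees and windows in powers of cycles

module Degrees where

  open import Data.Bool using (Bool; true; false; _∧_; not)
  open import Data.Empty using (⊥-elim)
  open import Data.Fin as Fin using (Fin; toℕ; fromℕ<)
  import Data.Fin.Properties as Fin
  open import Data.List using (length; filter; tabulate)
  open import Data.Nat
  open import Data.Nat.DivMod
  open import Data.Nat.Properties
  open import Data.Nat.Tactic.RingSolver using (solve-∀)
  open import Data.Product using (∃-syntax; _×_; _,_; proj₁; proj₂)
  open import Data.Sum using (_⊎_; inj₁; inj₂)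
  open import Relation.Binary.PropositionalEquality
  open import Relation.Nullary using (Dec; yes; no)
  open import Relation.Nullary.Decidable using (⌊_⌋)
  open import Defs using (Graph; Adj; adj?; symm; irrefl; degree; IsSubgraph; Walk; []; _∷_; DistAtMost; power; Next; cycle)
  open Sums
  open Hall using (_==_; ==-refl; ==⇒≡; ≢⇒==false; count-≤-injection)
  open CircleHall using (count; periodic-⟦⟧)
  open Layout using ([m%d+n]%d)

  ⌊⌋-true : ∀ {P : Set} (d : Dec P) → P → ⌊ d ⌋ ≡ true
  ⌊⌋-true (yes _) p = refl
  ⌊⌋-true (no ¬p) p = ⊥-elim (¬p p)

  ⌊⌋-true⁻ : ∀ {P : Set} (d : Dec P) → ⌊ d ⌋ ≡ true → P
  ⌊⌋-true⁻ (yes p) _ = p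

  length-filter-tabulate : ∀ {A : Set} {P : A → Set} (P? : ∀ x → Dec (P x)) m (f : Fin m → A) (g : ℕ → ℕ) →
    (∀ i → g (toℕ i) ≡ ⟦ ⌊ P? (f i) ⌋ ⟧) → length (filter P? (tabulate f)) ≡ ∑ m g
  length-filter-tabulate P? zero    f g eq = refl
  length-filter-tabulate P? (suc m) f g eq with P? (f Fin.zero) | eq Fin.zero | length-filter-tabulate P? m (λ i → f (Fin.suc i)) (λ i → g (suc i)) (λ i → eq (Fin.suc i))
  ... | yes _ | g0 | rest = trans (cong₂ _+_ (sym g0) rest) (sym (∑-split 1 m g))
  ... | no  _ | g0 | rest = trans (cong₂ _+_ (sym g0) rest) (sym (∑-split 1 m g))

  module Vertices (n : ℕ) .{{_ : NonZero n}} where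

    vertex : ℕ → Fin n
    vertex x = fromℕ< (m%n<n x n)

    toℕ-vertex : ∀ x → toℕ (vertex x) ≡ x % n
    toℕ-vertex x = Fin.toℕ-fromℕ< (m%n<n x n)

    vertex-cong : ∀ {x y} → x % n ≡ y % n → vertex x ≡ vertex y
    vertex-cong {x} {y} eq = Fin.toℕ-injective (trans (toℕ-vertex x) (trans eq (sym (toℕ-vertex y))))

    vertex-toℕ : ∀ v → vertex (toℕ v) ≡ v
    vertex-toℕ v = Fin.toℕ-injective (trans (toℕ-vertex (toℕ v)) (m<n⇒m%n≡m (Fin.toℕ<n v)))

    vertex-periodic : Periodic n vertex
    vertex-periodic x = vertex-cong ([m+n]%n≡m%n x n)

    %-shift-cancel : ∀ y {i j} → i < n → j < n → (y + i) % n ≡ (y + j) % n → i ≡ j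
    %-shift-cancel y {i} {j} i<n j<n eq = trans (sym (undo i<n)) (trans (cong (λ z → (z + (n ∸ y % n)) % n) eq) (undo j<n))
      where
      undo : ∀ {i} → i < n → ((y + i) % n + (n ∸ y % n)) % n ≡ i
      undo {i} i<n = begin
        ((y + i) % n + (n ∸ y % n)) % n                    ≡⟨ [m%d+n]%d (y + i) (n ∸ y % n) n ⟩
        (y + i + (n ∸ y % n)) % n                          ≡⟨ cong (λ z → (z + i + (n ∸ y % n)) % n) (m≡m%n+[m/n]*n y n) ⟩
        (y % n + y / n * n + i + (n ∸ y % n)) % n          ≡⟨ cong (_% n) (regroup (y % n) (y / n * n) i (n ∸ y % n)) ⟩
        (i + (y % n + (n ∸ y % n)) + y / n * n) % n        ≡⟨ cong (λ z → (i + z + y / n * n) % n) (m+[n∸m]≡n (<⇒≤ (m%n<n y n))) ⟩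
        (i + n + y / n * n) % n                            ≡⟨ [m+kn]%n≡m%n (i + n) (y / n) n ⟩
        (i + n) % n                                        ≡⟨ [m+n]%n≡m%n i n ⟩
        i % n                                              ≡⟨ m<n⇒m%n≡m i<n ⟩
        i                                                  ∎
        where
        open ≡-Reasoning
        regroup : ∀ a b i c → a + b + i + c ≡ i + (a + c) + b
        regroup = solve-∀

    adjacent : Graph n → ℕ → ℕ → Bool
    adjacent G x y = ⌊ adj? G (vertex x) (vertex y) ⌋

    module _ (G : Graph n) where

      adjacent-periodicˡ : ∀ y → Periodic n (λ x → adjacent G x y)
      adjacent-periodicˡ y x = cong (λ v → ⌊ adj? G v (vertex y) ⌋) (vertex-periodic x)

      adjacent-periodicʳ : ∀ x → Periodic n (adjacent G x)
      adjacent-periodicʳ x y = cong (λ v → ⌊ adj? G (vertex x) v ⌋) (vertex-periodic y)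

      adjacent-sym : ∀ x y → adjacent G x y ≡ adjacent G y x
      adjacent-sym x y with adj? G (vertex x) (vertex y) | adj? G (vertex y) (vertex x)
      ... | yes _ | yes _ = refl
      ... | no  _ | no  _ = refl
      ... | yes a | no ¬a = ⊥-elim (¬a (symm G a))
      ... | no ¬a | yes a = ⊥-elim (¬a (symm G a))

      degree-sum : ∀ x → degree G (vertex x) ≡ count (adjacent G x) n
      degree-sum x = length-filter-tabulate (adj? G (vertex x)) n (λ i → i) (λ i → ⟦ adjacent G x i ⟧)
        λ i → cong (λ v → ⟦ ⌊ adj? G (vertex x) v ⌋ ⟧) (vertex-toℕ i)

      degree-window : ∀ x y → degree G (vertex x) ≡ count (λ j → adjacent G x (y + j)) n
      degree-window x y = trans (degree-sum x) (sym (∑-rotate (periodic-⟦⟧ (adjacent-periodicʳ x)) y))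

      degree<n : ∀ x → degree G (vertex x) + 1 ≤ n
      degree<n x = begin
        degree G (vertex x) + 1
          ≡⟨ cong₂ _+_ (degree-sum x) (sym one) ⟩
        count (adjacent G x) n + count (λ i → i == x % n) n
          ≡⟨ ∑-+ n _ _ ⟨
        ∑ n (λ i → ⟦ adjacent G x i ⟧ + ⟦ i == x % n ⟧)
          ≤⟨ ∑-mono n (λ i i<n → pointwise i i<n (i ≟ x % n)) ⟩
        ∑ n (λ _ → 1)
          ≡⟨ trans (∑-const n 1) (*-identityʳ n) ⟩
        n ∎
        where
        open ≤-Reasoning
        one : count (λ i → i == x % n) n ≡ 1
        one = trans (∑-single n _ (m%n<n x n) λ i _ i≢ → cong ⟦_⟧ (≢⇒==false i≢)) (cong ⟦_⟧ (==-refl (x % n)))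
        no-loop : ∀ i → i < n → i ≡ x % n → adjacent G x i ≡ false
        no-loop i i<n eq with adj? G (vertex x) (vertex i)
        ... | no _  = refl
        ... | yes a = ⊥-elim (irrefl G (subst (Adj G (vertex x)) (vertex-cong (trans (m<n⇒m%n≡m i<n) eq)) a))
        pointwise : ∀ i → i < n → Dec (i ≡ x % n) → ⟦ adjacent G x i ⟧ + ⟦ i == x % n ⟧ ≤ 1
        pointwise i i<n (yes eq) = ≤-trans (≤-reflexive (cong (λ b → ⟦ b ⟧ + ⟦ i == x % n ⟧) (no-loop i i<n eq))) (⟦⟧≤1 (i == x % n))
        pointwise i i<n (no ne)  = ≤-trans (≤-reflexive (trans (cong (λ b → ⟦ adjacent G x i ⟧ + ⟦ b ⟧) (≢⇒==false ne)) (+-identityʳ _))) (⟦⟧≤1 (adjacent G x i))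

    module CyclePower (2≤n : 2 ≤ n) (K : ℕ) where

      G : Graph n
      G = power (cycle n) K

      successor : ∀ a → Next (vertex a) (vertex (suc a))
      successor a with suc (a % n) ≟ n
      ... | yes eq = inj₂ (trans (cong suc (toℕ-vertex a)) eq , trans (toℕ-vertex (suc a)) (trans wrap (trans (cong (_% n) eq) (n%n≡0 n))))
        where
        wrap : suc a % n ≡ suc (a % n) % n
        wrap = trans (cong (_% n) (+-comm 1 a)) (trans (sym ([m%d+n]%d a 1 n)) (cong (_% n) (+-comm (a % n) 1)))
      ... | no ne = inj₁ (trans (toℕ-vertex (suc a)) (trans (trans (cong (_% n) (+-comm 1 a)) (trans (sym ([m%d+n]%d a 1 n)) (cong (_% n) (+-comm (a % n) 1))))
              (trans (m<n⇒m%n≡m (≤∧≢⇒< (m%n<n a n) ne)) (cong suc (sym (toℕ-vertex a))))))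

      distinct : ∀ y {i j} → i < n → j < n → i ≢ j → vertex (y + i) ≢ vertex (y + j)
      distinct y i<n j<n i≢j eq = i≢j (%-shift-cancel y i<n j<n (trans (sym (toℕ-vertex _)) (trans (cong toℕ eq) (toℕ-vertex _))))

      step : ∀ a → Adj (cycle n) (vertex a) (vertex (suc a))
      step a = subst₂ (λ x y → vertex x ≢ vertex y) (+-identityʳ a) (+-comm a 1)
        (distinct a (≤-trans (s≤s z≤n) 2≤n) 2≤n λ ()) , inj₁ (successor a)

      path : ∀ a l → Walk (cycle n) l (vertex a) (vertex (a + l))
      path a zero    = subst (λ x → Walk (cycle n) 0 (vertex a) (vertex x)) (sym (+-identityʳ a)) []
      path a (suc l) = step a ∷ subst (λ x → Walk (cycle n) l (vertex (suc a)) (vertex x)) (sym (+-suc a l)) (path (suc a) l)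

      window-adjacent : ∀ k y j → k ≤ K → k + suc k ≤ n → j < k + suc k → j ≢ k → Adj G (vertex (y + k)) (vertex (y + j))
      window-adjacent k y j k≤K w≤n j<w j≢k = towards (≤-total k j)
        where
        k<n : k < n
        k<n = ≤-trans (m≤n+m (suc k) k) w≤n
        j<n : j < n
        j<n = <-≤-trans j<w w≤n
        reach : ∀ {a b} → a ≤ b → b ∸ a ≤ K → DistAtMost (cycle n) K (vertex (y + a)) (vertex (y + b))
        reach {a} {b} a≤b l≤K = b ∸ a , l≤K , subst (λ x → Walk (cycle n) (b ∸ a) (vertex (y + a)) (vertex x))
          (trans (+-assoc y a (b ∸ a)) (cong (y +_) (m+[n∸m]≡n a≤b))) (path (y + a) (b ∸ a))
        towards : k ≤ j ⊎ j ≤ k → Adj G (vertex (y + k)) (vertex (y + j))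
        towards (inj₁ k≤j) = distinct y k<n j<n (λ e → j≢k (sym e)) , reach k≤j
          (≤-trans (m≤n+o⇒m∸n≤o j k (s≤s⁻¹ (≤-trans j<w (≤-reflexive (+-suc k k))))) k≤K)
        towards (inj₂ j≤k) = symm G (distinct y j<n k<n j≢k , reach j≤k (≤-trans (m∸n≤m k j) k≤K))

      _≈_ : ℕ → ℕ → Set
      a ≈ b = a % n ≡ b % n

      ≈-+ : ∀ {a b} c → a ≈ b → (a + c) ≈ (b + c)
      ≈-+ {a} {b} c eq = trans (sym ([m%d+n]%d a c n)) (trans (cong (λ z → (z + c) % n) eq) ([m%d+n]%d b c n))

      next-offset : ∀ {u v : Fin n} → Next u v → toℕ v ≈ (toℕ u + 1)
      next-offset {u} (inj₁ eq)        = cong (_% n) (trans eq (+-comm 1 (toℕ u)))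
      next-offset {u} (inj₂ (eq , z)) = trans (cong (_% n) z) (trans (m<n⇒m%n≡m (≤-trans (s≤s z≤n) 2≤n))
        (sym (trans (cong (_% n) (trans (+-comm (toℕ u) 1) eq)) (n%n≡0 n))))

      -- The displacement of a walk of length `l` is recorded as `j - l`, so as to remain in the
      -- natural numbers: a step forwards adds 2 to `j`, a step backwards adds nothing.
      walk-offset : ∀ {l u v} → Walk (cycle n) l u v → ∃[ j ] j ≤ l + l × (toℕ v + l) ≈ (toℕ u + j)
      walk-offset {u = u} [] = 0 , z≤n , refl
      walk-offset {suc l} {u} {v} (_∷_ {v = x} (_ , nx) p) with walk-offset p
      ... | j , j≤ , eq = extend nx
        where
        shifted : (toℕ v + suc l) ≈ (toℕ x + j + 1)
        shifted = trans (cong (_% n) (trans (+-suc (toℕ v) l) (+-comm 1 (toℕ v + l)))) (≈-+ {toℕ v + l} 1 eq)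
        extend : Next u x ⊎ Next x u → ∃[ j ] j ≤ suc l + suc l × (toℕ v + suc l) ≈ (toℕ u + j)
        extend (inj₁ up) = suc (suc j) , ≤-trans (s≤s (s≤s j≤)) (≤-reflexive (cong suc (sym (+-suc l l)))) ,
          trans shifted (trans (cong (_% n) (+-swapʳ (toℕ x) j 1)) (trans (≈-+ {toℕ x + 1} j (≈-+ {toℕ x} 1 (next-offset up)))
            (cong (_% n) (trans (cong (_+ j) (trans (+-assoc (toℕ u) 1 1) refl)) (+-assoc (toℕ u) 2 j)))))
        extend (inj₂ down) = j , ≤-trans j≤ (≤-trans (+-mono-≤ (n≤1+n l) (n≤1+n l)) ≤-refl) ,
          trans shifted (trans (cong (_% n) (+-swapʳ (toℕ x) j 1)) (≈-+ {toℕ x + 1} j (sym (next-offset down))))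

      -- Adding `K ∸ l` to the offset makes walks of all lengths up to `K` refer to the same origin,
      -- `K` places before `u`.
      near-offset : ∀ {u v} → K ≤ n → Adj G u v → ∃[ j ] j < K + suc K × (toℕ u + (n ∸ K) + j) % n ≡ toℕ v
      near-offset {u} {v} K≤n (_ , l , l≤K , p) with walk-offset p
      ... | j , j≤ , eq = j + (K ∸ l) , bound , (begin
        (toℕ u + (n ∸ K) + (j + (K ∸ l))) % n       ≡⟨ cong (_% n) (regroup (toℕ u) (n ∸ K) j (K ∸ l)) ⟩
        (toℕ u + j + (K ∸ l + (n ∸ K))) % n         ≡⟨ ≈-+ {toℕ v + l} (K ∸ l + (n ∸ K)) eq ⟨
        (toℕ v + l + (K ∸ l + (n ∸ K))) % n         ≡⟨ cong (_% n) (trans (+-assoc (toℕ v) l _) (cong (toℕ v +_) whole)) ⟩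
        (toℕ v + n) % n                             ≡⟨ [m+n]%n≡m%n (toℕ v) n ⟩
        toℕ v % n                                   ≡⟨ m<n⇒m%n≡m (Fin.toℕ<n v) ⟩
        toℕ v                                       ∎)
        where
        open ≡-Reasoning
        bound : j + (K ∸ l) < K + suc K
        bound = ≤-trans (s≤s (≤-trans (+-monoˡ-≤ (K ∸ l) j≤) (≤-trans (≤-reflexive (trans (+-assoc l l (K ∸ l)) (cong (l +_) (m+[n∸m]≡n l≤K)))) (+-monoˡ-≤ K l≤K))))
          (≤-reflexive (sym (+-suc K K)))
        whole : l + (K ∸ l + (n ∸ K)) ≡ n
        whole = trans (sym (+-assoc l (K ∸ l) (n ∸ K))) (trans (cong (_+ (n ∸ K)) (m+[n∸m]≡n l≤K)) (m+[n∸m]≡n K≤n))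
        regroup : ∀ a b c d → a + b + (c + d) ≡ a + c + (d + b)
        regroup a b c d = trans (interchange a b c d) (cong (a + c +_) (+-comm b d))

      degree-power : K ≤ n → ∀ x → degree G (vertex x) ≤ K + suc K
      degree-power K≤n x = ≤-trans (≤-reflexive (degree-sum G x)) (≤-trans
        (count-≤-injection (K + suc K) n (λ _ → true) (adjacent G x) index
          (λ y y<n e → proj₁ (spec y y<n e) , refl)
          (λ y y′ y<n y′<n e e′ eq → trans (sym (proj₂ (spec y y<n e)))
            (trans (cong (λ j → (toℕ (vertex x) + (n ∸ K) + j) % n) eq) (proj₂ (spec y′ y′<n e′)))))
        (≤-reflexive (trans (∑-const (K + suc K) 1) (*-identityʳ (K + suc K)))))
        where
        index : ℕ → ℕ
        index y = find< (K + suc K) λ j → (toℕ (vertex x) + (n ∸ K) + j) % n == y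
        spec : ∀ y → y < n → adjacent G x y ≡ true → index y < K + suc K × (toℕ (vertex x) + (n ∸ K) + index y) % n ≡ y
        spec y y<n e with near-offset K≤n (⌊⌋-true⁻ (adj? G (vertex x) (vertex y)) e)
        ... | j , j< , eq with find<-spec (K + suc K) {λ j → (toℕ (vertex x) + (n ∸ K) + j) % n == y} (any<-intro (K + suc K) j<
                (trans (cong (_== y) (trans eq (trans (toℕ-vertex y) (m<n⇒m%n≡m y<n)))) (==-refl y)))
        ...   | f< , fe = f< , ==⇒≡ fe

      -- Inside the window every vertex but the centre is a neighbour in `G`; outside it, neighbours
      -- in `H` are neighbours in `G`. The centre accounts for the 1.
      non-neighbours : ∀ (H : Graph n) → IsSubgraph H G → ∀ k y → k ≤ K → k + suc k ≤ n →
        count (λ j → not (adjacent H (y + k) (y + j))) (k + suc k) + degree H (vertex (y + k)) ≤ 1 + degree G (vertex (y + k))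
      non-neighbours H H⊆G k y k≤K w≤n with m≤n⇒∃[o]m+o≡n w≤n
      ... | o , w+o≡n = begin
        count (λ j → not (h j)) w + degree H (vertex (y + k))
          ≡⟨ cong (count (λ j → not (h j)) w +_) (trans (degree-window H (y + k) y) (trans (cong (count h) (sym w+o≡n)) (∑-split w o (λ j → ⟦ h j ⟧)))) ⟩
        count (λ j → not (h j)) w + (count h w + ∑ o (λ j → ⟦ h (w + j) ⟧))
          ≡⟨ +-assoc (count (λ j → not (h j)) w) (count h w) _ ⟨
        count (λ j → not (h j)) w + count h w + ∑ o (λ j → ⟦ h (w + j) ⟧)
          ≡⟨ cong (_+ ∑ o (λ j → ⟦ h (w + j) ⟧)) (∑-+ w _ _) ⟨
        ∑ w (λ j → ⟦ not (h j) ⟧ + ⟦ h j ⟧) + ∑ o (λ j → ⟦ h (w + j) ⟧)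
          ≤⟨ +-mono-≤ (∑-mono w inside) (∑-mono o λ j _ → ⟦⟧-mono (sub (w + j))) ⟩
        ∑ w (λ j → ⟦ j == k ⟧ + ⟦ g j ⟧) + ∑ o (λ j → ⟦ g (w + j) ⟧)
          ≡⟨ cong (_+ ∑ o (λ j → ⟦ g (w + j) ⟧)) (trans (∑-+ w _ _) (cong (_+ count g w) one)) ⟩
        1 + count g w + ∑ o (λ j → ⟦ g (w + j) ⟧)
          ≡⟨ cong suc (trans (sym (∑-split w o (λ j → ⟦ g j ⟧))) (trans (cong (count g) w+o≡n) (sym (degree-window G (y + k) y)))) ⟩
        1 + degree G (vertex (y + k)) ∎
        where
        open ≤-Reasoning
        w : ℕ
        w = k + suc k
        h g : ℕ → Bool
        h j = adjacent H (y + k) (y + j)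
        g j = adjacent G (y + k) (y + j)
        sub : ∀ j → h j ≡ true → g j ≡ true
        sub j e = ⌊⌋-true (adj? G _ _) (H⊆G (⌊⌋-true⁻ (adj? H _ _) e))
        one : count (λ j → j == k) w ≡ 1
        one = trans (∑-single w _ (m≤n+m (suc k) k) λ j _ j≢ → cong ⟦_⟧ (≢⇒==false j≢)) (cong ⟦_⟧ (==-refl k))
        inside : ∀ j → j < w → ⟦ not (h j) ⟧ + ⟦ h j ⟧ ≤ ⟦ j == k ⟧ + ⟦ g j ⟧
        inside j j<w = ≤-trans (≤-reflexive (trans (+-comm ⟦ not (h j) ⟧ _) (⟦⟧-not (h j)))) (cases (j ≟ k))
          where
          cases : Dec (j ≡ k) → 1 ≤ ⟦ j == k ⟧ + ⟦ g j ⟧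
          cases (yes e) = ≤-trans (≤-reflexive (cong ⟦_⟧ (sym (trans (cong (_== k) e) (==-refl k))))) (m≤m+n _ _)
          cases (no ne) = ≤-trans (≤-reflexive (cong ⟦_⟧ (sym (⌊⌋-true (adj? G (vertex (y + k)) (vertex (y + j))) (window-adjacent k y j k≤K w≤n j<w ne))))) (m≤n+m _ _)

-- Parameters, and the Hamilton cycle from the orbit

module Reduction where

  open import Data.Bool using (true; not)
  open import Data.Fin as Fin using (Fin; toℕ)
  open import Data.Fin.Permutation using (Permutation′; permutation; _⟨$⟩ʳ_)
  import Data.Fin.Properties as Fin
  open import Data.List using (_∷_; [])
  open import Data.Nat
  open import Data.Nat.DivMod
  open import Data.Nat.Properties
  open import Data.Nat.Tactic.RingSolver using (solve)
  open import Data.Product using (∃-syntax; _×_; _,_; proj₁; proj₂)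
  open import Data.Sum using (_⊎_; inj₁; inj₂)
  open import Relation.Binary.PropositionalEquality
  open import Relation.Nullary using (yes; no)
  open import Defs using (Graph; Adj; adj?; symm; degree; IsSubgraph; power; Next; cycle; Hamiltonian)
  open Sums
  open CircleHall using (count)
  open Classes using (Setting)
  open Merge
  open Finish
  open Degrees

  root : ∀ e → .{{_ : NonZero e}} → ∀ K → ∃[ Q ] Q ^ e ≤ K × K < suc Q ^ e
  root e zero = 0 , ≤-reflexive (zero^ e) , ≤-reflexive (sym (^-zeroˡ e))
    where
    zero^ : ∀ e → .{{_ : NonZero e}} → 0 ^ e ≡ 0
    zero^ (suc e) = refl
  root e (suc K) with root e K
  ... | Q , Q^e≤K , K<Q′^e with suc K <? suc Q ^ e
  ...   | yes lt = Q , m≤n⇒m≤1+n Q^e≤K , lt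
  ...   | no ¬lt = suc Q , ≮⇒≥ ¬lt , ≤-<-trans K<Q′^e (^-monoˡ-< e (n<1+n (suc Q)))

  module FromSetting (S : Setting) where

    open Setting S using (n; n≢0; adj)
    open Permutes n
    open Vertices n

    module _ (3≤n : 3 ≤ n) (H : Graph n) (adj≡ : ∀ x y → adj x y ≡ true → Adj H (vertex x) (vertex y))
      (τ : ℕ → ℕ) (τ-perm : Perm τ) (v : ℕ) (v<n : v < n) (τ-adj : ∀ x → x < n → adj x (τ x) ≡ true)
      (all : ∀ {x} → x < n → Reach τ v x) where

      open SingleOrbit τ-perm v v<n all

      private
        at : ℕ → ℕ
        at i = iter τ i v

        at< : ∀ i → at i < n
        at< i = iter< τ-perm i v<n

        to from : Fin n → Fin n
        to i = vertex (at (toℕ i))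
        from x = vertex (position (toℕ x))

        to-from : ∀ x → to (from x) ≡ x
        to-from x = trans (cong vertex (trans (cong at (trans (toℕ-vertex _) (m<n⇒m%n≡m (proj₁ (position-spec (Fin.toℕ<n x))))))
          (proj₂ (position-spec (Fin.toℕ<n x))))) (vertex-toℕ x)

        from-to : ∀ i → from (to i) ≡ i
        from-to i = trans (cong vertex (trans (cong position (trans (toℕ-vertex _) (m<n⇒m%n≡m (at< (toℕ i)))))
          (iterates-distinct (proj₁ spec) (Fin.toℕ<n i) (proj₂ spec)))) (vertex-toℕ i)
          where
          spec = position-spec (at< (toℕ i))

        π : Permutation′ n
        π = permutation to from to-from from-to

        τ-edge : ∀ i → Adj H (vertex (at i)) (vertex (at (suc i)))
        τ-edge i = subst (λ x → Adj H (vertex (at i)) (vertex x)) (sym (iter-suc τ i v)) (adj≡ _ _ (τ-adj (at i) (at< i)))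

        next-edge : ∀ i j → Next i j → Adj H (π ⟨$⟩ʳ i) (π ⟨$⟩ʳ j)
        next-edge i j (inj₁ eq)       = subst (λ x → Adj H (to i) (vertex (at x))) (sym eq) (τ-edge (toℕ i))
        -- The closing edge: by `order`, the iterate with index `n` is the starting vertex again.
        next-edge i j (inj₂ (eq , z)) = subst (λ x → Adj H (to i) (vertex x))
          (trans (cong at eq) (trans order (cong at (sym z)))) (τ-edge (toℕ i))

      hamiltonian : Hamiltonian H
      hamiltonian = 3≤n , π , λ where
        i j (_ , inj₁ next) → next-edge i j next
        i j (_ , inj₂ next) → symm H (next-edge j i next)

  -- One factor `m` cancels, so a lower bound on `m` remains; its constant 2560 · 1024 is 64 · 4⁴ ·
  -- 40 · 4.
  spread-bound : ∀ Q P m → 2560 * 1024 * (Q * Q * Q * Q * Q) * (P * P) ≤ m →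
    64 * (4 * Q * (4 * Q) * (4 * Q * (4 * Q))) * (40 * (4 * Q) * (m * P) * P) ≤ m * m
  spread-bound Q P m h = ≤-trans (≤-reflexive (regroup 64 4 40 Q m P)) (*-monoˡ-≤ m h)
    where
    regroup : ∀ a b c Q m P → a * (b * Q * (b * Q) * (b * Q * (b * Q))) * (c * (b * Q) * (m * P) * P) ≡
      a * (b * b * b * b) * (c * b) * (Q * Q * Q * Q * Q) * (P * P) * m
    regroup a b c Q m P = solve (a ∷ b ∷ c ∷ Q ∷ m ∷ P ∷ [])

  module Parameters (n K Q : ℕ) .{{_ : NonZero n}} (K≤n : K ≤ n) (Q-large : 2 ^ 20 ≤ Q) (Q^20≤K : Q ^ 20 ≤ K)
    (H : Graph n) (H⊆G : IsSubgraph H (power (cycle n) K))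
    (degree-bound : ∀ v → (Q + 2) * degree (power (cycle n) K) v ≤ 2 * Q * degree H v) where

    open Vertices n

    2^20 : ℕ
    2^20 = 1048576

    at-most : ∀ c d → c + d ≡ 2^20 → c ≤ Q
    at-most c d eq = ≤-trans (≤-trans (m≤m+n c d) (≤-reflexive eq)) Q-large

    1≤Q : 1 ≤ Q
    1≤Q = at-most 1 1048575 refl

    -- The degree condition leaves a surplus of about `2 k / Q` in the window. The choice
    -- `q = 4 * Q` makes `64 * s` equal to `k / Q`, half of it; the other half absorbs the rounding
    -- of the radius. The radius belonging to `m′ = 1` is `unit`.
    q h M P unit : ℕ
    q = 4 * Q
    h = 3 * q + 7
    M = 64 * q
    P = h * M + 1 + h
    unit = 16 * q * (M * P)

    P≤ : P ≤ Q ^ 3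
    P≤ = ≤-trans (bound Q 1≤Q) (≤-trans (*-monoˡ-≤ (Q * Q) (at-most 4884 1043692 refl)) (≤-reflexive (cong (λ x → Q * (Q * x)) (sym (*-identityʳ Q)))))
      where
      bound : ∀ Q → 1 ≤ Q → (3 * (4 * Q) + 7) * (64 * (4 * Q)) + 1 + (3 * (4 * Q) + 7) ≤ 4884 * (Q * Q)
      bound Q h = certify 0 (1804 ⊗ (Q ⊗ h) ⊕ 8 ⊗ h ⊕ 8 ⊗ (Q ⊗ h)) (solve (Q ∷ []))

    pow : ∀ a b → Q ^ a * Q ^ b ≡ Q ^ (a + b)
    pow a b = sym (^-distribˡ-+-* Q a b)

    instance
      Q-nonZero : NonZero Q
      Q-nonZero = >-nonZero 1≤Q

      q-nonZero : NonZero q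
      q-nonZero = m*n≢0 4 Q

      P-nonZero : NonZero P
      P-nonZero = >-nonZero (≤-trans (≤-trans (m≤n+m 1 (h * M)) (m≤m+n (h * M + 1) h)) ≤-refl)

      M-nonZero : NonZero M
      M-nonZero = m*n≢0 64 q

      unit-nonZero : NonZero unit
      unit-nonZero = m*n≢0 (16 * q) (M * P) {{m*n≢0 16 q}} {{m*n≢0 M P}}

    unit≤ : unit ≤ Q ^ 6
    unit≤ = begin
      unit                              ≡⟨ expand Q P ⟩
      16384 * (Q * Q) * P               ≤⟨ *-mono-≤ (*-monoˡ-≤ (Q * Q) (at-most 16384 1032192 refl)) P≤ ⟩
      Q * (Q * Q) * Q ^ 3               ≡⟨ cong (λ x → Q * (Q * x) * Q ^ 3) (*-identityʳ Q) ⟨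
      Q ^ 3 * Q ^ 3                     ≡⟨ pow 3 3 ⟩
      Q ^ 6                             ∎
      where
      open ≤-Reasoning
      expand : ∀ Q P → 16 * (4 * Q) * (64 * (4 * Q) * P) ≡ 16384 * (Q * Q) * P
      expand Q P = solve (Q ∷ P ∷ [])

    -- The largest radius up to `K` whose window fits into the circle is `k₁`; rounded down to a
    -- multiple of `unit`, it becomes `k`.
    k₁ m′ m s k : ℕ
    k₁ = K ⊓ ((n ∸ 1) / 2)
    m′ = k₁ / unit
    m = m′ * M
    s = m * P
    k = 16 * q * s

    1≤n : 1 ≤ n
    1≤n = >-nonZero⁻¹ n

    half-bounds : 2 * ((n ∸ 1) / 2) + 1 ≤ n × n ≤ 2 * ((n ∸ 1) / 2) + 2
    half-bounds = ≤-trans (+-monoˡ-≤ 1 (≤-trans (≤-reflexive (*-comm 2 ((n ∸ 1) / 2))) (m/n*n≤m (n ∸ 1) 2))) (≤-reflexive n≡) ,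
      ≤-trans (≤-reflexive (sym n≡)) (≤-trans (+-monoˡ-≤ 1 (≤-trans (≤-reflexive (m≡m%n+[m/n]*n (n ∸ 1) 2))
        (+-mono-≤ (s≤s⁻¹ (m%n<n (n ∸ 1) 2)) (≤-reflexive (*-comm ((n ∸ 1) / 2) 2))))) (≤-reflexive (reorder ((n ∸ 1) / 2))))
      where
      n≡ : n ∸ 1 + 1 ≡ n
      n≡ = m∸n+n≡m 1≤n
      reorder : ∀ x → 1 + 2 * x + 1 ≡ 2 * x + 2
      reorder x = solve (x ∷ [])

    k₁-large : Q ^ 19 ≤ k₁
    k₁-large = ⊓-glb (≤-trans (^-monoʳ-≤ Q (n≤1+n 19)) Q^20≤K)
      (*-cancelˡ-≤ 2 (+-cancelʳ-≤ 2 _ _ (≤-trans (double (Q ^ 19) Q (m^n>0 Q 19) (at-most 4 1048572 refl))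
        (≤-trans (≤-trans Q^20≤K K≤n) (proj₂ half-bounds)))))
      where
      double : ∀ x Q → 1 ≤ x → 4 ≤ Q → 2 * x + 2 ≤ Q * x
      double x Q h₁ h₂ = ≤-trans (four-times x h₁) (*-monoˡ-≤ x h₂)
        where
        four-times : ∀ x → 1 ≤ x → 2 * x + 2 ≤ 4 * x
        four-times x h = certify 0 (2 ⊗ h) (solve (x ∷ []))

    m′-large : Q ^ 13 ≤ m′
    m′-large = ≤-trans (≤-reflexive (sym (m*n/n≡m (Q ^ 13) unit))) (/-monoˡ-≤ unit
      (≤-trans (*-monoʳ-≤ (Q ^ 13) unit≤) (≤-trans (≤-reflexive (pow 13 6)) k₁-large)))

    instance
      m-nonZero : NonZero m
      m-nonZero = m*n≢0 m′ M {{>-nonZero (≤-trans (m^n>0 Q 13) m′-large)}}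

      s-nonZero : NonZero s
      s-nonZero = m*n≢0 m P

    c : ℕ
    c = n / s

    k≡m′unit : k ≡ m′ * unit
    k≡m′unit = shuffle q m′ M P
      where
      shuffle : ∀ q m′ M P → 16 * q * (m′ * M * P) ≡ m′ * (16 * q * (M * P))
      shuffle q m′ M P = solve (q ∷ m′ ∷ M ∷ P ∷ [])

    k≤k₁ : k ≤ k₁
    k≤k₁ = ≤-trans (≤-reflexive k≡m′unit) (m/n*n≤m k₁ unit)

    k₁≤k+unit : k₁ ≤ k + unit
    k₁≤k+unit = ≤-trans (≤-reflexive (m≡m%n+[m/n]*n k₁ unit)) (≤-trans (≤-reflexive (+-comm (k₁ % unit) (m′ * unit)))
      (+-mono-≤ (≤-reflexive (sym k≡m′unit)) (<⇒≤ (m%n<n k₁ unit))))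

    k≤K : k ≤ K
    k≤K = ≤-trans k≤k₁ (m⊓n≤m K ((n ∸ 1) / 2))

    window≤n : k + suc k ≤ n
    window≤n = ≤-trans (arith k ((n ∸ 1) / 2) (≤-trans k≤k₁ (m⊓n≤n K ((n ∸ 1) / 2)))) (proj₁ half-bounds)
      where
      arith : ∀ k x → k ≤ x → k + suc k ≤ 2 * x + 1
      arith k x h = certify 0 (2 ⊗ h) (solve (k ∷ x ∷ []))

    2≤n : 2 ≤ n
    2≤n = ≤-trans (≤-trans (≤-trans (≤-trans (at-most 2 1048574 refl) (≤-trans (≤-reflexive (sym (*-identityʳ Q)))
      (^-monoʳ-≤ Q {1} {19} (s≤s z≤n)))) k₁-large) (m⊓n≤m K ((n ∸ 1) / 2))) K≤n

    open CyclePower 2≤n K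

    -- If the radius has been cut down to `(n - 1) / 2`, the trivial bound `n - 1` on the degree
    -- takes the place of `degree-power`.
    degree≤ : ∀ x → degree G (vertex x) ≤ k₁ + suc k₁
    degree≤ x = cases (≤-total K ((n ∸ 1) / 2))
      where
      cases : K ≤ (n ∸ 1) / 2 ⊎ (n ∸ 1) / 2 ≤ K → degree G (vertex x) ≤ k₁ + suc k₁
      cases (inj₁ K≤) = subst (λ y → degree G (vertex x) ≤ y + suc y) (sym (m≤n⇒m⊓n≡m K≤)) (degree-power K≤n x)
      cases (inj₂ ≤K) = subst (λ y → degree G (vertex x) ≤ y + suc y) (sym (m≥n⇒m⊓n≡n ≤K))
        (arith (degree G (vertex x)) ((n ∸ 1) / 2) (≤-trans (degree<n G x) (proj₂ half-bounds)))
        where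
        arith : ∀ d y → d + 1 ≤ 2 * y + 2 → d ≤ y + suc y
        arith d y h = certify 0 h (solve (d ∷ y ∷ []))

    dense : ∀ y → count (λ j → not (adjacent H (y + k) (y + j))) (k + suc k) + 64 * s ≤ k
    dense y = *-cancelˡ-≤ (2 * Q) {{m*n≢0 2 Q}} (arith (Q ∸ 2) Q k k₁ unit
      (count (λ j → not (adjacent H (y + k) (y + j))) (k + suc k)) (degree G (vertex (y + k))) (degree H (vertex (y + k))) s
      (sym (m∸n+n≡m (at-most 2 1048574 refl))) k≡64Qs (non-neighbours H H⊆G k y k≤K window≤n) (degree-bound (vertex (y + k)))
      (degree≤ (y + k)) k₁≤k+unit k≤k₁ slack)
      where
      k≡64Qs : k ≡ 64 * Q * s
      k≡64Qs = cong (_* s) (fold Q)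
        where
        fold : ∀ Q → 16 * (4 * Q) ≡ 64 * Q
        fold Q = solve (Q ∷ [])
      slack : 3 * Q + 2 * Q * unit ≤ 2 * k₁
      slack = begin
        3 * Q + 2 * Q * unit        ≤⟨ +-mono-≤ (*-mono-≤ (at-most 3 1048573 refl) (≤-reflexive (sym (*-identityʳ Q)))) (*-monoʳ-≤ (2 * Q) unit≤) ⟩
        Q ^ 2 + 2 * Q * Q ^ 6       ≡⟨ cong (Q ^ 2 +_) (*-assoc 2 Q (Q ^ 6)) ⟩
        Q ^ 2 + 2 * Q ^ 7           ≤⟨ +-mono-≤ (^-monoʳ-≤ Q {2} {8} (s≤s (s≤s z≤n))) (*-monoˡ-≤ (Q ^ 7) (at-most 2 1048574 refl)) ⟩
        Q ^ 8 + Q ^ 8               ≤⟨ +-mono-≤ eight (≤-trans eight (m≤m+n k₁ 0)) ⟩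
        2 * k₁                      ∎
        where
        open ≤-Reasoning
        eight : Q ^ 8 ≤ k₁
        eight = ≤-trans (^-monoʳ-≤ Q {8} {19} (m≤m+n 8 11)) k₁-large
      -- Eliminating both degrees yields `2 Q N ≤ 2 Q k + 2 Q u + 3 Q - 4 k₁ - 2`. Half of `4 k₁`
      -- pays for `2 Q * 64 s = 2 k`, and the other half for `3 Q + 2 Q u`.
      arith : ∀ Q′ Q k k₁ u N dG dH s → Q ≡ Q′ + 2 → k ≡ 64 * Q * s → N + dH ≤ 1 + dG → (Q + 2) * dG ≤ 2 * Q * dH →
        dG ≤ k₁ + suc k₁ → k₁ ≤ k + u → k ≤ k₁ → 3 * Q + 2 * Q * u ≤ 2 * k₁ →
        2 * Q * (N + 64 * s) ≤ 2 * Q * k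
      arith Q′ _ _ k₁ u N dG dH s refl refl h₁ h₂ h₃ h₄ h₅ h₆ = certify 2
        ((2 * (Q′ + 2)) ⊗ h₁ ⊕ h₂ ⊕ Q′ ⊗ h₃ ⊕ (2 * (Q′ + 2)) ⊗ h₄ ⊕ 2 ⊗ h₅ ⊕ h₆)
        (solve (Q′ ∷ k₁ ∷ u ∷ N ∷ dG ∷ dH ∷ s ∷ []))

    spread : 64 * (q * q * (q * q)) * (40 * q * (m * P) * P) ≤ m * m
    spread = spread-bound Q P m (begin
      2560 * 1024 * (Q * Q * Q * Q * Q) * (P * P)    ≤⟨ *-mono-≤ (*-monoˡ-≤ (Q * Q * Q * Q * Q)
                                                          (*-mono-≤ (at-most 2560 1046016 refl) (at-most 1024 1047552 refl))) (*-mono-≤ P≤ P≤) ⟩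
      Q * Q * (Q * Q * Q * Q * Q) * (Q ^ 3 * Q ^ 3)  ≡⟨ cong₂ _*_ (seven Q) (pow 3 3) ⟩
      Q ^ 7 * Q ^ 6                                  ≡⟨ pow 7 6 ⟩
      Q ^ 13                                         ≤⟨ m′-large ⟩
      m′                                             ≤⟨ m≤m*n m′ M ⟩
      m                                              ∎)
      where
      open ≤-Reasoning
      seven : ∀ Q → Q * Q * (Q * Q * Q * Q * Q) ≡ Q * (Q * (Q * (Q * (Q * (Q * (Q * 1))))))
      seven Q = solve (Q ∷ [])

    setting : Setting
    setting = record
      { n≢0 = >-nonZero 1≤n ; n = n ; k = k ; q = q ; P = P ; m = m ; c = c ; h = h ; M = M ; m′ = m′
      ; q-large = ≤-trans (at-most 65536 983040 refl) (m≤n*m Q 4)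
      ; h≡ = refl ; M≡ = refl ; P≡ = refl ; m≡ = refl ; k≡ = refl
      ; window≤n = window≤n
      ; cells≤n = m/n*n≤m n s
      ; n<cells = ≤-trans (s≤s (≤-reflexive (m≡m%n+[m/n]*n n s))) (≤-trans (+-monoˡ-< (c * s) (m%n<n n s)) (≤-reflexive (+-comm s (c * s))))
      ; spread = spread
      ; adj = adjacent H ; perˡ = adjacent-periodicˡ H ; perʳ = adjacent-periodicʳ H ; adj-sym = adjacent-sym H
      ; dense = dense }

    hamilton : Hamiltonian H
    hamilton = cycle-through one-cycle
      where
      open Finished setting
      open Permutes n
      3≤n : 3 ≤ n
      3≤n = ≤-trans (+-mono-≤ 1≤k (s≤s 1≤k)) window≤n
        where
        1≤k : 1 ≤ k
        1≤k = >-nonZero⁻¹ k {{m*n≢0 (16 * q) s {{m*n≢0 16 q}}}}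
      cycle-through : ∃[ τ ] Perm τ × (∀ x → x < n → adjacent H x (τ x) ≡ true) × (∀ x → x < n → Reach τ _ x) → Hamiltonian H
      cycle-through (τ , τ-perm , τ-adj , all) = FromSetting.hamiltonian setting 3≤n H
        (λ x y e → ⌊⌋-true⁻ (adj? H (vertex x) (vertex y)) e) τ τ-perm _ u₀<n τ-adj (λ {x} → all x)

-- The threshold and the choice of Q

module Conclusion where

  open import Data.Nat
  open import Data.Nat.Properties
  open import Data.Product using (∃-syntax; _×_; _,_; proj₁; proj₂)
  open import Data.Rational using (½)
  open import Relation.Binary.PropositionalEquality
  open import Defs using (ℝ; fromℕ; fromℚ; recip; Graph; degree; Is_-SubgraphOf; power; cycle; Hamiltonian)
    renaming (_<_ to _<ᴿ_; _≤_ to _≤ᴿ_; _+_ to _+ᴿ_; _^_ to _^ᴿ_)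
  open Sums
  open Reals using (degree-bound)
  open Reduction using (root; module Parameters)

  -- Makes the integer 20th root `Q` of `k` at least `2 ^ 20`, which dominates every numerical
  -- constant of the parameters.
  threshold : ℕ
  threshold = (2 ^ 20) ^ 20

  -- For the integer root, `k < (Q + 1) ^ e ≤ (2 Q) ^ e`, and `2 ^ e ≤ Q` bounds this by
  -- `Q ^ (e + 1)`.
  large-root : ∀ e f k → .{{_ : NonZero e}} → suc e ≤ f → (2 ^ e) ^ e ≤ k → ∃[ Q ] 2 ^ e ≤ Q × Q ^ e ≤ k × k < Q ^ f
  large-root e f k e<f large = Q , 2^e≤Q , proj₁ bounds , <-≤-trans (proj₂ bounds) (begin
      suc Q ^ e          ≤⟨ ^-monoˡ-≤ e (≤-trans (+-monoˡ-≤ Q 1≤Q) (≤-reflexive (cong (Q +_) (sym (+-identityʳ Q))))) ⟩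
      (2 * Q) ^ e        ≡⟨ power-* e 2 Q ⟩
      2 ^ e * Q ^ e      ≤⟨ *-monoˡ-≤ (Q ^ e) 2^e≤Q ⟩
      Q ^ suc e          ≤⟨ ^-monoʳ-≤ Q {{>-nonZero 1≤Q}} e<f ⟩
      Q ^ f              ∎)
    where
    open ≤-Reasoning
    Q : ℕ
    Q = proj₁ (root e k)
    bounds : Q ^ e ≤ k × k < suc Q ^ e
    bounds = proj₂ (root e k)
    2^e≤Q : 2 ^ e ≤ Q
    2^e≤Q = ≮⇒≥ λ Q<2^e → <-irrefl refl (<-≤-trans (proj₂ bounds) (≤-trans (^-monoˡ-≤ e Q<2^e) large))
    1≤Q : 1 ≤ Q
    1≤Q = ≤-trans (m^n>0 2 e) 2^e≤Q
    power-* : ∀ e a b → (a * b) ^ e ≡ a ^ e * b ^ e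
    power-* zero    a b = refl
    power-* (suc e) a b = trans (cong (a * b *_) (power-* e a b)) ([m*n]*[o*p]≡[m*o]*[n*p] a b (a ^ e) (b ^ e))

  hamiltonian-subgraph : ∀ (ε : ℝ) (ε>0 : fromℕ 0 <ᴿ ε) (n k : ℕ) → k ≤ n → recip ε ε>0 ^ᴿ 121 ≤ᴿ fromℕ k → threshold ≤ k →
    ∀ (H : Graph n) → Is (fromℚ ½ +ᴿ ε) -SubgraphOf H (power (cycle n) k) → Hamiltonian H
  hamiltonian-subgraph ε ε>0 n k k≤n ε-large threshold≤k H (H⊆G , degrees) = conclude (large-root 20 121 k (m≤m+n 21 100) threshold≤k)
    where
    conclude : ∃[ Q ] 2 ^ 20 ≤ Q × Q ^ 20 ≤ k × k < Q ^ 121 → Hamiltonian H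
    conclude (Q , Q-large , Q^20≤k , k<Q^121) =
      Parameters.hamilton n k Q {{>-nonZero (≤-trans (≤-trans (m^n>0 Q {{>-nonZero 1≤Q}} 20) Q^20≤k) k≤n)}} k≤n Q-large Q^20≤k H H⊆G
        λ v → degree-bound ε ε>0 k Q 1≤Q k<Q^121 ε-large (degree (power (cycle n) k) v) (degree H v) (degrees v)
      where
      1≤Q : 1 ≤ Q
      1≤Q = ≤-trans (m≤m+n 1 1048575) Q-large

open import Defs
open import Data.Nat as ℕ using (ℕ)
open import Data.Product using (∃-syntax; _,_)
open import Data.Rational using (½)

theorem1p2 : ∃[ k₀ ] (∀ (ε : ℝ) (ε>0 : fromℕ 0 < ε) (n k : ℕ) →
    k ℕ.≤ n →
    recip ε ε>0 ^ 121 ≤ fromℕ k →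
    k₀ ℕ.≤ k →
    ∀ (H : Graph n) →
    Is (fromℚ ½ + ε) -SubgraphOf H (power (cycle n) k) →
    Hamiltonian H)
theorem1p2 = Conclusion.threshold , Conclusion.hamiltonian-subgraph
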